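{- Let $G$ be a connected triangle-free subcubic graph on $n$ vertices. Then $\alpha(G) \geq \frac{11}{30}n - \frac{1}{15}$, unless $G$ is isomorphic to $F_{14}^{(1)}$ or $F_{14}^{(2)}$, in which case $\alpha(G) = \frac{11}{30}n - \frac{2}{15}$.
   Context: Graphs are finite, simple, undirected; subcubic = maximum degree at most $3$; $\alpha$ = independence number. $F_{14}^{(1)}$: vertices $v_1,\dots,v_6,w_1,\dots,w_6,y_1,y_5$; edges of the $6$-cycle $v_1v_2\cdots v_6v_1$, $v_iw_i$ ($1\le i\le 6$), $w_1w_3,w_3w_5,w_2w_4,w_4w_6,w_1y_1,w_5y_5,y_1y_5,y_1w_6,y_5w_2$. $F_{14}^{(2)}$: vertices $v_1,\dots,v_6,w_1,w_2,w_3,w_4,w_6,y_1,y_2,y_4$; edges of the $6$-cycle $v_1\cdots v_6v_1$, $v_1w_1,v_2w_2,v_3w_3,v_4w_4,v_5w_2,v_6w_6$, $w_1w_3,w_4w_6,w_1y_1,w_2y_2,w_4y_4,y_1y_2,y_2y_4,y_1w_6,y_4w_3$. -}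

module Defs where

open import Data.Bool using (Bool; true; false; if_then_else_; _∨_; _∧_)
open import Data.Nat using (ℕ; zero; suc; _≡ᵇ_; _≤_; _+_; _*_)
open import Data.Fin using (Fin; toℕ)
open import Data.Fin.Subset using (Subset; _∈_; ∣_∣)
open import Data.List using (List; []; _∷_; map; allFin)
open import Data.Nat.ListAction using (sum)
open import Data.Bool.ListAction using (any)
open import Data.Product using (Σ; _×_; _,_; ∃)
open import Relation.Binary.PropositionalEquality using (_≡_)
open import Function.Bundles using (_⤖_; Bijection)

record Graph : Set where
  field
    n   : ℕ
    adj : Fin n → Fin n → Bool
open Graph public

Simple : Graph → Set
Simple G = (∀ u v → adj G u v ≡ adj G v u) × (∀ u → adj G u u ≡ false)

deg : (G : Graph) → Fin (n G) → ℕ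
deg G u = sum (map (λ v → if adj G u v then 1 else 0) (allFin (n G)))

Subcubic : Graph → Set
Subcubic G = ∀ u → deg G u ≤ 3

TriangleFree : Graph → Set
TriangleFree G = ∀ u v w → adj G u v ≡ true → adj G v w ≡ true → adj G u w ≡ true → Data.Empty.⊥
  where import Data.Empty

data Walk (G : Graph) : Fin (n G) → Fin (n G) → Set where
  here : ∀ {u} → Walk G u u
  step : ∀ {u w v} → adj G u w ≡ true → Walk G w v → Walk G u v

Connected : Graph → Set
Connected G = ∀ u v → Walk G u v

Independent : (G : Graph) → Subset (n G) → Set
Independent G S = ∀ u v → u ∈ S → v ∈ S → adj G u v ≡ false

IsIndependenceNumber : Graph → ℕ → Set
IsIndependenceNumber G a =
  (Σ (Subset (n G)) λ S → Independent G S × ∣ S ∣ ≡ a) ×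
  (∀ S → Independent G S → ∣ S ∣ ≤ a)

Isomorphic : Graph → Graph → Set
Isomorphic G H = Σ (Fin (n G) ⤖ Fin (n H)) λ f →
  ∀ u v → adj H (Bijection.to f u) (Bijection.to f v) ≡ adj G u v

edgeAdj : (k : ℕ) → List (ℕ × ℕ) → Fin k → Fin k → Bool
edgeAdj k es u v = any (λ { (a , b) → ((a ≡ᵇ toℕ u) ∧ (b ≡ᵇ toℕ v)) ∨ ((a ≡ᵇ toℕ v) ∧ (b ≡ᵇ toℕ u)) }) es

-- F14^(1): v1..v6 ↦ 0..5, w1..w6 ↦ 6..11, y1 ↦ 12, y5 ↦ 13
F14-1 : Graph
F14-1 = record { n = 14 ; adj = edgeAdj 14 es }
  where
  es : List (ℕ × ℕ)
  es = (0 , 1) ∷ (1 , 2) ∷ (2 , 3) ∷ (3 , 4) ∷ (4 , 5) ∷ (5 , 0)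
     ∷ (0 , 6) ∷ (1 , 7) ∷ (2 , 8) ∷ (3 , 9) ∷ (4 , 10) ∷ (5 , 11)
     ∷ (6 , 8) ∷ (8 , 10) ∷ (7 , 9) ∷ (9 , 11)
     ∷ (6 , 12) ∷ (10 , 13) ∷ (12 , 13) ∷ (12 , 11) ∷ (13 , 7) ∷ []

-- F14^(2): v1..v6 ↦ 0..5, w1 ↦ 6, w2 ↦ 7, w3 ↦ 8, w4 ↦ 9, w6 ↦ 10,
--          y1 ↦ 11, y2 ↦ 12, y4 ↦ 13
F14-2 : Graph
F14-2 = record { n = 14 ; adj = edgeAdj 14 es }
  where
  es : List (ℕ × ℕ)
  es = (0 , 1) ∷ (1 , 2) ∷ (2 , 3) ∷ (3 , 4) ∷ (4 , 5) ∷ (5 , 0)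
     ∷ (0 , 6) ∷ (1 , 7) ∷ (2 , 8) ∷ (3 , 9) ∷ (4 , 7) ∷ (5 , 10)
     ∷ (6 , 8) ∷ (9 , 10)
     ∷ (6 , 11) ∷ (7 , 12) ∷ (9 , 13) ∷ (11 , 12) ∷ (12 , 13) ∷ (11 , 10) ∷ (13 , 8) ∷ []

{-# OPTIONS --safe #-}
-- Write λ = 15 α − 7 n + m.  For a connected triangle-free subcubic graph the bound follows from λ ≥ −1,
-- since 2 m ≤ 3 n.  Three operations move between graphs: deleting the closed neighbourhood of an
-- independent set; suppressing two adjacent vertices of degree 2 (the path p − s − t − q becomes the edge
-- p q, and λ drops by 3); adding an edge.  By a joint induction on the number of vertices:
--   * if every component has a vertex of degree at most 2 and there is no copy of a certain graph F₈ on
--     8 vertices, then λ ≥ 0: a vertex of degree 2 with two neighbours of degree 3 is deleted for free,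
--     adjacent vertices of degree 2 are suppressed unless they lie in a 5-cycle;
--   * if moreover the girth is at least 6, then 2 λ ≥ min (6 , Σ (3 − deg)), because suppression never
--     fails and deletion increases the deficiency;
--   * a connected graph containing F₈ has λ ≥ −1: three vertices of F₈ can be chosen unless all four
--     neighbours of F₈ are chosen, which an extra edge between two of these neighbours prevents;
--   * in a connected cubic graph, deleting N[v] costs 4, and 3 are regained by the second statement when
--     the girth is at least 6, and by suppressing the edge opposite to v in a 5-cycle v x s t y otherwise.
--     The suppression fails only if the edge lies in a second 5-cycle, up to small cuts, and then the
--     5-cycles close up to one of the two exceptional graphs or to a configuration that can be deleted.

module Submission where

open import Data.Bool using (Bool; true; false; if_then_else_; _∧_; _∨_; not; T)
open import Data.Bool.Properties using (∧-comm; ∨-comm) renaming (_≟_ to _≟ᵇ_)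
open import Data.Empty using (⊥; ⊥-elim)
open import Data.Fin using (Fin; zero; suc; toℕ; fromℕ<; #_)
open import Data.Fin.Properties using (_≟_; any?; all?; toℕ<n; toℕ-injective; toℕ-fromℕ<)
open import Data.List using (List; []; _∷_; _++_; map; length; filter; filterᵇ; allFin; upTo; concatMap)
open import Data.Nat.ListAction using () renaming (sum to sumL)
open import Data.List.Membership.Propositional using (_∈_; _∉_)
open import Data.List.Relation.Unary.Any using (here; there)
open import Data.List.Relation.Unary.All as All using (All; []; _∷_)
open import Data.List.Relation.Unary.AllPairs using ([]; _∷_)
open import Data.List.Relation.Unary.Unique.Propositional using (Unique)
open import Data.Nat using (ℕ; _∸_; zero; suc; _+_; _*_; _≤_; _<_; z≤n; s≤s; _≤?_; _<?_; _⊔_; _⊓_; _≡ᵇ_; _<ᵇ_; _≤ᵇ_)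
open import Data.Nat.Properties using (*-comm; +-cancelʳ-≤; <-irrefl; ≡ᵇ⇒≡; ≡⇒≡ᵇ; <ᵇ⇒<; <⇒<ᵇ; ≤ᵇ⇒≤; ≤⇒≤ᵇ; ⊔-lub; ≰⇒≥; m≤n⇒m⊓n≡m; m≥n⇒m⊓n≡n; <⇒≢; m<n⇒m<1+n; m≤n⇒m<n∨m≡n; m∸n+n≡m; m∸n≤m; n<1+n; ≮⇒≥; +-0-commutativeMonoid; ≤-refl; ≤-trans; ≤-reflexive; +-mono-≤; *-mono-≤; m≤m+n; m≤n+m; +-identityʳ; +-comm; *-distribˡ-+; *-distribʳ-+; *-identityʳ; *-zeroʳ; ≤-antisym; ≰⇒>; +-monoʳ-≤; +-monoˡ-≤; n≤0⇒n≡0; ≤-pred) renaming (_≟_ to _≟ℕ_)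
open import Data.Nat.Tactic.RingSolver using (solve-∀)
open import Data.Product using (Σ; ∃; _×_; _,_; proj₁; proj₂)
open import Data.Sum using (_⊎_; inj₁; inj₂)
open import Function using (_∘_; id)
open import Relation.Binary.PropositionalEquality using (_≡_; _≢_; refl; sym; trans; cong; cong₂; subst; subst₂; module ≡-Reasoning)
open import Relation.Nullary using (¬_; Dec; yes; no; does)
open import Relation.Nullary.Decidable using (dec-true; dec-false; _×-dec_; _→-dec_; map′; toWitness)
open import Data.Fin.Subset.Properties using (anySubset?)
open import Data.List.Membership.Propositional.Properties using (∈-filter⁺; ∈-filter⁻; ∈-allFin; ∈-map⁺; ∈-map⁻; ∈-++⁺ˡ; ∈-++⁺ʳ; ∈-upTo⁺; ∈-upTo⁻)
open import Data.List.Relation.Unary.Unique.Propositional.Properties using (filter⁺; allFin⁺; map⁺; ++⁺)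
open import Data.Vec using (Vec; []; _∷_; lookup; tabulate)
open import Data.Vec.Properties using (lookup∘tabulate; tabulate∘lookup; []=⇒lookup; lookup⇒[]=)
open import Defs hiding (here; step) renaming (deg to degree-of)
open import Data.List.Relation.Unary.Unique.DecPropositional using (unique?)
open import Data.List.Properties using (length-map; length-tabulate; map-tabulate)
open import Data.Fin.Subset using (∣_∣) renaming (_∈_ to _∈ˢ_)
open import Function.Bundles using (_⤖_; Bijection; mk⤖)
open import Algebra.Properties.CommutativeMonoid.Sum +-0-commutativeMonoid using (sum-cong-≗; ∑-distrib-+; ∑-comm; sum-replicate-zero) renaming (sum to ∑)

-- Deleting closed neighbourhoods is not enough by itself for λ ≥ -1: the rest may fall apart, and λ
-- adds up over components, so every component could contribute a deficit. Hence the auxiliary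
-- bounds with λ ≥ 0, which survive disjoint union. Their exclusions are forced: F₈ has n = 8, m =
-- 10, α = 3, hence λ = -1 in spite of its vertices of degree 2; the exceptional graphs have n = 14,
-- m = 21, α = 5, hence λ = -2. Suppression therefore still gains 1 when it produces an exceptional
-- component. All inequalities are stated for 2 λ, with degree sums in place of m, so the constants
-- of the code are doubled: a loss of 2 is tolerated in the end, suppression gains 6, an exceptional
-- graph misses 4. The long case analyses are trees of partial neighbourhoods evaluated by `check`;
-- one soundness proof serves all seven of them.

-- Linear arithmetic: a is a sum of hypotheses, k the slack, and the equation is left to the ring solver.
lin : ∀ {a b e f} k → a ≤ b → e + b + k ≡ f + a → e ≤ f
lin {a} {b} {e} {f} k a≤b eq = +-cancelʳ-≤ b e f
  (≤-trans (m≤m+n (e + b) k) (≤-trans (≤-reflexive eq) (+-monoʳ-≤ f a≤b)))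

-- Indicators, finite sums and Boolean reflection

ind : Bool → ℕ
ind b = if b then 1 else 0

*-distribˡ-∑ : ∀ {n} c (f : Fin n → ℕ) → c * ∑ f ≡ ∑ (λ i → c * f i)
*-distribˡ-∑ {zero}  c f = *-zeroʳ c
*-distribˡ-∑ {suc n} c f = trans (*-distribˡ-+ c (f zero) _) (cong (c * f zero +_) (*-distribˡ-∑ c (f ∘ suc)))

∑-mono : ∀ {n} {f g : Fin n → ℕ} → (∀ i → f i ≤ g i) → ∑ f ≤ ∑ g
∑-mono {zero}  f≤g = z≤n
∑-mono {suc n} f≤g = +-mono-≤ (f≤g zero) (∑-mono (f≤g ∘ suc))

∑-bound : ∀ {n} (f : Fin n → ℕ) i → f i ≤ ∑ f
∑-bound f zero    = m≤m+n _ _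
∑-bound f (suc i) = ≤-trans (∑-bound (f ∘ suc) i) (m≤n+m _ (f zero))

∑-zero : ∀ {n} (f : Fin n → ℕ) → (∀ i → f i ≡ 0) → ∑ f ≡ 0
∑-zero {n} f h = trans (sum-cong-≗ h) (sum-replicate-zero n)

ind-true : ∀ {b} → b ≡ true → ind b ≡ 1
ind-true refl = refl

ind-false : ∀ {b} → b ≡ false → ind b ≡ 0
ind-false refl = refl

ind≤1 : ∀ b → ind b ≤ 1
ind≤1 true  = ≤-refl
ind≤1 false = z≤n

∧-true : ∀ {a b} → a ∧ b ≡ true → a ≡ true × b ≡ true
∧-true {true} p = refl , p

∧-intro : ∀ {a b} → a ≡ true → b ≡ true → a ∧ b ≡ true
∧-intro refl p = p

not-true : ∀ {a} → not a ≡ true → a ≡ false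
not-true {false} _ = refl

t≢f : ∀ {a} → a ≡ true → a ≡ false → ⊥
t≢f refl ()

¬true : ∀ {a} → ¬ (a ≡ true) → a ≡ false
¬true {true}  h = ⊥-elim (h refl)
¬true {false} h = refl

bool? : ∀ b → (b ≡ true) ⊎ (b ≡ false)
bool? true  = inj₁ refl
bool? false = inj₂ refl

∑-δ : ∀ {n} (i : Fin n) (f : Fin n → ℕ) → ∑ (λ x → ind (does (x ≟ i)) * f x) ≡ f i
∑-δ {suc n} zero f = trans (cong₂ _+_ (+-identityʳ (f zero)) (∑-zero {n} (λ _ → 0) λ _ → refl)) (+-identityʳ (f zero))
∑-δ (suc i) f = ∑-δ i (f ∘ suc)


T⇒ : ∀ {b} → T b → b ≡ true
T⇒ {true} _ = refl

⇒T : ∀ {b} → b ≡ true → T b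
⇒T refl = _

∨-case : ∀ {a b} → a ∨ b ≡ true → a ≡ true ⊎ b ≡ true
∨-case {true}  p = inj₁ refl
∨-case {false} p = inj₂ p

∨-left : ∀ {a b} → a ≡ true → a ∨ b ≡ true
∨-left refl = refl

∨-right : ∀ {a b} → b ≡ true → a ∨ b ≡ true
∨-right {true}  refl = refl
∨-right {false} refl = refl

not-false : ∀ {a} → a ≡ false → not a ≡ true
not-false refl = refl

elem : ℕ → List ℕ → Bool
elem i []       = false
elem i (x ∷ xs) = (i ≡ᵇ x) ∨ elem i xs

elem⁻ : ∀ {i xs} → elem i xs ≡ true → i ∈ xs
elem⁻ {i} {x ∷ xs} h with ∨-case {i ≡ᵇ x} h
... | inj₁ e = here (≡ᵇ⇒≡ i x (⇒T e))
... | inj₂ e = there (elem⁻ e)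

elem⁺ : ∀ {i xs} → i ∈ xs → elem i xs ≡ true
elem⁺ {i} (here refl) = ∨-left (T⇒ (≡⇒≡ᵇ i i refl))
elem⁺ {i} {x ∷ _} (there m) = ∨-right {i ≡ᵇ x} (elem⁺ m)

elem-∉ : ∀ {i xs} → i ∉ xs → elem i xs ≡ false
elem-∉ h = ¬true (h ∘ elem⁻)

allᵇ : ∀ {A : Set} → (A → Bool) → List A → Bool
allᵇ f []       = true
allᵇ f (x ∷ xs) = f x ∧ allᵇ f xs

allᵇ⁻ : ∀ {A : Set} {f : A → Bool} {xs x} → allᵇ f xs ≡ true → x ∈ xs → f x ≡ true
allᵇ⁻ {f = f} {y ∷ _} h (here refl) = proj₁ (∧-true {f y} h)
allᵇ⁻ {f = f} {y ∷ _} h (there m)   = allᵇ⁻ (proj₂ (∧-true {f y} h)) m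

allᵇ-All : ∀ {A : Set} {f : A → Bool} {P : A → Set} {xs} → (∀ {x} → f x ≡ true → P x) → allᵇ f xs ≡ true → All P xs
allᵇ-All {xs = []}     g h = []
allᵇ-All {f = f} {xs = x ∷ xs} g h = g (proj₁ (∧-true {f x} h)) ∷ allᵇ-All g (proj₂ (∧-true {f x} h))

allᵇ⁺ : ∀ {A : Set} {f : A → Bool} {xs} → (∀ {x} → x ∈ xs → f x ≡ true) → allᵇ f xs ≡ true
allᵇ⁺ {xs = []}     g = refl
allᵇ⁺ {xs = x ∷ xs} g = ∧-intro (g (here refl)) (allᵇ⁺ (g ∘ there))

anyᵇ : ∀ {A : Set} → (A → Bool) → List A → Bool
anyᵇ f []       = false
anyᵇ f (x ∷ xs) = f x ∨ anyᵇ f xs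

anyᵇ⁻ : ∀ {A : Set} {f : A → Bool} {xs} → anyᵇ f xs ≡ true → ∃ λ x → x ∈ xs × f x ≡ true
anyᵇ⁻ {f = f} {x ∷ xs} h with ∨-case {f x} h
... | inj₁ e = x , here refl , e
... | inj₂ e with anyᵇ⁻ {xs = xs} e
... | y , m , p = y , there m , p

uniqᵇ : List ℕ → Bool
uniqᵇ []       = true
uniqᵇ (x ∷ xs) = not (elem x xs) ∧ uniqᵇ xs

uniq⁻ : ∀ {xs} → uniqᵇ xs ≡ true → Unique xs
uniq⁻ {[]}     h = []
uniq⁻ {x ∷ xs} h = All.tabulate (λ {y} m e → t≢f (elem⁺ {x} (subst (_∈ xs) (sym e) m)) (not-true (proj₁ (∧-true {not (elem x xs)} h))))
                 ∷ uniq⁻ (proj₂ (∧-true {not (elem x xs)} h))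

<ᵇ⁻ : ∀ {i k} → (i <ᵇ k) ≡ true → i < k
<ᵇ⁻ {i} {k} h = <ᵇ⇒< i k (⇒T h)

≤ᵇ⁻ : ∀ {i k} → (i ≤ᵇ k) ≡ true → i ≤ k
≤ᵇ⁻ {i} {k} h = ≤ᵇ⇒≤ i k (⇒T h)

≡ᵇ⁻ : ∀ {i k} → (i ≡ᵇ k) ≡ true → i ≡ k
≡ᵇ⁻ {i} {k} h = ≡ᵇ⇒≡ i k (⇒T h)

≡ᵇ-refl : ∀ i → (i ≡ᵇ i) ≡ true
≡ᵇ-refl i = T⇒ (≡⇒≡ᵇ i i refl)

≡ᵇ-≢ : ∀ {i k} → i ≢ k → (i ≡ᵇ k) ≡ false
≡ᵇ-≢ h = ¬true (h ∘ ≡ᵇ⁻)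

_‼_ : List ℕ → ℕ → ℕ
[]       ‼ i     = 0
(x ∷ xs) ‼ zero  = x
(x ∷ xs) ‼ suc i = xs ‼ i

‼∈ : ∀ {xs i} → i < length xs → xs ‼ i ∈ xs
‼∈ {x ∷ xs} {zero}  h       = here refl
‼∈ {x ∷ xs} {suc i} (s≤s h) = there (‼∈ h)

‼-inj : ∀ {xs i j} → Unique xs → i < length xs → j < length xs → xs ‼ i ≡ xs ‼ j → i ≡ j
‼-inj {x ∷ xs} {zero}  {zero}  u h k e = refl
‼-inj {x ∷ xs} {zero}  {suc j} (x∉ ∷ u) h (s≤s k) e = ⊥-elim (All.lookup x∉ (‼∈ k) e)
‼-inj {x ∷ xs} {suc i} {zero}  (x∉ ∷ u) (s≤s h) k e = ⊥-elim (All.lookup x∉ (‼∈ h) (sym e))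
‼-inj {x ∷ xs} {suc i} {suc j} (x∉ ∷ u) (s≤s h) (s≤s k) e = cong suc (‼-inj u h k e)

-- Certificates for finite case analyses

Edges : Set
Edges = List (ℕ × ℕ)

edgeᵇ : ℕ → ℕ → Edges → Bool
edgeᵇ a b []             = false
edgeᵇ a b ((c , d) ∷ es) = ((a ≡ᵇ c) ∧ (b ≡ᵇ d)) ∨ edgeᵇ a b es

edgeᵇ⁻ : ∀ {a b es} → edgeᵇ a b es ≡ true → (a , b) ∈ es
edgeᵇ⁻ {a} {b} {(c , d) ∷ es} h with ∨-case {(a ≡ᵇ c) ∧ (b ≡ᵇ d)} h
... | inj₁ e = here (cong₂ _,_ (≡ᵇ⁻ (proj₁ (∧-true {a ≡ᵇ c} e))) (≡ᵇ⁻ (proj₂ (∧-true {a ≡ᵇ c} e))))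
... | inj₂ e = there (edgeᵇ⁻ e)

nb : Edges → ℕ → List ℕ
nb []             i = []
nb ((a , b) ∷ es) i = if a ≡ᵇ i then b ∷ nb es i else if b ≡ᵇ i then a ∷ nb es i else nb es i

-- Partial knowledge of a neighbourhood: vertices 0 … k−1, some of their edges, and a list of
-- vertices all of whose edges are known.
record Cfg : Set where
  constructor cfg
  field
    k   : ℕ
    fin : List ℕ
    es  : Edges

-- A subcubic graph has no room for a fourth neighbour, so three known ones settle a vertex. The
-- duplicate test turns the length of the list into a number of distinct neighbours.
isClosed : Cfg → ℕ → Bool
isClosed c i = (elem i (Cfg.fin c) ∨ (3 ≤ᵇ length (nb (Cfg.es c) i))) ∧ uniqᵇ (nb (Cfg.es c) i)

dedup : List ℕ → List ℕ
dedup []       = []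
dedup (x ∷ xs) = if elem x xs then dedup xs else x ∷ dedup xs

Pat : Set
Pat = ℕ × Edges

-- In every occurrence of pat whose vertices in low have degree at most 2, the vertices ri and rj have a
-- common neighbour that is neither in exclude nor adjacent to a vertex of it (unless the goal holds).
record Rule : Set where
  constructor mkRule
  field
    pat     : Pat
    low     : List ℕ
    ri rj   : ℕ
    exclude : List ℕ

-- `kills` lists patterns known not to occur, `leafOK` is the numerical test that ends a branch, and
-- `isoOK` tells whether an exceptional graph is an admissible outcome.
record Mode : Set where
  field
    noC4   : Bool
    minDeg : ℕ
    kills  : List Pat
    rules  : List Rule
    leafOK : Cfg → List ℕ → Bool
    isoOK  : Bool

commonᵇ : Edges → ℕ → ℕ → Bool
commonᵇ es i j = anyᵇ (λ a → elem a (nb es j)) (nb es i)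

path3ᵇ : Edges → ℕ → ℕ → Bool
path3ᵇ es i j = anyᵇ (λ a → anyᵇ (λ b → not (b ≡ᵇ i) ∧ (not (a ≡ᵇ j) ∧ elem b (nb es a))) (nb es j)) (nb es i)

-- An upper approximation of adjacency: an unknown edge cannot meet a closed vertex, cannot join two
-- vertices with a common neighbour (triangle) and, with `c4`, cannot close a path of three edges
-- (4-cycle).
mayAdj : Bool → Cfg → ℕ → ℕ → Bool
mayAdj c4 c i j = elem j (nb es i) ∨
  (not (i ≡ᵇ j) ∧ (not (isClosed c i) ∧ (not (isClosed c j) ∧ (not (commonᵇ es i j) ∧ not (c4 ∧ path3ᵇ es i j)))))
  where open Cfg c

data Cert : Set where
  leaf : List ℕ → Cert
  kill : ℕ → List ℕ → Cert
  grow : ℕ → List Cert → Cert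
  rule : ℕ → List ℕ → List Cert → Cert
  iso  : Bool → List ℕ → Cert

finOpt : Mode → Cfg → ℕ → List Cfg
finOpt M (cfg k fin es) i = if Mode.minDeg M ≤ᵇ length (nb es i) then cfg k (i ∷ fin) es ∷ [] else []

oldOpt : Mode → Cfg → ℕ → List Cfg
oldOpt M c@(cfg k fin es) i = map (λ j → cfg k fin ((i , j) ∷ es))
  (filterᵇ (λ j → mayAdj (Mode.noC4 M) c i j ∧ not (elem j (nb es i))) (upTo k))

growOpts : Mode → Cfg → ℕ → List Cfg
growOpts M c@(cfg k fin es) i = finOpt M c i ++ (oldOpt M c i ++ (cfg (suc k) fin ((i , k) ∷ es) ∷ []))

-- A repeated edge would put a duplicate into a neighbour list and fail the test in `isClosed`.
addIf : ℕ → ℕ → Edges → Edges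
addIf i j es = if elem i (nb es j) then es else (i , j) ∷ es

okOld : Mode → Cfg → ℕ → ℕ → List ℕ → ℕ → Bool
okOld M c p q ex j = mayAdj (Mode.noC4 M) c p j ∧ (mayAdj (Mode.noC4 M) c q j ∧
  allᵇ (λ e → not (j ≡ᵇ e) ∧ not (elem j (nb (Cfg.es c) e))) ex)

ruleOpts : Mode → Cfg → ℕ → ℕ → List ℕ → List Cfg
ruleOpts M c@(cfg k fin es) p q ex =
  map (λ j → cfg k fin (addIf j p (addIf j q es))) (filterᵇ (okOld M c p q ex) (upTo k)) ++
  -- The common neighbour can be new only if both vertices may still have unknown edges.
  (if isClosed c p ∨ isClosed c q then [] else cfg (suc k) fin ((p , k) ∷ (q , k) ∷ es) ∷ [])

embᵇ : Cfg → Pat → List ℕ → Bool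
embᵇ (cfg k fin es) (pn , pes) js =
  (pn ≤ᵇ length js) ∧ (uniqᵇ js ∧ (allᵇ (λ j → j <ᵇ k) js ∧ allᵇ (λ e → elem (js ‼ proj₂ e) (nb es (js ‼ proj₁ e))) pes))

nth : ∀ {A : Set} → List A → ℕ → A → A
nth []       i       d = d
nth (x ∷ xs) zero    d = x
nth (x ∷ xs) (suc i) d = nth xs i d

lowᵇ : Cfg → ℕ → Bool
lowᵇ c i = isClosed c i ∧ (length (nb (Cfg.es c) i) ≤ᵇ 2)

-- A loop, which no graph here contains. It and `noRule` are only default values of `nth`, since
-- `check` tests the index as well.
noPat : Pat
noPat = 1 , ((0 , 0) ∷ [])

noRule : Rule
noRule = mkRule noPat [] 0 0 []

adjF : Bool → Fin 14 → Fin 14 → Bool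
adjF true  = Graph.adj F14-1
adjF false = Graph.adj F14-2

sameᵇ : Bool → Bool → Bool
sameᵇ true  b = b
sameᵇ false b = not b

isoᵇ : Cfg → Bool → List ℕ → Bool
isoᵇ c b js = (Cfg.k c ≡ᵇ 14) ∧ ((length js ≡ᵇ 14) ∧ (uniqᵇ js ∧ (allᵇ (λ j → (j <ᵇ 14) ∧ isClosed c j) js ∧
  (allᵇ (λ j → elem j js) (upTo 14) ∧ (allᵇ (λ j → length (nb (Cfg.es c) j) ≡ᵇ 3) js ∧
  allᵇ (λ x → allᵇ (λ y → sameᵇ (elem (js ‼ toℕ y) (nb (Cfg.es c) (js ‼ toℕ x))) (adjF b x y)) (allFin 14)) (allFin 14))))))

-- grow i branches over the next neighbour of vertex i: none, each old vertex that may be adjacent, a new one.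
mutual
  check : Mode → Cfg → Cert → Bool
  check M c (leaf I)      = Mode.leafOK M c I
  check M c (kill r js)   = embᵇ c (nth (Mode.kills M) r noPat) js ∧ (r <ᵇ length (Mode.kills M))
  check M c (grow i ts)   = (i <ᵇ Cfg.k c) ∧ (uniqᵇ (nb (Cfg.es c) i) ∧ checkAll M (growOpts M c i) ts)
  check M c (rule r js ts) = ruleᵇ M c (nth (Mode.rules M) r noRule) js ts ∧ (r <ᵇ length (Mode.rules M))
  check M c (iso b js)    = Mode.isoOK M ∧ isoᵇ c b js

  ruleᵇ : Mode → Cfg → Rule → List ℕ → List Cert → Bool
  ruleᵇ M c (mkRule pat low ri rj ex) js ts = embᵇ c pat js ∧ (allᵇ (λ a → lowᵇ c (js ‼ a)) low ∧
    ((allᵇ (λ a → a <ᵇ proj₁ pat) (ri ∷ rj ∷ low) ∧ allᵇ (λ a → a <ᵇ proj₁ pat) ex) ∧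
    checkAll M (ruleOpts M c (js ‼ ri) (js ‼ rj) (map (js ‼_) ex)) ts))

  checkAll : Mode → List Cfg → List Cert → Bool
  checkAll M []       ts       = true
  checkAll M (c ∷ cs) []       = false
  checkAll M (c ∷ cs) (t ∷ ts) = check M c t ∧ checkAll M cs ts

-- The closed neighbourhood of `I`, once all vertices of `I` are closed; `structᵇ` tests this and
-- the independence of `I`.
removed : Cfg → List ℕ → List ℕ
removed c I = dedup (I ++ concatMap (nb (Cfg.es c)) I)

structᵇ : Cfg → List ℕ → Bool
structᵇ c I = (1 ≤ᵇ length I) ∧ (allᵇ (λ i → isClosed c i ∧ allᵇ (λ j → elem j X ∧ not (elem j I)) (nb (Cfg.es c) i)) I ∧
  (uniqᵇ I ∧ (uniqᵇ X ∧ (allᵇ (λ x → elem x X) I ∧ (allᵇ (λ x → x <ᵇ Cfg.k c) X ∧ allᵇ (λ x → uniqᵇ (nb (Cfg.es c) x)) X)))))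
  where X = removed c I

lowDeg : ℕ → Cfg → ℕ → ℕ
lowDeg m c x = length (nb (Cfg.es c) x) ⊔ (if isClosed c x then 0 else m)

within : Bool → Cfg → List ℕ → ℕ → ℕ
within c4 c X x = length (filterᵇ (mayAdj c4 c x) X)

loSum hiSum : Bool → ℕ → Cfg → List ℕ → ℕ
loSum c4 m c X = sumL (map (lowDeg m c) X)
hiSum c4 m c X = sumL (map (λ x → lowDeg m c x ⊓ within c4 c X x) X)

knownSum : Cfg → List ℕ → ℕ
knownSum c X = sumL (map (λ x → length (filterᵇ (λ y → elem y (nb (Cfg.es c) x)) X)) X)

-- The gain of deleting the closed neighbourhood X of an independent set I: with d the least possible
-- degree of x ∈ X, the contribution 14 − 2 deg x + deg_X x is at most 14 − 2 d + min (d , possible neighbours in X).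
gainᵇ : Bool → ℕ → ℕ → ℕ → Cfg → List ℕ → Bool
gainᵇ c4 m a b c I = structᵇ c I ∧
  (14 * length X + hiSum c4 m c X + a ≤ᵇ 30 * length I + 2 * loSum c4 m c X + b)
  where X = removed c I

-- Used when the rest is only known to satisfy 2 λ ≥ -2 e, with e the number of its edges to X (see
-- `touch`). Each such edge adds 2 to the degree sum, which cancels this debt. Only edges inside X
-- remain to be counted, and the known ones bound them from below. The final 2 is the tolerated
-- loss.
crudeᵇ : Cfg → List ℕ → Bool
crudeᵇ c I = structᵇ c I ∧ (14 * length X ≤ᵇ 30 * length I + knownSum c X + 2)
  where X = removed c I

-- eightPat is a 4-cycle with a pendant edge at each vertex, the ends of opposite pendant edges being joined.
squarePat pentPat fivePat eightPat earPat pathPat : Pat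
squarePat = 4 , (0 , 1) ∷ (1 , 2) ∷ (2 , 3) ∷ (3 , 0) ∷ []
fivePat   = 5 , (0 , 1) ∷ (1 , 2) ∷ (2 , 3) ∷ (3 , 4) ∷ (4 , 0) ∷ []
eightPat  = 8 , (0 , 1) ∷ (1 , 2) ∷ (2 , 3) ∷ (3 , 0) ∷ (0 , 4) ∷ (1 , 5) ∷ (2 , 6) ∷ (3 , 7) ∷ (4 , 6) ∷ (5 , 7) ∷ []
-- The 5-cycle 0, 1, 2, 3, 4 with pendant edges at the ends of 2 3, the edge opposite to 0.
pentPat   = 7 , (0 , 1) ∷ (0 , 4) ∷ (1 , 2) ∷ (4 , 3) ∷ (2 , 3) ∷ (2 , 5) ∷ (3 , 6) ∷ []
pathPat   = 4 , (0 , 1) ∷ (0 , 2) ∷ (1 , 3) ∷ []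
-- The path 2, 0, 1, 3 of `pathPat`, closed to a 5-cycle by a common neighbour 4 of its ends, with
-- pendant edges at 2 and 4.
earPat    = 7 , (0 , 1) ∷ (0 , 2) ∷ (1 , 3) ∷ (2 , 4) ∷ (3 , 4) ∷ (2 , 5) ∷ (4 , 6) ∷ []

oppositePat adjacentPat : Pat
oppositePat = 10 , (4 , 8) ∷ (6 , 9) ∷ proj₂ eightPat
adjacentPat = 10 , (4 , 8) ∷ (5 , 9) ∷ proj₂ eightPat

-- The last two numbers passed to `gainᵇ` are the `a` and `b` of the intended `Val E V a b`: 0 2
-- tolerates a loss of 2, while 2 0 demands a gain of 2.
squareMode pentMode splitMode lowMode eightMode loopMode girthMode : Mode
squareMode = record { noC4 = false ; minDeg = 3 ; kills = eightPat ∷ [] ; rules = [] ; leafOK = gainᵇ false 3 0 2 ; isoOK = false }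
pentMode   = record { noC4 = true ; minDeg = 3 ; kills = squarePat ∷ [] ; rules = mkRule pentPat [] 5 6 (0 ∷ []) ∷ []
                    ; leafOK = gainᵇ true 3 0 2 ; isoOK = true }
splitMode  = record { noC4 = true ; minDeg = 3 ; kills = squarePat ∷ [] ; rules = [] ; leafOK = gainᵇ true 3 0 2 ; isoOK = true }
lowMode    = record { noC4 = false ; minDeg = 2 ; kills = eightPat ∷ []
                    ; rules = mkRule pathPat (0 ∷ 1 ∷ []) 2 3 [] ∷ mkRule earPat (0 ∷ 1 ∷ []) 5 6 [] ∷ []
                    ; leafOK = gainᵇ false 2 0 0 ; isoOK = false }
eightMode  = record { noC4 = false ; minDeg = 1 ; kills = []
                    ; rules = mkRule oppositePat [] 8 9 [] ∷ mkRule adjacentPat [] 8 9 [] ∷ []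
                    ; leafOK = crudeᵇ ; isoOK = false }
loopMode   = record { noC4 = false ; minDeg = 0 ; kills = [] ; rules = [] ; leafOK = gainᵇ false 0 2 0 ; isoOK = false }
girthMode  = record { noC4 = false ; minDeg = 2 ; kills = squarePat ∷ fivePat ∷ [] ; rules = mkRule pathPat (0 ∷ 1 ∷ []) 2 3 [] ∷ []
                    ; leafOK = λ c I → gainᵇ false 2 0 0 c I ∧ (30 * length I ≤ᵇ 11 * length (removed c I)) ; isoOK = false }


fiveSet : Bool → List (Fin 14)
fiveSet true  = # 0 ∷ # 2 ∷ # 4 ∷ # 7 ∷ # 11 ∷ []
fiveSet false = # 0 ∷ # 2 ∷ # 4 ∷ # 9 ∷ # 11 ∷ []

fiveSet-indep : ∀ b → allᵇ (λ x → allᵇ (λ y → not (adjF b x y)) (fiveSet b)) (fiveSet b) ≡ true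
fiveSet-indep true  = refl
fiveSet-indep false = refl

fiveSet-unique : ∀ b → Unique (fiveSet b)
fiveSet-unique true  = toWitness {a? = unique? _≟_ (fiveSet true)} _
fiveSet-unique false = toWitness {a? = unique? _≟_ (fiveSet false)} _

fiveSet-length : ∀ b → length (fiveSet b) ≡ 5
fiveSet-length true  = refl
fiveSet-length false = refl

fiveSet-nonadj : ∀ b {x y} → x ∈ fiveSet b → y ∈ fiveSet b → adjF b x y ≡ false
fiveSet-nonadj b {x} m n = not-true (allᵇ⁻ {f = λ y → not (adjF b x y)} {xs = fiveSet b}
  (allᵇ⁻ {f = λ x → allᵇ (λ y → not (adjF b x y)) (fiveSet b)} {xs = fiveSet b} (fiveSet-indep b) m) n)

-- The certificates were found by computer search; each closes one of the finite case analyses.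

squareCfg : Cfg
squareCfg = cfg 4 [] ((0 , 1) ∷ (1 , 2) ∷ (2 , 3) ∷ (3 , 0) ∷ [])

squareCert : Cert
squareCert =
  grow 0 (grow 1 (grow 2 (leaf (0 ∷ 2 ∷ []) ∷ leaf (0 ∷ 2 ∷ []) ∷ []) ∷ []) ∷ [])

pentCfg : Cfg
pentCfg = cfg 5 [] ((0 , 1) ∷ (1 , 2) ∷ (2 , 3) ∷ (3 , 4) ∷ (4 , 0) ∷ [])

pentCert : Cert
pentCert =
  grow 0 (grow 1 (rule 0 (3 ∷ 4 ∷ 0 ∷ 1 ∷ 2 ∷ 5 ∷ 6 ∷ []) (grow 2 (rule 0 (4 ∷ 0 ∷ 1 ∷ 2 ∷ 3 ∷ 6 ∷ 8 ∷ [])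
  (grow 3 (rule 0 (0 ∷ 1 ∷ 2 ∷ 3 ∷ 4 ∷ 8 ∷ 9 ∷ []) (rule 0 (1 ∷ 6 ∷ 7 ∷ 8 ∷ 2 ∷ 5 ∷ 10 ∷ []) (leaf (0 ∷ 2 ∷ 7
  ∷ 9 ∷ []) ∷ rule 0 (6 ∷ 1 ∷ 0 ∷ 5 ∷ 7 ∷ 4 ∷ 11 ∷ []) (rule 0 (1 ∷ 2 ∷ 3 ∷ 4 ∷ 0 ∷ 9 ∷ 12 ∷ []) (grow 6 (iso
  false (0 ∷ 1 ∷ 2 ∷ 8 ∷ 7 ∷ 5 ∷ 4 ∷ 6 ∷ 3 ∷ 10 ∷ 11 ∷ 12 ∷ 13 ∷ 9 ∷ []) ∷ leaf (0 ∷ 2 ∷ 7 ∷ 9 ∷ 11 ∷ []) ∷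
  []) ∷ []) ∷ []) ∷ []) ∷ []) ∷ []) ∷ grow 3 (rule 0 (0 ∷ 1 ∷ 2 ∷ 3 ∷ 4 ∷ 8 ∷ 7 ∷ []) [] ∷ rule 0 (0 ∷ 1 ∷ 2
  ∷ 3 ∷ 4 ∷ 8 ∷ 10 ∷ []) (rule 0 (2 ∷ 1 ∷ 6 ∷ 9 ∷ 8 ∷ 7 ∷ 10 ∷ []) (leaf (0 ∷ 2 ∷ 6 ∷ 10 ∷ []) ∷ rule 0 (8 ∷
  2 ∷ 3 ∷ 10 ∷ 9 ∷ 4 ∷ 11 ∷ []) (rule 0 (2 ∷ 1 ∷ 0 ∷ 4 ∷ 3 ∷ 5 ∷ 12 ∷ []) (grow 8 (iso false (0 ∷ 5 ∷ 7 ∷ 11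
  ∷ 12 ∷ 4 ∷ 1 ∷ 13 ∷ 6 ∷ 10 ∷ 3 ∷ 2 ∷ 8 ∷ 9 ∷ []) ∷ leaf (0 ∷ 2 ∷ 6 ∷ 10 ∷ 12 ∷ []) ∷ []) ∷ []) ∷ []) ∷ [])
  ∷ grow 4 (rule 0 (1 ∷ 0 ∷ 4 ∷ 9 ∷ 6 ∷ 3 ∷ 8 ∷ []) [] ∷ rule 0 (1 ∷ 2 ∷ 3 ∷ 4 ∷ 0 ∷ 10 ∷ 12 ∷ []) (leaf (2 ∷
  6 ∷ 10 ∷ []) ∷ rule 0 (3 ∷ 2 ∷ 8 ∷ 11 ∷ 10 ∷ 9 ∷ 12 ∷ []) (rule 0 (2 ∷ 1 ∷ 0 ∷ 4 ∷ 3 ∷ 5 ∷ 12 ∷ []) (grow 7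
  (iso false (0 ∷ 5 ∷ 13 ∷ 9 ∷ 6 ∷ 1 ∷ 4 ∷ 7 ∷ 12 ∷ 8 ∷ 2 ∷ 3 ∷ 10 ∷ 11 ∷ []) ∷ leaf (0 ∷ 2 ∷ 6 ∷ 11 ∷ 13 ∷
  []) ∷ []) ∷ []) ∷ []) ∷ rule 0 (2 ∷ 1 ∷ 0 ∷ 4 ∷ 3 ∷ 5 ∷ 12 ∷ []) (rule 0 (0 ∷ 1 ∷ 6 ∷ 7 ∷ 5 ∷ 9 ∷ 12 ∷ [])
  (grow 5 (iso false (1 ∷ 0 ∷ 4 ∷ 12 ∷ 7 ∷ 6 ∷ 2 ∷ 5 ∷ 3 ∷ 13 ∷ 9 ∷ 8 ∷ 11 ∷ 10 ∷ []) ∷ leaf (0 ∷ 2 ∷ 6 ∷ 10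
  ∷ 12 ∷ []) ∷ []) ∷ []) ∷ rule 0 (4 ∷ 3 ∷ 10 ∷ 13 ∷ 12 ∷ 11 ∷ 5 ∷ []) (grow 9 (iso false (0 ∷ 4 ∷ 3 ∷ 10 ∷
  13 ∷ 5 ∷ 1 ∷ 12 ∷ 2 ∷ 11 ∷ 7 ∷ 6 ∷ 9 ∷ 8 ∷ []) ∷ leaf (0 ∷ 2 ∷ 6 ∷ 11 ∷ 13 ∷ []) ∷ []) ∷ []) ∷ grow 7 (leaf
  (0 ∷ 2 ∷ 7 ∷ 10 ∷ 12 ∷ []) ∷ leaf (0 ∷ 2 ∷ 7 ∷ 10 ∷ 12 ∷ []) ∷ rule 0 (0 ∷ 1 ∷ 6 ∷ 7 ∷ 5 ∷ 9 ∷ 15 ∷ [])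
  (leaf (2 ∷ 9 ∷ 10 ∷ []) ∷ rule 0 (1 ∷ 0 ∷ 5 ∷ 7 ∷ 6 ∷ 14 ∷ 15 ∷ []) (leaf (4 ∷ 10 ∷ 14 ∷ []) ∷ leaf (7 ∷ 9
  ∷ 14 ∷ []) ∷ rule 0 (0 ∷ 4 ∷ 12 ∷ 14 ∷ 5 ∷ 13 ∷ 17 ∷ []) (leaf (0 ∷ 2 ∷ 7 ∷ 9 ∷ 10 ∷ 12 ∷ []) ∷ []) ∷ []) ∷
  []) ∷ []) ∷ []) ∷ []) ∷ []) ∷ []) ∷ []) ∷ []) ∷ []) ∷ []) ∷ []) ∷ [])

-- F₈ with its edge 0 1 replaced by the path 0, 8, 9, 1, where 8 9 is the edge opposite to 12 in the
-- 5-cycle 12, 10, 8, 9, 11.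
splitCfg : Cfg
splitCfg = cfg 13 [] ((0 , 8) ∷ (8 , 9) ∷ (9 , 1) ∷ (1 , 2) ∷ (2 , 3) ∷ (3 , 0) ∷ (0 , 4) ∷ (1 , 5) ∷ (2 , 6) ∷ (3 , 7) ∷ (4 , 6) ∷ (5 , 7) ∷ (8 , 10) ∷ (9 , 11) ∷ (10 , 12) ∷ (11 , 12) ∷ [])

splitCert : Cert
splitCert =
  grow 4 (leaf (0 ∷ 2 ∷ 5 ∷ 9 ∷ []) ∷ grow 6 (leaf (0 ∷ 2 ∷ 10 ∷ []) ∷ grow 5 (leaf (0 ∷ 10 ∷ 11 ∷ []) ∷ leaf
  (1 ∷ 3 ∷ 8 ∷ []) ∷ grow 7 (grow 12 (iso false (0 ∷ 8 ∷ 10 ∷ 12 ∷ 11 ∷ 4 ∷ 3 ∷ 9 ∷ 7 ∷ 13 ∷ 6 ∷ 2 ∷ 1 ∷ 5 ∷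
  []) ∷ leaf (1 ∷ 6 ∷ 11 ∷ []) ∷ []) ∷ leaf (0 ∷ 7 ∷ 11 ∷ []) ∷ leaf (1 ∷ 3 ∷ 8 ∷ []) ∷ []) ∷ leaf (1 ∷ 6 ∷
  11 ∷ []) ∷ []) ∷ []) ∷ leaf (0 ∷ 2 ∷ 9 ∷ []) ∷ grow 5 (grow 6 (grow 7 (grow 12 (iso false (1 ∷ 9 ∷ 11 ∷ 12
  ∷ 10 ∷ 5 ∷ 2 ∷ 8 ∷ 6 ∷ 13 ∷ 7 ∷ 3 ∷ 0 ∷ 4 ∷ []) ∷ leaf (0 ∷ 7 ∷ 10 ∷ []) ∷ []) ∷ leaf (0 ∷ 7 ∷ 10 ∷ []) ∷
  []) ∷ leaf (0 ∷ 2 ∷ 9 ∷ []) ∷ leaf (0 ∷ 2 ∷ 9 ∷ []) ∷ []) ∷ leaf (1 ∷ 3 ∷ 8 ∷ []) ∷ grow 6 (leaf (0 ∷ 2 ∷ 9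
  ∷ []) ∷ grow 7 (grow 12 (iso true (0 ∷ 8 ∷ 10 ∷ 12 ∷ 13 ∷ 4 ∷ 3 ∷ 9 ∷ 7 ∷ 11 ∷ 5 ∷ 6 ∷ 2 ∷ 1 ∷ []) ∷ leaf
  (4 ∷ 8 ∷ 11 ∷ []) ∷ []) ∷ leaf (1 ∷ 3 ∷ 8 ∷ []) ∷ leaf (1 ∷ 3 ∷ 8 ∷ []) ∷ []) ∷ leaf (0 ∷ 2 ∷ 9 ∷ []) ∷
  leaf (0 ∷ 2 ∷ 9 ∷ []) ∷ []) ∷ grow 6 (leaf (0 ∷ 2 ∷ 9 ∷ []) ∷ grow 7 (leaf (0 ∷ 2 ∷ 5 ∷ 9 ∷ 10 ∷ []) ∷ leaf
  (1 ∷ 3 ∷ 8 ∷ []) ∷ leaf (1 ∷ 3 ∷ 8 ∷ []) ∷ leaf (1 ∷ 3 ∷ 8 ∷ []) ∷ []) ∷ leaf (0 ∷ 2 ∷ 9 ∷ []) ∷ leaf (0 ∷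
  2 ∷ 9 ∷ []) ∷ leaf (0 ∷ 2 ∷ 9 ∷ []) ∷ []) ∷ []) ∷ [])

eightCfg : Cfg
eightCfg = cfg 8 [] ((0 , 1) ∷ (1 , 2) ∷ (2 , 3) ∷ (3 , 0) ∷ (0 , 4) ∷ (1 , 5) ∷ (2 , 6) ∷ (3 , 7) ∷ (4 , 6) ∷ (5 , 7) ∷ [])

eightCert : Cert
eightCert =
  grow 4 (leaf (1 ∷ 3 ∷ 4 ∷ []) ∷ leaf (0 ∷ 2 ∷ 5 ∷ []) ∷ leaf (0 ∷ 2 ∷ 7 ∷ []) ∷ grow 5 (leaf (0 ∷ 2 ∷ 5 ∷
  []) ∷ leaf (0 ∷ 2 ∷ 5 ∷ []) ∷ grow 8 (leaf (0 ∷ 2 ∷ 8 ∷ []) ∷ grow 6 (leaf (1 ∷ 3 ∷ 6 ∷ []) ∷ leaf (0 ∷ 2 ∷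
  7 ∷ []) ∷ leaf (1 ∷ 6 ∷ 8 ∷ []) ∷ rule 0 (0 ∷ 1 ∷ 2 ∷ 3 ∷ 4 ∷ 5 ∷ 6 ∷ 7 ∷ 8 ∷ 10 ∷ []) (grow 9 (grow 7
  (leaf (0 ∷ 2 ∷ 7 ∷ []) ∷ leaf (0 ∷ 2 ∷ 5 ∷ 9 ∷ []) ∷ rule 0 (1 ∷ 0 ∷ 3 ∷ 2 ∷ 5 ∷ 4 ∷ 7 ∷ 6 ∷ 8 ∷ 11 ∷ [])
  [] ∷ []) ∷ leaf (0 ∷ 7 ∷ 8 ∷ []) ∷ grow 10 (leaf (0 ∷ 2 ∷ 8 ∷ 10 ∷ []) ∷ leaf (0 ∷ 2 ∷ 5 ∷ 10 ∷ []) ∷ grow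
  7 (leaf (0 ∷ 2 ∷ 7 ∷ []) ∷ leaf (0 ∷ 2 ∷ 7 ∷ 8 ∷ 10 ∷ []) ∷ leaf (0 ∷ 2 ∷ 7 ∷ 8 ∷ 10 ∷ []) ∷ leaf (0 ∷ 2 ∷
  7 ∷ 8 ∷ 10 ∷ []) ∷ []) ∷ []) ∷ []) ∷ []) ∷ []) ∷ []) ∷ grow 6 (leaf (1 ∷ 3 ∷ 6 ∷ []) ∷ leaf (0 ∷ 2 ∷ 7 ∷
  []) ∷ rule 0 (0 ∷ 1 ∷ 2 ∷ 3 ∷ 4 ∷ 5 ∷ 6 ∷ 7 ∷ 8 ∷ 9 ∷ []) (grow 8 (leaf (0 ∷ 2 ∷ 8 ∷ 9 ∷ []) ∷ leaf (0 ∷ 2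
  ∷ 5 ∷ 8 ∷ []) ∷ grow 10 (grow 7 (leaf (0 ∷ 2 ∷ 7 ∷ []) ∷ leaf (0 ∷ 2 ∷ 7 ∷ 8 ∷ 9 ∷ []) ∷ leaf (0 ∷ 2 ∷ 7 ∷
  8 ∷ 9 ∷ []) ∷ []) ∷ leaf (2 ∷ 7 ∷ 9 ∷ []) ∷ grow 7 (leaf (0 ∷ 2 ∷ 7 ∷ []) ∷ leaf (0 ∷ 2 ∷ 7 ∷ 8 ∷ 9 ∷ []) ∷
  leaf (0 ∷ 2 ∷ 7 ∷ 8 ∷ 9 ∷ []) ∷ leaf (0 ∷ 2 ∷ 7 ∷ 8 ∷ 9 ∷ []) ∷ []) ∷ []) ∷ []) ∷ []) ∷ rule 1 (0 ∷ 1 ∷ 2 ∷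
  3 ∷ 4 ∷ 5 ∷ 6 ∷ 7 ∷ 8 ∷ 9 ∷ []) (grow 9 (leaf (1 ∷ 3 ∷ 6 ∷ 9 ∷ []) ∷ grow 7 (leaf (0 ∷ 2 ∷ 7 ∷ []) ∷ leaf
  (3 ∷ 6 ∷ 8 ∷ []) ∷ rule 1 (0 ∷ 3 ∷ 2 ∷ 1 ∷ 4 ∷ 7 ∷ 6 ∷ 5 ∷ 8 ∷ 11 ∷ []) (leaf (0 ∷ 2 ∷ 5 ∷ 8 ∷ 11 ∷ []) ∷
  []) ∷ rule 0 (1 ∷ 0 ∷ 3 ∷ 2 ∷ 5 ∷ 4 ∷ 7 ∷ 6 ∷ 9 ∷ 12 ∷ []) (rule 1 (2 ∷ 3 ∷ 0 ∷ 1 ∷ 6 ∷ 7 ∷ 4 ∷ 5 ∷ 10 ∷ 12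
  ∷ []) (leaf (0 ∷ 2 ∷ 5 ∷ 10 ∷ 12 ∷ []) ∷ []) ∷ []) ∷ []) ∷ []) ∷ rule 1 (1 ∷ 2 ∷ 3 ∷ 0 ∷ 5 ∷ 6 ∷ 7 ∷ 4 ∷ 9
  ∷ 10 ∷ []) (grow 8 (grow 9 (leaf (8 ∷ 9 ∷ []) ∷ leaf (1 ∷ 3 ∷ 6 ∷ 8 ∷ 9 ∷ []) ∷ []) ∷ grow 9 (leaf (1 ∷ 3 ∷
  8 ∷ 9 ∷ []) ∷ leaf (1 ∷ 3 ∷ 6 ∷ 8 ∷ 9 ∷ []) ∷ []) ∷ grow 7 (leaf (0 ∷ 2 ∷ 7 ∷ []) ∷ leaf (0 ∷ 2 ∷ 5 ∷ 8 ∷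
  10 ∷ []) ∷ rule 0 (1 ∷ 0 ∷ 3 ∷ 2 ∷ 5 ∷ 4 ∷ 7 ∷ 6 ∷ 9 ∷ 12 ∷ []) (leaf (0 ∷ 2 ∷ 7 ∷ 8 ∷ 9 ∷ []) ∷ []) ∷ rule
  1 (0 ∷ 3 ∷ 2 ∷ 1 ∷ 4 ∷ 7 ∷ 6 ∷ 5 ∷ 8 ∷ 13 ∷ []) (rule 0 (1 ∷ 0 ∷ 3 ∷ 2 ∷ 5 ∷ 4 ∷ 7 ∷ 6 ∷ 9 ∷ 13 ∷ []) (leaf
  (0 ∷ 2 ∷ 7 ∷ 8 ∷ 9 ∷ []) ∷ leaf (1 ∷ 3 ∷ 8 ∷ 9 ∷ 13 ∷ []) ∷ []) ∷ []) ∷ []) ∷ []) ∷ rule 0 (0 ∷ 1 ∷ 2 ∷ 3 ∷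
  4 ∷ 5 ∷ 6 ∷ 7 ∷ 8 ∷ 10 ∷ []) (leaf (0 ∷ 2 ∷ 5 ∷ 8 ∷ 10 ∷ []) ∷ leaf (1 ∷ 3 ∷ 4 ∷ 9 ∷ 10 ∷ []) ∷ leaf (1 ∷ 3
  ∷ 6 ∷ 8 ∷ 9 ∷ []) ∷ leaf (0 ∷ 2 ∷ 8 ∷ 9 ∷ 10 ∷ []) ∷ []) ∷ []) ∷ []) ∷ []) ∷ []) ∷ [])

lowCfg : Cfg
lowCfg = cfg 3 (0 ∷ []) ((0 , 1) ∷ (0 , 2) ∷ [])

lowCert : Cert
lowCert =
  grow 1 (grow 1 (rule 0 (0 ∷ 1 ∷ 2 ∷ 3 ∷ []) (grow 2 (leaf (1 ∷ 2 ∷ []) ∷ grow 3 (leaf (0 ∷ 3 ∷ []) ∷ grow 4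
  (leaf (4 ∷ []) ∷ grow 5 (leaf (5 ∷ []) ∷ leaf (4 ∷ 5 ∷ []) ∷ rule 1 (0 ∷ 1 ∷ 2 ∷ 3 ∷ 4 ∷ 5 ∷ 6 ∷ []) (kill
  0 (2 ∷ 4 ∷ 3 ∷ 5 ∷ 0 ∷ 6 ∷ 1 ∷ 7 ∷ []) ∷ []) ∷ []) ∷ []) ∷ grow 4 (leaf (4 ∷ []) ∷ rule 1 (0 ∷ 1 ∷ 2 ∷ 3 ∷
  4 ∷ 5 ∷ 7 ∷ []) (grow 5 (leaf (5 ∷ []) ∷ leaf (0 ∷ 3 ∷ 5 ∷ []) ∷ []) ∷ rule 1 (1 ∷ 0 ∷ 3 ∷ 2 ∷ 4 ∷ 6 ∷ 7 ∷
  []) (grow 5 (leaf (5 ∷ []) ∷ grow 6 (leaf (6 ∷ []) ∷ leaf (0 ∷ 5 ∷ 6 ∷ []) ∷ grow 7 (leaf (7 ∷ []) ∷ leaf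
  (0 ∷ 5 ∷ 7 ∷ []) ∷ leaf (1 ∷ 6 ∷ 7 ∷ []) ∷ grow 9 (grow 9 (leaf (1 ∷ 2 ∷ 9 ∷ []) ∷ leaf (1 ∷ 2 ∷ 6 ∷ 7 ∷ 9
  ∷ []) ∷ leaf (0 ∷ 3 ∷ 5 ∷ 7 ∷ []) ∷ []) ∷ grow 9 (leaf (1 ∷ 2 ∷ 9 ∷ []) ∷ leaf (1 ∷ 2 ∷ 6 ∷ 7 ∷ 9 ∷ []) ∷
  leaf (0 ∷ 4 ∷ 5 ∷ 6 ∷ []) ∷ []) ∷ grow 9 (leaf (1 ∷ 2 ∷ 9 ∷ []) ∷ leaf (0 ∷ 3 ∷ 5 ∷ 7 ∷ []) ∷ leaf (0 ∷ 4 ∷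
  5 ∷ 6 ∷ []) ∷ leaf (0 ∷ 3 ∷ 5 ∷ 7 ∷ []) ∷ []) ∷ []) ∷ []) ∷ []) ∷ []) ∷ grow 8 (leaf (0 ∷ 4 ∷ 8 ∷ []) ∷
  leaf (1 ∷ 6 ∷ 7 ∷ []) ∷ grow 5 (leaf (5 ∷ []) ∷ leaf (0 ∷ 3 ∷ 5 ∷ []) ∷ leaf (0 ∷ 5 ∷ 7 ∷ []) ∷ grow 6
  (leaf (1 ∷ 6 ∷ []) ∷ grow 9 (leaf (9 ∷ []) ∷ grow 10 (leaf (10 ∷ []) ∷ leaf (5 ∷ 10 ∷ []) ∷ leaf (0 ∷ 3 ∷ 7
  ∷ 10 ∷ []) ∷ []) ∷ leaf (0 ∷ 3 ∷ 5 ∷ 7 ∷ []) ∷ []) ∷ grow 9 (leaf (9 ∷ []) ∷ grow 10 (leaf (10 ∷ []) ∷ leaf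
  (5 ∷ 10 ∷ []) ∷ leaf (8 ∷ 9 ∷ []) ∷ []) ∷ grow 11 (leaf (11 ∷ []) ∷ leaf (8 ∷ 9 ∷ 11 ∷ []) ∷ leaf (8 ∷ 9 ∷
  11 ∷ []) ∷ leaf (0 ∷ 3 ∷ 5 ∷ 7 ∷ []) ∷ []) ∷ []) ∷ grow 12 (grow 12 (leaf (0 ∷ 3 ∷ 12 ∷ []) ∷ leaf (1 ∷ 2 ∷
  6 ∷ 7 ∷ []) ∷ leaf (1 ∷ 2 ∷ 6 ∷ 7 ∷ []) ∷ []) ∷ grow 12 (leaf (0 ∷ 3 ∷ 12 ∷ []) ∷ leaf (1 ∷ 2 ∷ 6 ∷ 7 ∷ [])
  ∷ leaf (0 ∷ 3 ∷ 5 ∷ 12 ∷ []) ∷ []) ∷ grow 12 (leaf (0 ∷ 3 ∷ 12 ∷ []) ∷ leaf (1 ∷ 2 ∷ 6 ∷ 7 ∷ []) ∷ leaf (0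
  ∷ 3 ∷ 5 ∷ 12 ∷ []) ∷ leaf (1 ∷ 2 ∷ 6 ∷ 7 ∷ []) ∷ []) ∷ []) ∷ []) ∷ []) ∷ []) ∷ []) ∷ []) ∷ []) ∷ []) ∷ [])
  ∷ []) ∷ grow 2 (grow 2 (leaf (1 ∷ 2 ∷ []) ∷ leaf (0 ∷ []) ∷ leaf (0 ∷ []) ∷ []) ∷ grow 2 (leaf (1 ∷ 2 ∷ [])
  ∷ leaf (0 ∷ []) ∷ leaf (0 ∷ []) ∷ []) ∷ grow 2 (rule 0 (0 ∷ 2 ∷ 1 ∷ 5 ∷ []) (grow 5 (leaf (0 ∷ 5 ∷ []) ∷
  grow 3 (leaf (3 ∷ []) ∷ grow 4 (leaf (4 ∷ []) ∷ leaf (3 ∷ 4 ∷ []) ∷ rule 1 (0 ∷ 2 ∷ 1 ∷ 5 ∷ 3 ∷ 4 ∷ 6 ∷ [])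
  (kill 0 (1 ∷ 3 ∷ 5 ∷ 4 ∷ 0 ∷ 6 ∷ 2 ∷ 7 ∷ []) ∷ []) ∷ []) ∷ []) ∷ grow 3 (leaf (3 ∷ []) ∷ rule 1 (0 ∷ 2 ∷ 1
  ∷ 5 ∷ 3 ∷ 4 ∷ 7 ∷ []) (grow 4 (leaf (4 ∷ []) ∷ leaf (0 ∷ 3 ∷ 6 ∷ []) ∷ []) ∷ rule 1 (2 ∷ 0 ∷ 5 ∷ 1 ∷ 3 ∷ 6
  ∷ 7 ∷ []) (grow 4 (leaf (4 ∷ []) ∷ grow 6 (leaf (6 ∷ []) ∷ leaf (0 ∷ 4 ∷ 6 ∷ []) ∷ grow 7 (leaf (7 ∷ []) ∷
  leaf (0 ∷ 4 ∷ 7 ∷ []) ∷ leaf (2 ∷ 6 ∷ 7 ∷ []) ∷ grow 9 (grow 9 (leaf (1 ∷ 2 ∷ 9 ∷ []) ∷ leaf (1 ∷ 2 ∷ 6 ∷ 7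
  ∷ 9 ∷ []) ∷ leaf (0 ∷ 4 ∷ 5 ∷ 7 ∷ []) ∷ []) ∷ grow 9 (leaf (1 ∷ 2 ∷ 9 ∷ []) ∷ leaf (1 ∷ 2 ∷ 6 ∷ 7 ∷ 9 ∷ [])
  ∷ leaf (0 ∷ 3 ∷ 4 ∷ 6 ∷ []) ∷ []) ∷ grow 9 (leaf (1 ∷ 2 ∷ 9 ∷ []) ∷ leaf (0 ∷ 4 ∷ 5 ∷ 7 ∷ []) ∷ leaf (0 ∷ 3
  ∷ 4 ∷ 6 ∷ []) ∷ leaf (0 ∷ 3 ∷ 4 ∷ 6 ∷ []) ∷ []) ∷ []) ∷ []) ∷ []) ∷ []) ∷ grow 8 (leaf (0 ∷ 3 ∷ 8 ∷ []) ∷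
  leaf (2 ∷ 6 ∷ 7 ∷ []) ∷ grow 4 (leaf (4 ∷ []) ∷ leaf (0 ∷ 4 ∷ 5 ∷ []) ∷ leaf (0 ∷ 4 ∷ 7 ∷ []) ∷ grow 6
  (leaf (2 ∷ 6 ∷ []) ∷ grow 9 (leaf (9 ∷ []) ∷ grow 10 (leaf (10 ∷ []) ∷ leaf (4 ∷ 10 ∷ []) ∷ leaf (0 ∷ 3 ∷ 6
  ∷ 8 ∷ []) ∷ []) ∷ leaf (0 ∷ 4 ∷ 5 ∷ 7 ∷ []) ∷ []) ∷ grow 9 (leaf (9 ∷ []) ∷ grow 10 (leaf (10 ∷ []) ∷ leaf
  (4 ∷ 10 ∷ []) ∷ leaf (8 ∷ 9 ∷ []) ∷ []) ∷ grow 11 (leaf (11 ∷ []) ∷ leaf (8 ∷ 9 ∷ 11 ∷ []) ∷ leaf (8 ∷ 9 ∷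
  11 ∷ []) ∷ leaf (0 ∷ 3 ∷ 4 ∷ 6 ∷ []) ∷ []) ∷ []) ∷ grow 12 (grow 12 (leaf (0 ∷ 5 ∷ 12 ∷ []) ∷ leaf (1 ∷ 2 ∷
  6 ∷ 7 ∷ []) ∷ leaf (1 ∷ 2 ∷ 6 ∷ 7 ∷ []) ∷ []) ∷ grow 12 (leaf (0 ∷ 4 ∷ 12 ∷ []) ∷ leaf (1 ∷ 2 ∷ 6 ∷ 7 ∷ [])
  ∷ leaf (0 ∷ 4 ∷ 5 ∷ 12 ∷ []) ∷ []) ∷ grow 12 (leaf (0 ∷ 5 ∷ 12 ∷ []) ∷ leaf (1 ∷ 2 ∷ 6 ∷ 7 ∷ []) ∷ leaf (0
  ∷ 4 ∷ 5 ∷ 12 ∷ []) ∷ leaf (1 ∷ 2 ∷ 6 ∷ 7 ∷ []) ∷ []) ∷ []) ∷ []) ∷ []) ∷ []) ∷ []) ∷ []) ∷ []) ∷ []) ∷ grow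
  5 (leaf (0 ∷ 5 ∷ []) ∷ grow 3 (leaf (3 ∷ []) ∷ grow 4 (leaf (4 ∷ []) ∷ leaf (3 ∷ 4 ∷ []) ∷ rule 1 (0 ∷ 2 ∷
  1 ∷ 5 ∷ 3 ∷ 4 ∷ 6 ∷ []) (kill 0 (1 ∷ 3 ∷ 5 ∷ 4 ∷ 0 ∷ 6 ∷ 2 ∷ 7 ∷ []) ∷ []) ∷ []) ∷ []) ∷ grow 4 (leaf (4 ∷
  []) ∷ rule 1 (0 ∷ 2 ∷ 1 ∷ 5 ∷ 4 ∷ 3 ∷ 7 ∷ []) (grow 3 (leaf (3 ∷ []) ∷ leaf (0 ∷ 3 ∷ 5 ∷ []) ∷ []) ∷ rule 1
  (2 ∷ 0 ∷ 5 ∷ 1 ∷ 4 ∷ 6 ∷ 7 ∷ []) (grow 3 (leaf (3 ∷ []) ∷ grow 6 (leaf (6 ∷ []) ∷ leaf (0 ∷ 3 ∷ 6 ∷ []) ∷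
  grow 7 (leaf (7 ∷ []) ∷ leaf (0 ∷ 3 ∷ 7 ∷ []) ∷ leaf (2 ∷ 6 ∷ 7 ∷ []) ∷ grow 9 (grow 9 (leaf (1 ∷ 2 ∷ 9 ∷
  []) ∷ leaf (1 ∷ 2 ∷ 6 ∷ 7 ∷ 9 ∷ []) ∷ leaf (0 ∷ 3 ∷ 5 ∷ 7 ∷ []) ∷ []) ∷ grow 9 (leaf (1 ∷ 2 ∷ 9 ∷ []) ∷
  leaf (1 ∷ 2 ∷ 6 ∷ 7 ∷ 9 ∷ []) ∷ leaf (0 ∷ 3 ∷ 4 ∷ 6 ∷ []) ∷ []) ∷ grow 9 (leaf (1 ∷ 2 ∷ 9 ∷ []) ∷ leaf (0 ∷
  3 ∷ 5 ∷ 7 ∷ []) ∷ leaf (0 ∷ 3 ∷ 4 ∷ 6 ∷ []) ∷ leaf (0 ∷ 3 ∷ 4 ∷ 6 ∷ []) ∷ []) ∷ []) ∷ []) ∷ []) ∷ []) ∷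
  grow 8 (leaf (0 ∷ 4 ∷ 8 ∷ []) ∷ leaf (2 ∷ 6 ∷ 7 ∷ []) ∷ grow 3 (leaf (3 ∷ []) ∷ leaf (0 ∷ 3 ∷ 5 ∷ []) ∷
  leaf (0 ∷ 3 ∷ 7 ∷ []) ∷ grow 6 (leaf (2 ∷ 6 ∷ []) ∷ grow 9 (leaf (9 ∷ []) ∷ grow 10 (leaf (10 ∷ []) ∷ leaf
  (3 ∷ 10 ∷ []) ∷ leaf (0 ∷ 4 ∷ 6 ∷ 8 ∷ []) ∷ []) ∷ leaf (0 ∷ 3 ∷ 5 ∷ 7 ∷ []) ∷ []) ∷ grow 9 (leaf (9 ∷ []) ∷
  grow 10 (leaf (10 ∷ []) ∷ leaf (3 ∷ 10 ∷ []) ∷ leaf (8 ∷ 9 ∷ []) ∷ []) ∷ grow 11 (leaf (11 ∷ []) ∷ leaf (8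
  ∷ 9 ∷ 11 ∷ []) ∷ leaf (8 ∷ 9 ∷ 11 ∷ []) ∷ leaf (0 ∷ 3 ∷ 4 ∷ 6 ∷ []) ∷ []) ∷ []) ∷ grow 12 (grow 12 (leaf (0
  ∷ 5 ∷ 12 ∷ []) ∷ leaf (1 ∷ 2 ∷ 6 ∷ 7 ∷ []) ∷ leaf (1 ∷ 2 ∷ 6 ∷ 7 ∷ []) ∷ []) ∷ grow 12 (leaf (0 ∷ 3 ∷ 12 ∷
  []) ∷ leaf (1 ∷ 2 ∷ 6 ∷ 7 ∷ []) ∷ leaf (0 ∷ 3 ∷ 5 ∷ 12 ∷ []) ∷ []) ∷ grow 12 (leaf (0 ∷ 5 ∷ 12 ∷ []) ∷ leaf
  (1 ∷ 2 ∷ 6 ∷ 7 ∷ []) ∷ leaf (0 ∷ 3 ∷ 5 ∷ 12 ∷ []) ∷ leaf (1 ∷ 2 ∷ 6 ∷ 7 ∷ []) ∷ []) ∷ []) ∷ []) ∷ []) ∷ [])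
  ∷ []) ∷ []) ∷ []) ∷ []) ∷ []) ∷ leaf (0 ∷ []) ∷ leaf (0 ∷ []) ∷ leaf (0 ∷ []) ∷ []) ∷ []) ∷ []) ∷ [])

-- Two adjacent vertices 0 and 1 of degree 2 whose outer neighbours 2 and 3 are adjacent.
loopCfg : Cfg
loopCfg = cfg 4 (0 ∷ 1 ∷ []) ((0 , 1) ∷ (0 , 2) ∷ (1 , 3) ∷ (2 , 3) ∷ [])

loopCert : Cert
loopCert =
  grow 2 (leaf (1 ∷ 2 ∷ []) ∷ grow 3 (leaf (0 ∷ 3 ∷ []) ∷ leaf (0 ∷ 3 ∷ []) ∷ []) ∷ [])

girthCfg : Cfg
girthCfg = cfg 3 (0 ∷ []) ((0 , 1) ∷ (0 , 2) ∷ [])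

girthCert : Cert
girthCert =
  grow 1 (grow 2 (kill 0 (0 ∷ 1 ∷ 3 ∷ 2 ∷ []) ∷ grow 1 (rule 0 (0 ∷ 1 ∷ 2 ∷ 3 ∷ []) (kill 1 (0 ∷ 1 ∷ 3 ∷ 4 ∷
  2 ∷ []) ∷ kill 1 (0 ∷ 1 ∷ 3 ∷ 5 ∷ 2 ∷ []) ∷ []) ∷ kill 0 (0 ∷ 1 ∷ 4 ∷ 2 ∷ []) ∷ grow 4 (kill 1 (0 ∷ 1 ∷ 3 ∷
  4 ∷ 2 ∷ []) ∷ kill 1 (0 ∷ 1 ∷ 5 ∷ 4 ∷ 2 ∷ []) ∷ grow 2 (rule 0 (0 ∷ 2 ∷ 1 ∷ 4 ∷ []) (kill 1 (0 ∷ 1 ∷ 3 ∷ 4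
  ∷ 2 ∷ []) ∷ kill 1 (0 ∷ 1 ∷ 5 ∷ 4 ∷ 2 ∷ []) ∷ []) ∷ kill 0 (0 ∷ 1 ∷ 3 ∷ 2 ∷ []) ∷ kill 0 (0 ∷ 1 ∷ 5 ∷ 2 ∷
  []) ∷ leaf (0 ∷ []) ∷ []) ∷ []) ∷ []) ∷ []) ∷ [])

squareOK : check squareMode squareCfg squareCert ≡ true
squareOK = refl

pentOK : check pentMode pentCfg pentCert ≡ true
pentOK = refl

splitOK : check splitMode splitCfg splitCert ≡ true
splitOK = refl

lowOK : check lowMode lowCfg lowCert ≡ true
lowOK = refl

eightOK : check eightMode eightCfg eightCert ≡ true
eightOK = refl

loopOK : check loopMode loopCfg loopCert ≡ true
loopOK = refl

girthOK : check girthMode girthCfg girthCert ≡ true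
girthOK = refl


-- Every graph of the induction is a relation `E` restricted to a Boolean set `V` of the same
-- `Fin N`: deletion shrinks `V`, suppression also changes `E`, and no vertex is ever renamed.
module Ambient (N : ℕ) where


  -- Vertex sets, degrees and edge counts

  Vx : Set
  Vx = Fin N

  VSet : Set
  VSet = Vx → Bool

  Adj : Set
  Adj = Vx → Vx → Bool

  -- Sealed so that numbers of vertices and edges stay atoms in the arithmetic and do not unfold to
  -- sums.
  opaque
    card : VSet → ℕ
    card V = ∑ λ x → ind (V x)

    deg : Adj → VSet → Vx → ℕ
    deg E V x = ∑ λ y → ind (V y) * ind (E x y)

    eb : Adj → VSet → VSet → ℕ
    eb E U V = ∑ λ x → ind (U x) * deg E V x

  _⊑_ : VSet → VSet → Set
  U ⊑ V = ∀ {x} → U x ≡ true → V x ≡ true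

  infix 4 _⊑_
  infixl 6 _∖_ _∪_

  _∖_ : VSet → VSet → VSet
  (V ∖ X) x = V x ∧ not (X x)

  _∪_ : VSet → VSet → VSet
  (V ∪ X) x = V x ∨ X x

  ∖⊑ : ∀ {V X} → V ∖ X ⊑ V
  ∖⊑ p = proj₁ (∧-true p)

  ∖-not : ∀ {V X x} → (V ∖ X) x ≡ true → X x ≡ false
  ∖-not {V} {X} {x} p = not-true (proj₂ (∧-true {V x} p))

  ∖-intro : ∀ {V X x} → V x ≡ true → X x ≡ false → (V ∖ X) x ≡ true
  ∖-intro p q = ∧-intro p (cong not q)

  -- Disjoint union, written as an identity of indicators so that all three counts split by
  -- distributivity.
  record Split (V A B : VSet) : Set where
    constructor split
    field pointwise : ∀ x → ind (V x) ≡ ind (A x) + ind (B x)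
  open Split

  split-∖ : ∀ {V X} → X ⊑ V → Split V (V ∖ X) X
  split-∖ {V} {X} X⊑V .pointwise x with V x in v | X x in q
  ... | true  | true  = refl
  ... | true  | false = refl
  ... | false | false = refl
  ... | false | true  = ⊥-elim (t≢f (X⊑V q) v)

  split-∪ : ∀ {A B} → (∀ {x} → A x ≡ true → B x ≡ true → ⊥) → Split (A ∪ B) A B
  split-∪ {A} {B} dis .pointwise x with A x in a | B x in b
  ... | true  | true  = ⊥-elim (dis a b)
  ... | true  | false = refl
  ... | false | true  = refl
  ... | false | false = refl

  opaque
    unfolding card deg eb

    card-split : ∀ {V A B} → Split V A B → card V ≡ card A + card B
    card-split {V} {A} {B} s = trans (sum-cong-≗ (s .pointwise)) (∑-distrib-+ (ind ∘ A) (ind ∘ B))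

    deg-split : ∀ {E V A B} x → Split V A B → deg E V x ≡ deg E A x + deg E B x
    deg-split {E} {V} {A} {B} x s = trans
      (sum-cong-≗ λ y → trans (cong (_* ind (E x y)) (s .pointwise y)) (*-distribʳ-+ (ind (E x y)) (ind (A y)) (ind (B y))))
      (∑-distrib-+ (λ y → ind (A y) * ind (E x y)) (λ y → ind (B y) * ind (E x y)))

    eb-splitˡ : ∀ {E V A B} U → Split V A B → eb E V U ≡ eb E A U + eb E B U
    eb-splitˡ {E} {V} {A} {B} U s = trans
      (sum-cong-≗ λ x → trans (cong (_* deg E U x) (s .pointwise x)) (*-distribʳ-+ (deg E U x) (ind (A x)) (ind (B x))))
      (∑-distrib-+ (λ x → ind (A x) * deg E U x) (λ x → ind (B x) * deg E U x))

    eb-splitʳ : ∀ {E V A B} U → Split V A B → eb E U V ≡ eb E U A + eb E U B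
    eb-splitʳ {E} {V} {A} {B} U s = trans
      (sum-cong-≗ λ x → trans (cong (ind (U x) *_) (deg-split {E} x s)) (*-distribˡ-+ (ind (U x)) (deg E A x) (deg E B x)))
      (∑-distrib-+ (λ x → ind (U x) * deg E A x) (λ x → ind (U x) * deg E B x))

  Symm : Adj → Set
  Symm E = ∀ x y → E x y ≡ E y x

  opaque
    unfolding eb deg

    eb-comm : ∀ {E} U V → Symm E → eb E U V ≡ eb E V U
    eb-comm {E} U V sy = begin
      ∑ (λ x → ind (U x) * ∑ (λ y → ind (V y) * ind (E x y)))
        ≡⟨ sum-cong-≗ (λ x → *-distribˡ-∑ (ind (U x)) (λ y → ind (V y) * ind (E x y))) ⟩
      ∑ (λ x → ∑ (λ y → ind (U x) * (ind (V y) * ind (E x y))))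
        ≡⟨ ∑-comm (λ x y → ind (U x) * (ind (V y) * ind (E x y))) ⟩
      ∑ (λ y → ∑ (λ x → ind (U x) * (ind (V y) * ind (E x y))))
        ≡⟨ sum-cong-≗ (λ y → sum-cong-≗ (λ x → swap x y)) ⟩
      ∑ (λ y → ∑ (λ x → ind (V y) * (ind (U x) * ind (E y x))))
        ≡⟨ sum-cong-≗ (λ y → sym (*-distribˡ-∑ (ind (V y)) (λ x → ind (U x) * ind (E y x)))) ⟩
      ∑ (λ y → ind (V y) * ∑ (λ x → ind (U x) * ind (E y x))) ∎
      where
      open ≡-Reasoning
      swap : ∀ x y → ind (U x) * (ind (V y) * ind (E x y)) ≡ ind (V y) * (ind (U x) * ind (E y x))
      swap x y rewrite sy x y = lem (ind (U x)) (ind (V y)) (ind (E y x))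
        where
        lem : ∀ a b c → a * (b * c) ≡ b * (a * c)
        lem = solve-∀

  eb-split : ∀ {E V A B} → Symm E → Split V A B → eb E V V ≡ eb E A A + eb E B B + 2 * eb E B A
  eb-split {E} {V} {A} {B} sy s = begin
    eb E V V                                        ≡⟨ eb-splitˡ V s ⟩
    eb E A V + eb E B V                             ≡⟨ cong₂ _+_ (eb-splitʳ A s) (eb-splitʳ B s) ⟩
    eb E A A + eb E A B + (eb E B A + eb E B B)     ≡⟨ cong (λ z → eb E A A + z + (eb E B A + eb E B B)) (eb-comm A B sy) ⟩
    eb E A A + eb E B A + (eb E B A + eb E B B)     ≡⟨ lem (eb E A A) (eb E B B) (eb E B A) ⟩
    eb E A A + eb E B B + 2 * eb E B A              ∎
    where
    open ≡-Reasoning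
    lem : ∀ a b c → a + c + (c + b) ≡ a + b + 2 * c
    lem = solve-∀

  opaque
    unfolding card deg eb

    deg-mono : ∀ {E U V} x → U ⊑ V → deg E U x ≤ deg E V x
    deg-mono {E} {U} {V} x U⊑V = ∑-mono λ y → *-mono-≤ (le y) (≤-refl {ind (E x y)})
      where
      le : ∀ y → ind (U y) ≤ ind (V y)
      le y with U y in q
      ... | true  rewrite U⊑V q = ≤-refl
      ... | false = z≤n

    card-mono : ∀ {U V} → U ⊑ V → card U ≤ card V
    card-mono {U} {V} U⊑V = ∑-mono le
      where
      le : ∀ y → ind (U y) ≤ ind (V y)
      le y with U y in q
      ... | true  rewrite U⊑V q = ≤-refl
      ... | false = z≤n

    card-cong : ∀ {U V} → (∀ x → U x ≡ V x) → card U ≡ card V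
    card-cong h = sum-cong-≗ λ x → cong ind (h x)

    mem≤card : ∀ {V x} → V x ≡ true → 1 ≤ card V
    mem≤card {V} {x} v = ≤-trans (≤-reflexive (sym (ind-true v))) (∑-bound (ind ∘ V) x)

  card-∖< : ∀ {V X x} → X ⊑ V → X x ≡ true → card (V ∖ X) < card V
  card-∖< {V} {X} {x} X⊑V q = lin 0 (mem≤card {X} q)
    (trans (lem (card (V ∖ X)) (card X)) (cong (_+ 1) (sym (card-split (split-∖ {V} {X} X⊑V)))))
    where
    lem : ∀ a b → suc a + b + 0 ≡ a + b + 1
    lem = solve-∀

  Indep : Adj → VSet → Set
  Indep E S = ∀ {x y} → S x ≡ true → S y ≡ true → E x y ≡ false

  -- 30 |S| − Σ_{v ∈ V} (14 − deg v) ≥ a − b.  In the notation n, m, α of the subgraph induced by V this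
  -- says 2 (15 α − 7 n + m) ≥ a − b.
  record Val (E : Adj) (V : VSet) (a b : ℕ) : Set where
    constructor val
    field
      S     : VSet
      S⊑V   : S ⊑ V
      indep : Indep E S
      bound : 14 * card V + a ≤ 30 * card S + (eb E V V + b)

  -- `nbI` makes X contain the closed neighbourhood of I, so an independent set outside X can be
  -- joined with I.
  record Cut (E : Adj) (V X I : VSet) : Set where
    constructor cut
    field
      X⊑V    : X ⊑ V
      I⊑X    : I ⊑ X
      indepI : Indep E I
      nbI    : ∀ {i y} → I i ≡ true → V y ≡ true → E i y ≡ true → X y ≡ true

  -- Passing from `V` to `V ∖ X` lowers the degree sum by 2 e(X, V) - e(X, X), which explains these
  -- two terms of the last hypothesis.
  cut-val : ∀ {E V X I a b a′ b′} → Symm E → Cut E V X I → Val E (V ∖ X) a b →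
            14 * card X + eb E X X + (a′ + b) ≤ 30 * card I + 2 * eb E X V + (a + b′) →
            Val E V a′ b′
  cut-val {E} {V} {X} {I} {a} {b} {a′} {b′} sy (cut X⊑V I⊑X indI nbI) (val S S⊑ indS bd) h =
    val (S ∪ I) sub indep
      (subst₂ _≤_ (cong (λ z → 14 * z + a′) (sym cV)) (cong₂ (λ z w → 30 * z + (w + b′)) (sym cS) (sym eV)) final)
    where
    V′ = V ∖ X
    spl = split-∖ {V} {X} X⊑V
    dis : ∀ {x} → S x ≡ true → I x ≡ true → ⊥
    dis s i = t≢f (I⊑X i) (∖-not {V} {X} (S⊑ s))
    cV = card-split spl
    cS = card-split (split-∪ {S} {I} dis)
    eV = eb-split {E} sy spl
    sub : S ∪ I ⊑ V
    sub {x} p with S x in s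
    ... | true  = ∖⊑ {V} {X} (S⊑ s)
    ... | false = X⊑V (I⊑X p)
    indSI : ∀ {x y} → S x ≡ true → I y ≡ true → E y x ≡ false
    indSI s i = ¬true λ e → t≢f (nbI i (∖⊑ {V} {X} (S⊑ s)) e) (∖-not {V} {X} (S⊑ s))
    indep : Indep E (S ∪ I)
    indep {x} {y} p q with S x in sx | S y in sy′
    ... | true  | true  = indS sx sy′
    ... | true  | false = trans (sy x y) (indSI sx q)
    ... | false | true  = indSI sy′ p
    ... | false | false = indI p q
    h′ : 14 * card X + eb E X X + (a′ + b) ≤ 30 * card I + 2 * (eb E X V′ + eb E X X) + (a + b′)
    h′ = subst (λ z → 14 * card X + eb E X X + (a′ + b) ≤ 30 * card I + 2 * z + (a + b′)) (eb-splitʳ {E} X spl) h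
    final : 14 * (card V′ + card X) + a′ ≤ 30 * (card S + card I) + (eb E V′ V′ + eb E X X + 2 * eb E X V′ + b′)
    final = lin 0 (+-mono-≤ bd h′)
      (lem (card V′) (card X) (card S) (card I) (eb E V′ V′) (eb E X X) (eb E X V′) a b a′ b′)
      where
      lem : ∀ v x s i e f g a b a′ b′ →
        14 * (v + x) + a′ + (30 * s + (e + b) + (30 * i + 2 * (g + f) + (a + b′))) + 0
        ≡ 30 * (s + i) + (e + f + 2 * g + b′) + (14 * v + a + (14 * x + f + (a′ + b)))
      lem = solve-∀


  -- Vertex sets given by lists

  does-refl : ∀ (x : Vx) → does (x ≟ x) ≡ true
  does-refl x = dec-true (x ≟ x) refl

  does-≢ : ∀ {x y : Vx} → x ≢ y → does (x ≟ y) ≡ false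
  does-≢ {x} {y} = dec-false (x ≟ y)

  ⟪_⟫ : List Vx → VSet
  ⟪ [] ⟫     x = false
  ⟪ y ∷ ys ⟫ x = does (x ≟ y) ∨ ⟪ ys ⟫ x

  ⟪⟫⁺ : ∀ {xs x} → x ∈ xs → ⟪ xs ⟫ x ≡ true
  ⟪⟫⁺ {x = x} (here refl) rewrite does-refl x = refl
  ⟪⟫⁺ {y ∷ ys} {x} (there p) with does (x ≟ y)
  ... | true  = refl
  ... | false = ⟪⟫⁺ p

  ⟪⟫⁻ : ∀ {xs x} → ⟪ xs ⟫ x ≡ true → x ∈ xs
  ⟪⟫⁻ {y ∷ ys} {x} p with x ≟ y
  ... | yes e = here e
  ... | no _  = there (⟪⟫⁻ p)

  ⟪⟫-single : ∀ {x y} → ⟪ x ∷ [] ⟫ y ≡ true → y ≡ x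
  ⟪⟫-single {x} {y} p with y ≟ x
  ... | yes e = e

  ⟪⟫-∉ : ∀ {xs x} → x ∉ xs → ⟪ xs ⟫ x ≡ false
  ⟪⟫-∉ h = ¬true (h ∘ ⟪⟫⁻)

  ⟪⟫-⊑ : ∀ {xs} {V : VSet} → All (λ x → V x ≡ true) xs → ⟪ xs ⟫ ⊑ V
  ⟪⟫-⊑ a p = All.lookup a (⟪⟫⁻ p)

  ∑-list : ∀ {xs} → Unique xs → (f : Vx → ℕ) → ∑ (λ x → ind (⟪ xs ⟫ x) * f x) ≡ sumL (map f xs)
  ∑-list []        f = ∑-zero (λ x → ind (⟪ [] ⟫ x) * f x) λ _ → refl
  ∑-list {y ∷ ys} (y∉ ∷ u) f = begin
    ∑ (λ x → ind (⟪ y ∷ ys ⟫ x) * f x)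
      ≡⟨ sum-cong-≗ pt ⟩
    ∑ (λ x → ind (does (x ≟ y)) * f x + ind (⟪ ys ⟫ x) * f x)
      ≡⟨ ∑-distrib-+ (λ x → ind (does (x ≟ y)) * f x) (λ x → ind (⟪ ys ⟫ x) * f x) ⟩
    ∑ (λ x → ind (does (x ≟ y)) * f x) + ∑ (λ x → ind (⟪ ys ⟫ x) * f x)
      ≡⟨ cong₂ _+_ (∑-δ y f) (∑-list u f) ⟩
    f y + sumL (map f ys) ∎
    where
    open ≡-Reasoning
    pt : ∀ x → ind (⟪ y ∷ ys ⟫ x) * f x ≡ ind (does (x ≟ y)) * f x + ind (⟪ ys ⟫ x) * f x
    pt x with x ≟ y
    ... | no _ = refl
    ... | yes refl rewrite ⟪⟫-∉ {ys} {y} (λ m → All.lookup y∉ m refl) = sym (+-identityʳ _)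

  sumL-1 : ∀ {A : Set} (xs : List A) → sumL (map (λ _ → 1) xs) ≡ length xs
  sumL-1 []       = refl
  sumL-1 (x ∷ xs) = cong suc (sumL-1 xs)

  opaque
    unfolding card deg eb

    card-list : ∀ {xs : List Vx} → Unique xs → card ⟪ xs ⟫ ≡ length xs
    card-list {xs} u = trans (sum-cong-≗ λ x → sym (*-identityʳ (ind (⟪ xs ⟫ x))))
                             (trans (∑-list u (λ _ → 1)) (sumL-1 xs))

    eb-list : ∀ {E : Adj} {xs : List Vx} V → Unique xs → eb E ⟪ xs ⟫ V ≡ sumL (map (deg E V) xs)
    eb-list {E} V u = ∑-list u (deg E V)

    deg-list : ∀ {E : Adj} {xs : List Vx} x → Unique xs → deg E ⟪ xs ⟫ x ≡ sumL (map (λ y → ind (E x y)) xs)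
    deg-list {E} x u = ∑-list u (λ y → ind (E x y))

    deg-card : ∀ (E : Adj) (V : VSet) (x : Vx) → deg E V x ≡ card (λ y → V y ∧ E x y)
    deg-card E V x = sum-cong-≗ λ y → h (V y) (E x y)
      where
      h : ∀ a b → ind a * ind b ≡ ind (a ∧ b)
      h true  b = +-identityʳ (ind b)
      h false b = refl

    card-pos : ∀ {V : VSet} → 1 ≤ card V → ∃ λ x → V x ≡ true
    card-pos {V} h with any? (λ x → V x ≟ᵇ true)
    ... | yes p = p
    ... | no ¬p with ≤-trans h (≤-reflexive (∑-zero (ind ∘ V) λ x → ind-false (¬true λ t → ¬p (x , t))))
    ... | ()

    eb-cong : ∀ {E E′ : Adj} {U V V′ : VSet} →
              (∀ {x} → U x ≡ true → deg E V x ≡ deg E′ V′ x) → eb E U V ≡ eb E′ U V′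
    eb-cong {E} {E′} {U} {V} {V′} h = sum-cong-≗ pt
      where
      pt : ∀ x → ind (U x) * deg E V x ≡ ind (U x) * deg E′ V′ x
      pt x with U x in u
      ... | true  = cong (_+ 0) (h u)
      ... | false = refl

    eb-lower : ∀ {E : Adj} {U V : VSet} k → (∀ {x} → U x ≡ true → k ≤ deg E V x) → card U * k ≤ eb E U V
    eb-lower {E} {U} {V} k h = ≤-trans (≤-reflexive (trans (*-comm (card U) k) (*-distribˡ-∑ k (ind ∘ U)))) (∑-mono pt)
      where
      pt : ∀ x → k * ind (U x) ≤ ind (U x) * deg E V x
      pt x with U x in u
      ... | true  = ≤-trans (≤-reflexive (*-identityʳ k)) (≤-trans (h u) (m≤m+n _ 0))
      ... | false = ≤-reflexive (*-zeroʳ k)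

    eb-upper : ∀ {E : Adj} {U V : VSet} k → (∀ {x} → U x ≡ true → deg E V x ≤ k) → eb E U V ≤ card U * k
    eb-upper {E} {U} {V} k h = ≤-trans (∑-mono pt) (≤-reflexive (sym (trans (*-comm (card U) k) (*-distribˡ-∑ k (ind ∘ U)))))
      where
      pt : ∀ x → ind (U x) * deg E V x ≤ k * ind (U x)
      pt x with U x in u
      ... | true  = ≤-trans (≤-reflexive (+-identityʳ _)) (≤-trans (h u) (≤-reflexive (sym (*-identityʳ k))))
      ... | false = z≤n

    deg-zero : ∀ {E : Adj} {V : VSet} {x} → (∀ {y} → V y ≡ true → E x y ≡ true → ⊥) → deg E V x ≡ 0
    deg-zero {E} {V} {x} h = ∑-zero (λ y → ind (V y) * ind (E x y)) pt
      where
      pt : ∀ y → ind (V y) * ind (E x y) ≡ 0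
      pt y with V y in v | E x y in e
      ... | true  | true  = ⊥-elim (h v e)
      ... | true  | false = refl
      ... | false | _     = refl

    eb-zero : ∀ {E : Adj} {U V : VSet} → (∀ {x y} → U x ≡ true → V y ≡ true → E x y ≡ true → ⊥) → eb E U V ≡ 0
    eb-zero {E} {U} {V} h = ∑-zero (λ x → ind (U x) * deg E V x) pt
      where
      pt : ∀ x → ind (U x) * deg E V x ≡ 0
      pt x with U x in u
      ... | true  = trans (+-identityʳ _) (deg-zero {E} {V} (h u))
      ... | false = refl

    deg-pos : ∀ {E : Adj} {V : VSet} {x y} → V y ≡ true → E x y ≡ true → 1 ≤ deg E V x
    deg-pos {E} {V} {x} {y} v e = ≤-trans (≤-reflexive (sym (cong₂ (λ a b → ind a * ind b) v e))) (∑-bound (λ z → ind (V z) * ind (E x z)) y)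

    eb-pos : ∀ {E : Adj} {U V : VSet} {x} → U x ≡ true → deg E V x ≤ eb E U V
    eb-pos {E} {U} {V} {x} u = ≤-trans (≤-reflexive (sym (trans (cong (λ a → ind a * deg E V x) u) (+-identityʳ _)))) (∑-bound (λ z → ind (U z) * deg E V z) x)

    card-⟨⟩≤ : ∀ {xs : List Vx} {P : VSet} → Unique xs → ⟪ xs ⟫ ⊑ P → length xs ≤ card P
    card-⟨⟩≤ u h = ≤-trans (≤-reflexive (sym (card-list u))) (card-mono h)

  opaque
    unfolding card

    card-sum : ∀ (P : VSet) → card P ≡ sumL (map (λ x → ind (P x)) (allFin N))
    card-sum P = trans (sum-cong-≗ λ x → trans (sym (+-identityʳ (ind (P x)))) (cong (λ b → ind b * ind (P x)) (sym (⟪⟫⁺ (∈-allFin x)))))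
                       (∑-list (allFin⁺ N) (ind ∘ P))

  els : VSet → List Vx
  els P = filter (λ x → P x ≟ᵇ true) (allFin N)

  els-unique : ∀ P → Unique (els P)
  els-unique P = filter⁺ (λ x → P x ≟ᵇ true) (allFin⁺ N)

  els⁺ : ∀ {P x} → P x ≡ true → x ∈ els P
  els⁺ {P} {x} p = ∈-filter⁺ (λ x → P x ≟ᵇ true) (∈-allFin x) p

  els⁻ : ∀ {P x} → x ∈ els P → P x ≡ true
  els⁻ {P} m = proj₂ (∈-filter⁻ (λ x → P x ≟ᵇ true) {xs = allFin N} m)

  ⟪els⟫ : ∀ P x → ⟪ els P ⟫ x ≡ P x
  ⟪els⟫ P x with P x in p
  ... | true  = ⟪⟫⁺ (els⁺ {P} p)
  ... | false = ⟪⟫-∉ λ m → t≢f (els⁻ {P} m) p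

  els-length : ∀ P → length (els P) ≡ card P
  els-length P = trans (sym (card-list (els-unique P))) (card-cong (⟪els⟫ P))

  full : ∀ {P : VSet} {xs} → Unique xs → ⟪ xs ⟫ ⊑ P → card P ≤ length xs → P ⊑ ⟪ xs ⟫
  full {P} {xs} u sub h {x} p with bool? (⟪ xs ⟫ x)
  ... | inj₁ t = t
  ... | inj₂ f = ⊥-elim (<-irrefl refl (≤-trans h′ (≤-trans h (≤-reflexive (sym (card-list u))))))
    where
    h′ : card ⟪ xs ⟫ < card P
    h′ = ≤-trans (+-monoˡ-≤ (card ⟪ xs ⟫) (mem≤card {V = P ∖ ⟪ xs ⟫} (∖-intro {V = P} {X = ⟪ xs ⟫} p f)))
                 (≤-reflexive (sym (card-split (split-∖ {V = P} sub))))

  fresh : ∀ {P : VSet} {xs} → Unique xs → ⟪ xs ⟫ ⊑ P → length xs < card P → ∃ λ x → P x ≡ true × x ∉ xs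
  fresh {P} {xs} u sub h with card-pos {V = P ∖ ⟪ xs ⟫} h′
    where
    h′ : 1 ≤ card (P ∖ ⟪ xs ⟫)
    h′ = +-cancelʳ-≤ (card ⟪ xs ⟫) 1 _
      (≤-trans (s≤s (≤-reflexive (card-list u))) (≤-trans h (≤-reflexive (card-split (split-∖ {V = P} sub)))))
  ... | x , p = x , ∖⊑ {V = P} {X = ⟪ xs ⟫} p , λ m → t≢f (⟪⟫⁺ m) (∖-not {V = P} {X = ⟪ xs ⟫} p)

  -- Triangle-free subcubic graphs, connectedness and components

  record Good (E : Adj) (V : VSet) : Set where
    field
      symm : Symm E
      irr  : ∀ x → E x x ≡ false
      tri  : ∀ {x y z} → V x ≡ true → V y ≡ true → V z ≡ true →
             E x y ≡ true → E y z ≡ true → E x z ≡ true → ⊥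
      cub  : ∀ {x} → V x ≡ true → deg E V x ≤ 3

    symm⁺ : ∀ {x y} → E x y ≡ true → E y x ≡ true
    symm⁺ {x} {y} e = trans (symm y x) e

    adj≢ : ∀ {x y} → E x y ≡ true → x ≢ y
    adj≢ {x} e refl = t≢f e (irr x)

  good-⊑ : ∀ {E : Adj} {U V : VSet} → Good E V → U ⊑ V → Good E U
  good-⊑ g s = record { symm = symm ; irr = irr ; tri = λ a b c → tri (s a) (s b) (s c)
                      ; cub = λ {x} u → ≤-trans (deg-mono x s) (cub (s u)) }
    where open Good g

  -- Closed subsets of `V` are its unions of components. Looseness and connectedness quantify over
  -- them instead of walks, because they transfer directly through deletion, suppression and added
  -- edges.
  Closed : Adj → VSet → VSet → Set
  Closed E V U = ∀ {x y} → U x ≡ true → V y ≡ true → E x y ≡ true → U y ≡ true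

  Nonempty : VSet → Set
  Nonempty U = ∃ λ x → U x ≡ true

  Loose : Adj → VSet → Set
  Loose E V = ∀ U → Nonempty U → U ⊑ V → Closed E V U → ∃ λ u → U u ≡ true × deg E V u ≤ 2

  Conn : Adj → VSet → Set
  Conn E V = ∀ U → Nonempty U → U ⊑ V → Closed E V U → V ⊑ U

  Proper : Adj → VSet → VSet → Set
  Proper E V U = Nonempty U × (∀ x → U x ≡ true → V x ≡ true) ×
                 (∀ x y → U x ≡ true → V y ≡ true → E x y ≡ true → U y ≡ true) ×
                 (∃ λ x → V x ≡ true × U x ≡ false)

  proper? : ∀ E V U → Dec (Proper E V U)
  proper? E V U = any? (λ x → U x ≟ᵇ true) ×-dec
                  all? (λ x → (U x ≟ᵇ true) →-dec (V x ≟ᵇ true)) ×-dec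
                  all? (λ x → all? λ y → (U x ≟ᵇ true) →-dec ((V y ≟ᵇ true) →-dec ((E x y ≟ᵇ true) →-dec (U y ≟ᵇ true)))) ×-dec
                  any? (λ x → (V x ≟ᵇ true) ×-dec (U x ≟ᵇ false))

  -- Decided by trying all subsets; the second outcome supplies a set that splits `V`.
  conn? : ∀ E V → Conn E V ⊎ ∃ (Proper E V)
  conn? E V with anySubset? (λ S → proper? E V (lookup S))
  ... | yes (S , p) = inj₂ (lookup S , p)
  ... | no ¬p = inj₁ λ U ne sub cl {v} Vv → conn U ne sub cl v Vv (bool? (U v))
    where
    conn : ∀ U → Nonempty U → U ⊑ V → Closed E V U → ∀ v → V v ≡ true → (U v ≡ true) ⊎ (U v ≡ false) → U v ≡ true
    conn U ne sub cl v Vv (inj₁ t) = t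
    conn U (z , Uz) sub cl v Vv (inj₂ f) = ⊥-elim (¬p (tabulate U ,
      (z , trans (eq z) Uz) , (λ x p → sub (trans (sym (eq x)) p)) ,
      (λ x y p q e → trans (eq y) (cl (trans (sym (eq x)) p) q e)) , (v , Vv , trans (eq v) f)))
      where
      eq : ∀ x → lookup (tabulate U) x ≡ U x
      eq = lookup∘tabulate U

  record Comp (E : Adj) (V : VSet) (s : Vx) : Set where
    field
      K      : VSet
      s∈K    : K s ≡ true
      K⊑V    : K ⊑ V
      closed : Closed E V K
      conn   : Conn E K

  -- While a proper closed subset exists, it or its complement contains s and is smaller. Closedness
  -- is transitive and, by symmetry, passes to complements.
  component : ∀ {E} V s → Symm E → V s ≡ true → Comp E V s
  component {E} V s sy Vs = go (card V) V ≤-refl Vs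
    where
    go : ∀ n V → card V ≤ n → V s ≡ true → Comp E V s
    go zero V h Vs with ≤-trans (mem≤card {V = V} Vs) h
    ... | ()
    go (suc n) V h Vs with conn? E V
    ... | inj₁ c = record { K = V ; s∈K = Vs ; K⊑V = λ p → p ; closed = λ _ q _ → q ; conn = c }
    ... | inj₂ (U , (z , Uz) , sub , cl , (w , Vw , Uw)) with bool? (U s)
    ... | inj₁ Us = record { K = K ; s∈K = s∈K ; K⊑V = λ p → sub _ (K⊑V p)
                           ; closed = λ p q e → closed p (cl _ _ (K⊑V p) q e) e ; conn = conn }
      where
      lt : card U < card V
      lt = ≤-trans (+-monoˡ-≤ (card U) (mem≤card {V = V ∖ U} (∖-intro {V = V} {X = U} Vw Uw)))
                   (≤-reflexive (sym (card-split (split-∖ {V = V} (sub _)))))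
      open Comp (go n U (≤-pred (≤-trans lt h)) Us)
    ... | inj₂ Us = record { K = K ; s∈K = s∈K ; K⊑V = λ p → ∖⊑ {V = V} {X = U} (K⊑V p)
                           ; closed = λ p q e → closed p (∖-intro {V = V} {X = U} q (¬true λ t →
                               t≢f (cl _ _ t (∖⊑ {V = V} {X = U} (K⊑V p)) (trans (sy _ _) e)) (∖-not {V = V} {X = U} (K⊑V p)))) e
                           ; conn = conn }
      where
      open Comp (go n (V ∖ U) (≤-pred (≤-trans (card-∖< {V = V} (sub _) Uz) h)) (∖-intro {V = V} {X = U} Vs Us))

  closed-edges : ∀ {E : Adj} {V K} → Closed E V K → eb E K (V ∖ K) ≡ 0
  closed-edges {E} {V} {K} cl = eb-zero {E} λ p q e → t≢f (cl p (∖⊑ {V = V} {X = K} q) e) (∖-not {V = V} {X = K} q)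

  closed-deg : ∀ {E : Adj} {V K x} → K ⊑ V → Closed E V K → K x ≡ true → deg E V x ≡ deg E K x
  closed-deg {E} {V} {K} {x} sub cl k = trans (deg-split x (split-∖ {V = V} sub))
    (cong (_+ deg E K x) (deg-zero {E} λ q e → t≢f (cl k (∖⊑ {V = V} {X = K} q) e) (∖-not {V = V} {X = K} q)))

  -- λ is additive here because no edge joins K to the rest.
  val-union : ∀ {E : Adj} {V K a b c d} → Symm E → K ⊑ V → Closed E V K →
              Val E K a b → Val E (V ∖ K) c d → Val E V (a + c) (b + d)
  val-union {E} {V} {K} {a} {b} {c} {d} sy sub cl (val S S⊑ iS bS) (val R R⊑ iR bR) =
    val (R ∪ S) sub′ ind′ (subst₂ _≤_ (cong (λ z → 14 * z + (a + c)) (sym cV))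
      (cong₂ (λ z w → 30 * z + (w + (b + d))) (sym cS) (sym eV)) final)
    where
    V′ = V ∖ K
    spl = split-∖ {V = V} {K} sub
    cV = card-split spl
    cS = card-split (split-∪ {A = R} {S} λ r s → t≢f (S⊑ s) (∖-not {V = V} {X = K} (R⊑ r)))
    eV : eb E V V ≡ eb E V′ V′ + eb E K K + 2 * 0
    eV = trans (eb-split {E = E} sy spl) (cong (λ z → eb E V′ V′ + eb E K K + 2 * z) (closed-edges {E} {V} {K} cl))
    sub′ : R ∪ S ⊑ V
    sub′ {x} p with R x in r
    ... | true  = ∖⊑ {V = V} {X = K} (R⊑ r)
    ... | false = sub (S⊑ p)
    cross : ∀ {x y} → S x ≡ true → R y ≡ true → E x y ≡ false
    cross s r = ¬true λ e → t≢f (cl (S⊑ s) (∖⊑ {V = V} {X = K} (R⊑ r)) e) (∖-not {V = V} {X = K} (R⊑ r))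
    ind′ : Indep E (R ∪ S)
    ind′ {x} {y} p q with R x in rx | R y in ry
    ... | true  | true  = iR rx ry
    ... | true  | false = trans (sy x y) (cross q rx)
    ... | false | true  = cross p ry
    ... | false | false = iS p q
    final : 14 * (card V′ + card K) + (a + c) ≤ 30 * (card R + card S) + (eb E V′ V′ + eb E K K + 2 * 0 + (b + d))
    final = lin 0 (+-mono-≤ bS bR) (lem (card V′) (card K) (card R) (card S) (eb E V′ V′) (eb E K K) a b c d)
      where
      lem : ∀ v k r s e f a b c d → 14 * (v + k) + (a + c) + (30 * s + (f + b) + (30 * r + (e + d))) + 0
        ≡ 30 * (r + s) + (e + f + 2 * 0 + (b + d)) + (14 * k + a + (14 * v + c))
      lem = solve-∀

  val-weaken : ∀ {E : Adj} {V a b c d} → a + d ≤ c + b → Val E V c d → Val E V a b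
  val-weaken {E} {V} {a} {b} {c} {d} h (val S s i bd) = val S s i
    (lin 0 (+-mono-≤ h bd) (lem (card V) (card S) (eb E V V) a b c d))
    where
    lem : ∀ v s e a b c d → 14 * v + a + (c + b + (30 * s + (e + d))) + 0 ≡ 30 * s + (e + b) + (a + d + (14 * v + c))
    lem = solve-∀

  deg-drop : ∀ {E : Adj} {V X u x} → X ⊑ V → X x ≡ true → E u x ≡ true → deg E (V ∖ X) u < deg E V u
  deg-drop {E} {V} {X} {u} sub p e = lin 0 (deg-pos {E} {X} p e)
    (trans (lem (deg E (V ∖ X) u) (deg E X u)) (cong (_+ 1) (sym (deg-split u (split-∖ {V = V} sub)))))
    where
    lem : ∀ a b → suc a + b + 0 ≡ a + b + 1
    lem = solve-∀

  Meets Apart : Adj → VSet → VSet → Set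
  Meets E U X = ∃ λ u → U u ≡ true × ∃ λ x → X x ≡ true × E u x ≡ true
  Apart E U X = ∀ {u x} → U u ≡ true → X x ≡ true → E u x ≡ true → ⊥

  CommonNb : Adj → VSet → Vx → Vx → Set
  CommonNb E V p q = ∃ λ w → V w ≡ true × E p w ≡ true × E q w ≡ true

  meets? : ∀ (E : Adj) (U X : VSet) → (Meets E U X) ⊎
           Apart E U X
  meets? E U X with any? (λ u → (U u ≟ᵇ true) ×-dec any? (λ x → (X x ≟ᵇ true) ×-dec (E u x ≟ᵇ true)))
  ... | yes p = inj₁ p
  ... | no ¬p = inj₂ λ {u} {x} a b c → ¬p (u , a , x , b , c)

  closed-lift : ∀ {E : Adj} {V X U : VSet} → Apart E U X →
                Closed E (V ∖ X) U → Closed E V U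
  closed-lift {E} {V} {X} h cl u v e = cl u (∖-intro {V = V} {X = X} v (¬true λ x → h u x e)) e

  -- A component of `V ∖ X` with an edge to X has a vertex that lost a neighbour, so its degree is
  -- at most 2; a component without such an edge is already closed in `V`.
  loose-∖ : ∀ {E : Adj} {V X} → Good E V → X ⊑ V → Loose E V → Loose E (V ∖ X)
  loose-∖ {E} {V} {X} g sub lo U ne U⊑ cl with meets? E U X
  ... | inj₁ (u , a , x , b , e) = u , a , ≤-pred (≤-trans (deg-drop {E} sub b e) (Good.cub g (∖⊑ {V = V} {X = X} (U⊑ a))))
  ... | inj₂ h with lo U ne (λ p → ∖⊑ {V = V} {X = X} (U⊑ p)) (closed-lift {E} {V} {X} h cl)
  ... | u , a , d = u , a , ≤-trans (deg-mono u (∖⊑ {V = V} {X = X})) d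

  -- By connectedness every component of the rest has an edge to X, and the end of this edge has
  -- lost a neighbour.
  loose-conn : ∀ {E : Adj} {V X} → Good E V → X ⊑ V → Nonempty X → Conn E V → Loose E (V ∖ X)
  loose-conn {E} {V} {X} g sub (z , Xz) co U ne U⊑ cl with meets? E U X
  ... | inj₁ (u , a , x , b , e) = u , a , ≤-pred (≤-trans (deg-drop {E} sub b e) (Good.cub g (∖⊑ {V = V} {X = X} (U⊑ a))))
  ... | inj₂ h = ⊥-elim (t≢f Xz (∖-not {V = V} {X = X} (U⊑ (co U ne (λ p → ∖⊑ {V = V} {X = X} (U⊑ p)) (closed-lift {E} {V} {X} h cl) (sub Xz)))))

  loose-low : ∀ {E : Adj} {V u} → Conn E V → V u ≡ true → deg E V u ≤ 2 → Loose E V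
  loose-low co v d U ne sub cl = _ , co U ne sub cl v , d

  deg-exact : ∀ {E V x xs} → Unique xs → (∀ {y} → y ∈ xs → V y ≡ true × E x y ≡ true) →
              (∀ {y} → V y ≡ true → E x y ≡ true → y ∈ xs) → deg E V x ≡ length xs
  deg-exact {E} {V} {x} {xs} u h k = trans (deg-card E V x)
    (trans (card-cong {U = λ y → V y ∧ E x y} {V = ⟪ xs ⟫} pt) (card-list u))
    where
    pt : ∀ y → (V y ∧ E x y) ≡ ⟪ xs ⟫ y
    pt y with V y in v | E x y in e
    ... | true  | true  = sym (⟪⟫⁺ (k v e))
    ... | true  | false = sym (⟪⟫-∉ λ m → t≢f (proj₂ (h m)) e)
    ... | false | _     = sym (⟪⟫-∉ λ m → t≢f (proj₁ (h m)) v)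

  -- Adding an edge and suppressing two adjacent vertices of degree 2

  record Pair (E : Adj) (V : VSet) (s t p q : Vx) : Set where
    field
      s∈ : V s ≡ true
      t∈ : V t ≡ true
      p∈ : V p ≡ true
      q∈ : V q ≡ true
      st : E s t ≡ true
      sp : E s p ≡ true
      tq : E t q ≡ true
      nbS : ∀ {y} → V y ≡ true → E s y ≡ true → y ≡ t ⊎ y ≡ p
      nbT : ∀ {y} → V y ≡ true → E t y ≡ true → y ≡ s ⊎ y ≡ q
      p≢t : p ≢ t
      q≢s : q ≢ s
      p≢q : p ≢ q

  unique₂ : ∀ {x y : Vx} → x ≢ y → Unique (x ∷ y ∷ [])
  unique₂ h = (h ∷ []) ∷ [] ∷ []

  addE : Adj → Vx → Vx → Adj
  addE E p q x y = E x y ∨ (does (x ≟ p) ∧ does (y ≟ q) ∨ does (x ≟ q) ∧ does (y ≟ p))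

  addE⁻ : ∀ {E p q x y} → addE E p q x y ≡ true → E x y ≡ true ⊎ (x ≡ p × y ≡ q) ⊎ (x ≡ q × y ≡ p)
  addE⁻ {E} {p} {q} {x} {y} h with E x y | x ≟ p | y ≟ q | x ≟ q | y ≟ p
  ... | true  | _ | _ | _ | _ = inj₁ refl
  ... | false | yes a | yes b | _ | _ = inj₂ (inj₁ (a , b))
  ... | false | yes a | no b | yes c | yes d = inj₂ (inj₂ (c , d))
  ... | false | no a | _ | yes c | yes d = inj₂ (inj₂ (c , d))

  addE⁺ : ∀ {E p q x y} → E x y ≡ true → addE E p q x y ≡ true
  addE⁺ h rewrite h = refl

  addE-pq : ∀ {E p q} → addE E p q p q ≡ true
  addE-pq {E} {p} {q} with E p q
  ... | true = refl
  ... | false rewrite does-refl p | does-refl q = refl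

  addE-false : ∀ {E p q x y} → addE E p q x y ≡ false → E x y ≡ false
  addE-false {E} {x = x} {y} h with E x y
  ... | false = refl

  addE-sym : ∀ {E p q} → Symm E → Symm (addE E p q)
  addE-sym {E} {p} {q} sy x y rewrite sy x y = cong (E y x ∨_) (lem (does (x ≟ p)) (does (y ≟ q)) (does (x ≟ q)) (does (y ≟ p)))
    where
    lem : ∀ a b c d → (a ∧ b ∨ c ∧ d) ≡ (d ∧ c ∨ b ∧ a)
    lem a b c d rewrite ∧-comm a b | ∧-comm c d = ∨-comm (b ∧ a) (d ∧ c)

  ∨-pad : ∀ v e → ind v * ind (e ∨ false) ≡ ind v * ind e + 0
  ∨-pad v true  = sym (+-identityʳ _)
  ∨-pad v false = sym (+-identityʳ _)

  opaque
    unfolding deg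

    deg-addE : ∀ {E V p q x} → E p q ≡ false → E q p ≡ false → p ≢ q → V p ≡ true → V q ≡ true →
               deg (addE E p q) V x ≡ deg E V x + (ind (does (x ≟ p)) + ind (does (x ≟ q)))
    deg-addE {E} {V} {p} {q} {x} npq nqp p≢q Vp Vq = begin
      ∑ (λ y → ind (V y) * ind (addE E p q x y))
        ≡⟨ sum-cong-≗ pt ⟩
      ∑ (λ y → ind (V y) * ind (E x y) + (ind (does (y ≟ q)) * a + ind (does (y ≟ p)) * b))
        ≡⟨ ∑-distrib-+ (λ y → ind (V y) * ind (E x y)) (λ y → ind (does (y ≟ q)) * a + ind (does (y ≟ p)) * b) ⟩
      deg E V x + ∑ (λ y → ind (does (y ≟ q)) * a + ind (does (y ≟ p)) * b)
        ≡⟨ cong (deg E V x +_) (trans (∑-distrib-+ (λ y → ind (does (y ≟ q)) * a) (λ y → ind (does (y ≟ p)) * b))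
             (cong₂ _+_ (∑-δ q (λ _ → a)) (∑-δ p (λ _ → b)))) ⟩
      deg E V x + (a + b) ∎
      where
      open ≡-Reasoning
      a b : ℕ
      a = ind (does (x ≟ p))
      b = ind (does (x ≟ q))
      pt : ∀ y → ind (V y) * ind (addE E p q x y) ≡ ind (V y) * ind (E x y) + (ind (does (y ≟ q)) * a + ind (does (y ≟ p)) * b)
      pt y with x ≟ p | y ≟ q | x ≟ q | y ≟ p
      ... | yes refl | _ | yes x≡q | _ = ⊥-elim (p≢q x≡q)
      ... | _ | yes refl | _ | yes y≡p = ⊥-elim (p≢q (sym y≡p))
      ... | yes refl | yes refl | no _ | no _ rewrite npq | Vq = refl
      ... | no _ | no _ | yes refl | yes refl rewrite nqp | Vp = refl
      ... | yes _ | no _ | no _ | yes _ = ∨-pad (V y) (E x y)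
      ... | yes _ | no _ | no _ | no _ = ∨-pad (V y) (E x y)
      ... | no _ | yes _ | yes _ | no _ = ∨-pad (V y) (E x y)
      ... | no _ | yes _ | no _ | no _ = ∨-pad (V y) (E x y)
      ... | no _ | no _ | yes _ | no _ = ∨-pad (V y) (E x y)
      ... | no _ | no _ | no _ | yes _ = ∨-pad (V y) (E x y)
      ... | no _ | no _ | no _ | no _ = ∨-pad (V y) (E x y)

  -- One new edge in a triangle makes the third vertex a common neighbour of p and q; two new edges
  -- would force a loop or p ≡ q.
  addE-tri : ∀ {E V p q} → Good E V → p ≢ q → (∀ {w} → V w ≡ true → E p w ≡ true → E q w ≡ true → ⊥) →
             ∀ {x y z} → V x ≡ true → V y ≡ true → V z ≡ true →
             addE E p q x y ≡ true → addE E p q y z ≡ true → addE E p q x z ≡ true → ⊥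
  addE-tri {E} {V} {p} {q} g p≢q noc {x} {y} {z} Vx Vy Vz a b c
    with addE⁻ {E} {p} {q} {x} {y} a | addE⁻ {E} {p} {q} {y} {z} b | addE⁻ {E} {p} {q} {x} {z} c
  ... | inj₁ a | inj₁ b | inj₁ c = Good.tri g Vx Vy Vz a b c
  ... | inj₁ a | inj₁ b | inj₂ (inj₁ (refl , refl)) = noc Vy a (Good.symm⁺ g b)
  ... | inj₁ a | inj₁ b | inj₂ (inj₂ (refl , refl)) = noc Vy (Good.symm⁺ g b) a
  ... | inj₁ a | inj₂ (inj₁ (refl , refl)) | inj₁ c = noc Vx (Good.symm⁺ g a) (Good.symm⁺ g c)
  ... | inj₁ a | inj₂ (inj₂ (refl , refl)) | inj₁ c = noc Vx (Good.symm⁺ g c) (Good.symm⁺ g a)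
  ... | inj₂ (inj₁ (refl , refl)) | inj₁ b | inj₁ c = noc Vz c b
  ... | inj₂ (inj₂ (refl , refl)) | inj₁ b | inj₁ c = noc Vz b c
  ... | inj₁ a | inj₂ (inj₁ (refl , refl)) | inj₂ (inj₁ (refl , e)) = Good.adj≢ g a refl
  ... | inj₁ a | inj₂ (inj₁ (refl , refl)) | inj₂ (inj₂ (refl , e)) = p≢q (sym e)
  ... | inj₁ a | inj₂ (inj₂ (refl , refl)) | inj₂ (inj₁ (refl , e)) = p≢q e
  ... | inj₁ a | inj₂ (inj₂ (refl , refl)) | inj₂ (inj₂ (refl , e)) = Good.adj≢ g a refl
  ... | inj₂ (inj₁ (refl , refl)) | inj₁ b | inj₂ (inj₁ (e , refl)) = Good.adj≢ g b refl
  ... | inj₂ (inj₁ (refl , refl)) | inj₁ b | inj₂ (inj₂ (e , refl)) = p≢q e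
  ... | inj₂ (inj₂ (refl , refl)) | inj₁ b | inj₂ (inj₁ (e , refl)) = p≢q (sym e)
  ... | inj₂ (inj₂ (refl , refl)) | inj₁ b | inj₂ (inj₂ (e , refl)) = Good.adj≢ g b refl
  ... | inj₂ (inj₁ (refl , refl)) | inj₂ (inj₁ (e , refl)) | _ = p≢q (sym e)
  ... | inj₂ (inj₂ (refl , refl)) | inj₂ (inj₂ (e , refl)) | _ = p≢q e
  ... | inj₂ (inj₁ (refl , refl)) | inj₂ (inj₂ (refl , refl)) | inj₁ c = Good.adj≢ g c refl
  ... | inj₂ (inj₁ (refl , refl)) | inj₂ (inj₂ (refl , refl)) | inj₂ (inj₁ (_ , e)) = p≢q e
  ... | inj₂ (inj₁ (refl , refl)) | inj₂ (inj₂ (refl , refl)) | inj₂ (inj₂ (e , _)) = p≢q e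
  ... | inj₂ (inj₂ (refl , refl)) | inj₂ (inj₁ (refl , refl)) | inj₁ c = Good.adj≢ g c refl
  ... | inj₂ (inj₂ (refl , refl)) | inj₂ (inj₁ (refl , refl)) | inj₂ (inj₁ (e , _)) = p≢q (sym e)
  ... | inj₂ (inj₂ (refl , refl)) | inj₂ (inj₁ (refl , refl)) | inj₂ (inj₂ (_ , e)) = p≢q (sym e)

  addE-irr : ∀ {E V p q} → Good E V → p ≢ q → ∀ x → addE E p q x x ≡ false
  addE-irr {E} {V} {p} {q} g p≢q x = ¬true λ t → h (addE⁻ {E} {p} {q} {x} {x} t)
    where
    h : E x x ≡ true ⊎ (x ≡ p × x ≡ q) ⊎ (x ≡ q × x ≡ p) → ⊥
    h (inj₁ e) = t≢f e (Good.irr g x)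
    h (inj₂ (inj₁ (refl , e))) = p≢q e
    h (inj₂ (inj₂ (refl , e))) = p≢q (sym e)

  -- Replacing a path p − s − t − q whose inner vertices have degree 2 by the edge p q.
  module Suppress {E : Adj} {V : VSet} {s t p q : Vx} (g : Good E V) (P : Pair E V s t p q)
    (npq : E p q ≡ false) (noc : ∀ {w} → V w ≡ true → E p w ≡ true → E q w ≡ true → ⊥) where

    open Good g
    open Pair P

    E⁺ : Adj
    E⁺ = addE E p q

    st-set V⁻ : VSet
    st-set = ⟪ s ∷ t ∷ [] ⟫
    V⁻ = V ∖ st-set

    s≢t : s ≢ t
    s≢t = adj≢ st

    ust : Unique (s ∷ t ∷ [])
    ust = unique₂ s≢t

    st⊑V : st-set ⊑ V
    st⊑V = ⟪⟫-⊑ {V = V} (s∈ ∷ t∈ ∷ [])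

    spl : Split V V⁻ st-set
    spl = split-∖ {V} st⊑V

    V⁻-intro : ∀ {x} → V x ≡ true → x ≢ s → x ≢ t → V⁻ x ≡ true
    V⁻-intro v a b = ∖-intro {V} {st-set} v (⟪⟫-∉ {s ∷ t ∷ []} λ { (here e) → a e ; (there (here e)) → b e })

    V⁻⊑V : V⁻ ⊑ V
    V⁻⊑V = ∖⊑ {V} {st-set}

    V⁻≢s : ∀ {x} → V⁻ x ≡ true → x ≢ s
    V⁻≢s p refl = t≢f (⟪⟫⁺ {s ∷ t ∷ []} (here refl)) (∖-not {V} {st-set} p)

    V⁻≢t : ∀ {x} → V⁻ x ≡ true → x ≢ t
    V⁻≢t p refl = t≢f (⟪⟫⁺ {s ∷ t ∷ []} (there (here refl))) (∖-not {V} {st-set} p)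

    p∈⁻ : V⁻ p ≡ true
    p∈⁻ = V⁻-intro p∈ (λ e → adj≢ sp (sym e)) p≢t

    q∈⁻ : V⁻ q ≡ true
    q∈⁻ = V⁻-intro q∈ q≢s (λ e → adj≢ tq (sym e))

    npq′ : E q p ≡ false
    npq′ = trans (symm q p) npq

    card-supp : card V ≡ card V⁻ + 2
    card-supp = trans (card-split spl) (cong (card V⁻ +_) (card-list ust))

    -- At p the lost neighbour s is replaced by q, at q the lost t by p; no other remaining vertex
    -- was adjacent to s or t.
    deg-supp : ∀ {x} → V⁻ x ≡ true → deg E⁺ V⁻ x ≡ deg E V x
    deg-supp {x} vx = trans (deg-addE {E} {V⁻} {p} {q} {x} npq npq′ p≢q p∈⁻ q∈⁻) (sym
      (trans (deg-split x spl) (cong (deg E V⁻ x +_) (trans (deg-list {E} x ust)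
        (trans (cong (ind (E x s) +_) (+-identityʳ (ind (E x t)))) (cong₂ _+_ (cong ind xs) (cong ind xt)))))))
      where
      xs : E x s ≡ does (x ≟ p)
      xs with x ≟ p
      ... | yes refl = symm⁺ sp
      ... | no x≢p = ¬true λ e → case (nbS (V⁻⊑V vx) (symm⁺ e))
        where
        case : x ≡ t ⊎ x ≡ p → ⊥
        case (inj₁ e) = V⁻≢t vx e
        case (inj₂ e) = x≢p e
      xt : E x t ≡ does (x ≟ q)
      xt with x ≟ q
      ... | yes refl = symm⁺ tq
      ... | no x≢q = ¬true λ e → case (nbT (V⁻⊑V vx) (symm⁺ e))
        where
        case : x ≡ s ⊎ x ≡ q → ⊥
        case (inj₁ e) = V⁻≢s vx e
        case (inj₂ e) = x≢q e

    deg-s : deg E V s ≡ 2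
    deg-s = deg-exact {E} {V} {s} {t ∷ p ∷ []} (unique₂ (p≢t ∘ sym))
      (λ { (here refl) → t∈ , st ; (there (here refl)) → p∈ , sp })
      (λ v e → h (nbS v e))
      where
      h : ∀ {y} → y ≡ t ⊎ y ≡ p → y ∈ t ∷ p ∷ []
      h (inj₁ e) = here e
      h (inj₂ e) = there (here e)

    deg-t : deg E V t ≡ 2
    deg-t = deg-exact {E} {V} {t} {s ∷ q ∷ []} (unique₂ (q≢s ∘ sym))
      (λ { (here refl) → s∈ , symm⁺ st ; (there (here refl)) → q∈ , tq })
      (λ v e → h (nbT v e))
      where
      h : ∀ {y} → y ≡ s ⊎ y ≡ q → y ∈ s ∷ q ∷ []
      h (inj₁ e) = here e
      h (inj₂ e) = there (here e)

    eb-supp : eb E V V ≡ eb E⁺ V⁻ V⁻ + 4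
    eb-supp = trans (eb-splitˡ V spl) (cong₂ _+_ (sym (eb-cong {E⁺} {E} {V⁻} {V⁻} {V} deg-supp))
      (trans (eb-list {E} V ust) (cong₂ (λ a b → a + (b + 0)) deg-s deg-t)))

    good : Good E⁺ V⁻
    good = record
      { symm = addE-sym symm
      ; irr  = addE-irr g p≢q
      ; tri  = λ a b c → addE-tri g p≢q noc (V⁻⊑V a) (V⁻⊑V b) (V⁻⊑V c)
      ; cub  = λ {x} v → ≤-trans (≤-reflexive (deg-supp v)) (cub (V⁻⊑V v)) }

    -- The new edge keeps p and q from both lying in S, so s or t can be added. Two vertices and a
    -- degree sum of 4 come back: 30 - 28 + 4 = 6.
    supp-val : ∀ {a b} → Val E⁺ V⁻ a b → Val E V (a + 6) b
    supp-val {a} {b} (val S S⊑ iS bS) = pick (bool? (S p))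
      where
      iE : ∀ {x y} → S x ≡ true → S y ≡ true → E x y ≡ false
      iE {x} {y} sx sy = addE-false {E} {p} {q} {x} {y} (iS sx sy)
      build : ∀ z → V z ≡ true → (∀ {y} → S y ≡ true → y ≢ z) → (∀ {y} → S y ≡ true → E z y ≡ false) → Val E V (a + 6) b
      build z Vz dis adj = val (S ∪ ⟪ z ∷ [] ⟫) sub ind′ final
        where
        z-only : ∀ {x} → ⟪ z ∷ [] ⟫ x ≡ true → x ≡ z
        z-only {x} = ⟪⟫-single {z} {x}
        sub : S ∪ ⟪ z ∷ [] ⟫ ⊑ V
        sub {x} h with S x in sx
        ... | true  = V⁻⊑V (S⊑ sx)
        ... | false rewrite z-only {x} h = Vz
        ind′ : Indep E (S ∪ ⟪ z ∷ [] ⟫)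
        ind′ {x} {y} h k with S x in sx | S y in sy
        ... | true  | true  = iE sx sy
        ... | true  | false rewrite z-only {y} k = trans (symm x z) (adj sx)
        ... | false | true  rewrite z-only {x} h = adj sy
        ... | false | false rewrite z-only {x} h | z-only {y} k = irr z
        cS : card (S ∪ ⟪ z ∷ [] ⟫) ≡ card S + 1
        cS = trans (card-split (split-∪ {S} {⟪ z ∷ [] ⟫} λ h k → dis h (z-only k)))
                   (cong (card S +_) (card-list {z ∷ []} ([] ∷ [])))
        final : 14 * card V + (a + 6) ≤ 30 * card (S ∪ ⟪ z ∷ [] ⟫) + (eb E V V + b)
        final rewrite cS | card-supp | eb-supp =
          lin 0 bS (lem (card V⁻) (card S) (eb E⁺ V⁻ V⁻) a b)
          where
          lem : ∀ v s e a b → 14 * (v + 2) + (a + 6) + (30 * s + (e + b)) + 0 ≡ 30 * (s + 1) + (e + 4 + b) + (14 * v + a)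
          lem = solve-∀
      pick : S p ≡ true ⊎ S p ≡ false → Val E V (a + 6) b
      pick (inj₂ np) = build s s∈ (λ h → V⁻≢s (S⊑ h)) λ {y} h → ¬true λ e → case h (nbS (V⁻⊑V (S⊑ h)) e)
        where
        case : ∀ {y} → S y ≡ true → y ≡ t ⊎ y ≡ p → ⊥
        case h (inj₁ e) = V⁻≢t (S⊑ h) e
        case h (inj₂ refl) = t≢f h np
      pick (inj₁ yp) = build t t∈ (λ h → V⁻≢t (S⊑ h)) λ {y} h → ¬true λ e → case h (nbT (V⁻⊑V (S⊑ h)) e)
        where
        case : ∀ {y} → S y ≡ true → y ≡ s ⊎ y ≡ q → ⊥
        case h (inj₁ e) = V⁻≢s (S⊑ h) e
        case h (inj₂ refl) = t≢f (addE-pq {E} {p} {q}) (iS yp h)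

    -- A closed set of the new graph contains both or none of p and q; adding s and t in the first
    -- case makes it closed in the old graph.
    supp-conn : Conn E V → Conn E⁺ V⁻
    supp-conn co U (z , Uz) U⊑ cl {x} vx = back (co U′ (z , ∨-l Uz) U′⊑ cl′ (V⁻⊑V vx))
      where
      touch : Bool
      touch = U p ∨ U q
      ∨-l : ∀ {a b} → a ≡ true → a ∨ b ≡ true
      ∨-l refl = refl
      ∨-r : ∀ {a b} → b ≡ true → a ∨ b ≡ true
      ∨-r {true}  refl = refl
      ∨-r {false} refl = refl
      U′ : VSet
      U′ = U ∪ (λ x → st-set x ∧ touch)
      back : U′ x ≡ true → U x ≡ true
      back h with U x
      ... | true = refl
      ... | false = ⊥-elim (t≢f (proj₁ (∧-true h)) (∖-not {V} {st-set} vx))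
      U′⊑ : U′ ⊑ V
      U′⊑ {y} h with U y in uy
      ... | true  = V⁻⊑V (U⊑ uy)
      ... | false = st⊑V (proj₁ (∧-true h))
      pq : touch ≡ true → U p ≡ true × U q ≡ true
      pq h with U p in up | U q in uq
      ... | true  | true  = refl , refl
      ... | true  | false = ⊥-elim (t≢f (cl up q∈⁻ (addE-pq {E} {p} {q})) uq)
      ... | false | true  = ⊥-elim (t≢f (cl uq p∈⁻ (trans (addE-sym symm q p) (addE-pq {E} {p} {q}))) up)
      s∈st : st-set s ≡ true
      s∈st = ⟪⟫⁺ {s ∷ t ∷ []} (here refl)
      t∈st : st-set t ≡ true
      t∈st = ⟪⟫⁺ {s ∷ t ∷ []} (there (here refl))
      in-st : ∀ {y} → y ∈ s ∷ t ∷ [] → touch ≡ true → U′ y ≡ true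
      in-st (here refl) h = ∨-r (∧-intro s∈st h)
      in-st (there (here refl)) h = ∨-r (∧-intro t∈st h)
      cl′ : Closed E V U′
      cl′ {y} {w} h vw e with U y in uy
      ... | true with s ≟ w | t ≟ w
      ... | yes refl | _ = in-st (here refl) (case (nbS (V⁻⊑V (U⊑ uy)) (symm⁺ e)))
        where
        case : y ≡ t ⊎ y ≡ p → touch ≡ true
        case (inj₁ e′) = ⊥-elim (V⁻≢t (U⊑ uy) e′)
        case (inj₂ refl) = ∨-l uy
      ... | no _ | yes refl = in-st (there (here refl)) (case (nbT (V⁻⊑V (U⊑ uy)) (symm⁺ e)))
        where
        case : y ≡ s ⊎ y ≡ q → touch ≡ true
        case (inj₁ e′) = ⊥-elim (V⁻≢s (U⊑ uy) e′)
        case (inj₂ refl) = ∨-r uy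
      ... | no w≢s | no w≢t = ∨-l (cl uy (V⁻-intro vw (w≢s ∘ sym) (w≢t ∘ sym)) (addE⁺ {E} {p} {q} e))
      cl′ {y} {w} h vw e | false with ⟪⟫⁻ {s ∷ t ∷ []} {y} (proj₁ (∧-true h)) | pq (proj₂ (∧-true {st-set y} h))
      ... | here refl | up , uq = case (nbS vw e)
        where
        case : w ≡ t ⊎ w ≡ p → U′ w ≡ true
        case (inj₁ refl) = in-st (there (here refl)) (∨-l up)
        case (inj₂ refl) = ∨-l up
      ... | there (here refl) | up , uq = case (nbT vw e)
        where
        case : w ≡ s ⊎ w ≡ q → U′ w ≡ true
        case (inj₁ refl) = in-st (here refl) (∨-l up)
        case (inj₂ refl) = ∨-l uq

  -- Soundness of certificates

  -- `φ` is total on ℕ for convenience; its values beyond the vertices of the pattern are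
  -- unconstrained.
  record Emb (E : Adj) (V : VSet) (P : Pat) (φ : ℕ → Vx) : Set where
    field
      inV   : ∀ {i} → i < proj₁ P → V (φ i) ≡ true
      inj   : ∀ {i j} → i < proj₁ P → j < proj₁ P → φ i ≡ φ j → i ≡ j
      edges : All (λ e → E (φ (proj₁ e)) (φ (proj₂ e)) ≡ true) (proj₂ P)

    edge : ∀ {a b} → (a , b) ∈ proj₂ P → E (φ a) (φ b) ≡ true
    edge m = All.lookup edges m

    edge! : ∀ a b → edgeᵇ a b (proj₂ P) ≡ true → E (φ a) (φ b) ≡ true
    edge! a b h = edge (edgeᵇ⁻ h)

    inV! : ∀ {i} → (i <ᵇ proj₁ P) ≡ true → V (φ i) ≡ true
    inV! h = inV (<ᵇ⁻ h)

    apart : ∀ {i j} → (i <ᵇ proj₁ P) ≡ true → (j <ᵇ proj₁ P) ≡ true → (i ≡ᵇ j) ≡ false → φ i ≢ φ j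
    apart {i} a b h eq = t≢f (subst (λ z → (i ≡ᵇ z) ≡ true) (inj (<ᵇ⁻ a) (<ᵇ⁻ b) eq) (≡ᵇ-refl i)) h

  Free : Adj → VSet → Pat → Set
  Free E V P = ∀ φ → Emb E V P φ → ⊥

  free-⊑ : ∀ {E U V P} → U ⊑ V → Free E V P → Free E U P
  free-⊑ s f φ e = f φ record { inV = λ h → s (Emb.inV e h) ; inj = Emb.inj e ; edges = Emb.edges e }

  nth∈ : ∀ {A : Set} {xs : List A} {i d} → i < length xs → nth xs i d ∈ xs
  nth∈ {xs = x ∷ xs} {zero}  h = here refl
  nth∈ {xs = x ∷ xs} {suc i} (s≤s h) = there (nth∈ h)

  unique-map : ∀ {xs : List ℕ} (φ : ℕ → Vx) → (∀ {i j} → i ∈ xs → j ∈ xs → φ i ≡ φ j → i ≡ j) → Unique xs → Unique (map φ xs)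
  unique-map {[]}     φ h u = []
  unique-map {x ∷ xs} φ h (x∉ ∷ u) = All.tabulate (λ m e → case (∈-map⁻ φ m) e) ∷ unique-map φ (λ a b → h (there a) (there b)) u
    where
    case : ∀ {y} → (∃ λ j → j ∈ xs × y ≡ φ j) → φ x ≡ y → ⊥
    case (j , m , refl) e = All.lookup x∉ m (h (here refl) (there m) e)

  nb-mem : ∀ {es i j} → j ∈ nb es i → (i , j) ∈ es ⊎ (j , i) ∈ es
  nb-mem {(a , b) ∷ es} {i} {j} m with a ≡ᵇ i in p | b ≡ᵇ i in q
  ... | true | _ rewrite ≡ᵇ⁻ {a} {i} p = case m
    where
    case : j ∈ b ∷ nb es i → _
    case (here refl) = inj₁ (here refl)
    case (there m) with nb-mem {es} m
    ... | inj₁ x = inj₁ (there x)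
    ... | inj₂ x = inj₂ (there x)
  ... | false | true rewrite ≡ᵇ⁻ {b} {i} q = case m
    where
    case : j ∈ a ∷ nb es i → _
    case (here refl) = inj₂ (here refl)
    case (there m) with nb-mem {es} m
    ... | inj₁ x = inj₁ (there x)
    ... | inj₂ x = inj₂ (there x)
  ... | false | false with nb-mem {es} m
  ... | inj₁ x = inj₁ (there x)
  ... | inj₂ x = inj₂ (there x)

  nb-len : ∀ e es i → length (nb es i) ≤ length (nb (e ∷ es) i)
  nb-len (a , b) es i with a ≡ᵇ i | b ≡ᵇ i
  ... | true  | _     = m≤n+m _ 1
  ... | false | true  = m≤n+m _ 1
  ... | false | false = ≤-refl

  nb-≢ : ∀ {a b i es j} → j ∈ nb es i → j ∈ nb ((a , b) ∷ es) i
  nb-≢ {a} {b} {i} m with a ≡ᵇ i | b ≡ᵇ i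
  ... | true  | _     = there m
  ... | false | true  = there m
  ... | false | false = m

  record Valid (E : Adj) (V : VSet) (c : Cfg) (φ : ℕ → Vx) : Set where
    open Cfg c
    field
      emb  : Emb E V (k , es) φ
      wf   : All (λ e → proj₁ e < k × proj₂ e < k) es
      fin<k : ∀ {i} → elem i fin ≡ true → i < k
      done : ∀ {i} → elem i fin ≡ true → deg E V (φ i) ≤ length (nb es i)
    open Emb emb public

    edges′ : ∀ {i j} → Symm E → j ∈ nb es i → E (φ i) (φ j) ≡ true
    edges′ sy m with nb-mem {es} m
    ... | inj₁ x = edge x
    ... | inj₂ x = trans (sy _ _) (edge x)

    nb<k : ∀ {i j} → j ∈ nb es i → j < k
    nb<k m with nb-mem {es} m
    ... | inj₁ x = proj₂ (All.lookup wf x)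
    ... | inj₂ x = proj₁ (All.lookup wf x)

  -- The facts about one graph that justify reading a case tree in mode `M`. A rule may also reach
  -- `Goal` outright instead of delivering the common neighbour.
  record Sem (M : Mode) (E : Adj) (V : VSet) (Goal : Set) : Set₁ where
    open Mode M
    field
      good   : Good E V
      c4free : noC4 ≡ true → ∀ {x a b y} → V x ≡ true → V a ≡ true → V b ≡ true → V y ≡ true →
               E x a ≡ true → E a b ≡ true → E b y ≡ true → E x y ≡ true → b ≢ x → a ≢ y → ⊥
      degs   : ∀ {x} → V x ≡ true → minDeg ≤ deg E V x
      killed : ∀ {P} → P ∈ kills → Free E V P
      ruled  : ∀ {R} → R ∈ rules → ∀ φ → Emb E V (Rule.pat R) φ →
               (∀ {a} → a ∈ Rule.low R → a < proj₁ (Rule.pat R) → deg E V (φ a) ≤ 2) →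
               Goal ⊎ ∃ λ w → V w ≡ true × E (φ (Rule.ri R)) w ≡ true × E (φ (Rule.rj R)) w ≡ true ×
                 (∀ {e} → e ∈ Rule.exclude R → e < proj₁ (Rule.pat R) → w ≢ φ e × E (φ e) w ≡ false)
      leafed : ∀ c φ I → Valid E V c φ → leafOK c I ≡ true → Goal
      isoed  : isoOK ≡ true → ∀ c φ b js → Valid E V c φ → isoᵇ c b js ≡ true → Goal

  module Local {E : Adj} {V : VSet} (g : Good E V) {c : Cfg} {φ : ℕ → Vx} (v : Valid E V c φ) where
    open Valid v
    open Cfg c
    open Good g using (symm; irr; cub; symm⁺)

    mapped-unique : ∀ {xs} → (∀ {i} → i ∈ xs → i < k) → Unique xs → Unique (map φ xs)
    mapped-unique lt u = unique-map φ (λ a b e → inj (lt a) (lt b) e) u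

    image-⊑ : ∀ {xs} → (∀ {i} → i ∈ xs → i < k) → ⟪ map φ xs ⟫ ⊑ V
    image-⊑ {xs} lt p with ∈-map⁻ φ (⟪⟫⁻ {map φ xs} p)
    ... | j , m , refl = inV (lt m)

    nb-image : ∀ {i} → ⟪ map φ (nb es i) ⟫ ⊑ (λ y → V y ∧ E (φ i) y)
    nb-image {i} p with ∈-map⁻ φ (⟪⟫⁻ {map φ (nb es i)} p)
    ... | j , m , refl = ∧-intro (inV (nb<k m)) (edges′ symm m)

    nb-deg : ∀ {i} → uniqᵇ (nb es i) ≡ true → length (nb es i) ≤ deg E V (φ i)
    nb-deg {i} u = ≤-trans (≤-reflexive (sym (length-map φ (nb es i))))
      (≤-trans (card-⟨⟩≤ (mapped-unique nb<k (uniq⁻ u)) nb-image) (≤-reflexive (sym (deg-card E V (φ i)))))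

    closed-uniq : ∀ {i} → isClosed c i ≡ true → uniqᵇ (nb es i) ≡ true
    closed-uniq {i} h = proj₂ (∧-true {elem i fin ∨ (3 ≤ᵇ length (nb es i))} h)

    closed-deg≤ : ∀ {i} → i < k → isClosed c i ≡ true → deg E V (φ i) ≤ length (nb es i)
    closed-deg≤ {i} i<k h with ∨-case {elem i fin} (proj₁ (∧-true {elem i fin ∨ (3 ≤ᵇ length (nb es i))} h))
    ... | inj₁ f = done f
    ... | inj₂ t = ≤-trans (cub (inV i<k)) (≤ᵇ⁻ t)

    -- The known neighbours are distinct and no fewer than the degree, so there is no further one.
    closed-sound : ∀ {i y} → i < k → isClosed c i ≡ true → V y ≡ true → E (φ i) y ≡ true → ∃ λ j → j ∈ nb es i × y ≡ φ j
    closed-sound {i} {y} i<k h Vy e = ∈-map⁻ φ (⟪⟫⁻ (full {P = λ z → V z ∧ E (φ i) z}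
      (mapped-unique nb<k (uniq⁻ (closed-uniq h))) nb-image
      (≤-trans (≤-reflexive (sym (deg-card E V (φ i)))) (≤-trans (closed-deg≤ i<k h) (≤-reflexive (sym (length-map φ (nb es i))))))
      (∧-intro Vy e)))

    closed-nb : ∀ {i j} → i < k → j < k → isClosed c i ≡ true → E (φ i) (φ j) ≡ true → elem j (nb es i) ≡ true
    closed-nb i<k j<k h e with closed-sound i<k h (inV j<k) e
    ... | l , m , eq with inj j<k (nb<k m) eq
    ... | refl = elem⁺ m

    nb-sym : ∀ {i j} → j ∈ nb es i → i ∈ nb es j
    nb-sym {i} {j} m with nb-mem {es} m
    ... | inj₁ x = go es x
      where
      go : ∀ es → (i , j) ∈ es → i ∈ nb es j
      go ((a , b) ∷ es) (here refl) with i ≡ᵇ j in p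
      ... | true rewrite ≡ᵇ⁻ {i} {j} p = here refl
      ... | false rewrite ≡ᵇ-refl j = here refl
      go ((a , b) ∷ es) (there x) = nb-≢ {a} {b} {j} {es} (go es x)
    ... | inj₂ x = go es x
      where
      go : ∀ es → (j , i) ∈ es → i ∈ nb es j
      go ((a , b) ∷ es) (here refl) rewrite ≡ᵇ-refl j = here refl
      go ((a , b) ∷ es) (there x) = nb-≢ {a} {b} {j} {es} (go es x)

    may-sound : ∀ {c4 i j} →
      (c4 ≡ true → ∀ {x a b y} → V x ≡ true → V a ≡ true → V b ≡ true → V y ≡ true →
        E x a ≡ true → E a b ≡ true → E b y ≡ true → E x y ≡ true → b ≢ x → a ≢ y → ⊥) →
      i < k → j < k → E (φ i) (φ j) ≡ true → mayAdj c4 c i j ≡ true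
    may-sound {c4} {i} {j} hyp i<k j<k e = ∨-or (bool? (elem j (nb es i)))
      where
      ∨-or : (elem j (nb es i) ≡ true) ⊎ (elem j (nb es i) ≡ false) → mayAdj c4 c i j ≡ true
      ∨-or (inj₁ t) = ∨-left t
      ∨-or (inj₂ f) = ∨-right {elem j (nb es i)} (∧-intro (not-false (≡ᵇ-≢ {i} {j} λ { refl → t≢f e (irr (φ i)) }))
        (∧-intro (not-false (¬true λ h → t≢f (closed-nb i<k j<k h e) f))
        (∧-intro (not-false (¬true λ h → t≢f (elem⁺ (nb-sym (elem⁻ (closed-nb j<k i<k h (symm⁺ e))))) f))
        (∧-intro (not-false (¬true no-tri)) (not-false (¬true no-c4))))))
        where
        no-tri : commonᵇ es i j ≡ true → ⊥
        no-tri h with anyᵇ⁻ {xs = nb es i} h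
        ... | a , m , p = Good.tri g (inV i<k) (inV (nb<k m)) (inV j<k) (edges′ symm m)
                            (edges′ symm (nb-sym (elem⁻ p))) e
        no-c4 : (c4 ∧ path3ᵇ es i j) ≡ true → ⊥
        no-c4 h with anyᵇ⁻ {xs = nb es i} (proj₂ (∧-true {c4} h))
        ... | a , m , p with anyᵇ⁻ {xs = nb es j} p
        ... | b , m′ , q = hyp (proj₁ (∧-true {c4} h)) (inV i<k) (inV (nb<k m)) (inV (nb<k m′)) (inV j<k)
                (edges′ symm m) (edges′ symm (elem⁻ (proj₂ (∧-true {not (a ≡ᵇ j)} q2)))) (edges′ symm (nb-sym m′)) e
                (λ eq → t≢f (subst (λ z → (z ≡ᵇ i) ≡ true) (sym (inj (nb<k m′) i<k eq)) (≡ᵇ-refl i)) (not-true (proj₁ (∧-true {not (b ≡ᵇ i)} q))))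
                (λ eq → t≢f (subst (λ z → (z ≡ᵇ j) ≡ true) (sym (inj (nb<k m) j<k eq)) (≡ᵇ-refl j)) (not-true (proj₁ (∧-true {not (a ≡ᵇ j)} q2))))
          where q2 = proj₂ (∧-true {not (b ≡ᵇ i)} q)

    find : ∀ w → (∃ λ j → j < k × w ≡ φ j) ⊎ (∀ {j} → j < k → w ≢ φ j)
    find w = go k
      where
      go : ∀ m → (∃ λ j → j < m × w ≡ φ j) ⊎ (∀ {j} → j < m → w ≢ φ j)
      go zero = inj₂ λ ()
      go (suc m) with go m | w ≟ φ m
      ... | inj₁ (j , p , e) | _ = inj₁ (j , m<n⇒m<1+n p , e)
      ... | inj₂ h | yes e = inj₁ (m , n<1+n m , e)
      ... | inj₂ h | no ne = inj₂ λ {j} p → case j (m≤n⇒m<n∨m≡n (≤-pred p))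
        where
        case : ∀ j → j < m ⊎ j ≡ m → w ≢ φ j
        case j (inj₁ l) = h l
        case j (inj₂ refl) = ne

    extend : ℕ → Vx → (ℕ → Vx)
    extend m w i = if i ≡ᵇ m then w else φ i

    extend-old : ∀ {w i} → i < k → extend k w i ≡ φ i
    extend-old {w} {i} h rewrite ≡ᵇ-≢ {i} {k} (<⇒≢ h) = refl

    extend-new : ∀ {w} → extend k w k ≡ w
    extend-new rewrite ≡ᵇ-refl k = refl

    valid-old : ∀ {i j} → i < k → j < k → E (φ i) (φ j) ≡ true → Valid E V (cfg k fin ((i , j) ∷ es)) φ
    valid-old {i} {j} i<k j<k e = record
      { emb = record { inV = inV ; inj = inj ; edges = e ∷ edges }
      ; wf = (i<k , j<k) ∷ wf
      ; fin<k = fin<k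
      ; done = λ {l} f → ≤-trans (done f) (nb-len (i , j) es l) }

    valid-fin : ∀ {i} → i < k → deg E V (φ i) ≤ length (nb es i) → Valid E V (cfg k (i ∷ fin) es) φ
    valid-fin {i} i<k h = record { emb = emb ; wf = wf ; fin<k = λ {l} f → lt l (∨-case {l ≡ᵇ i} f) ; done = λ {l} f → case l (∨-case {l ≡ᵇ i} f) }
      where
      lt : ∀ l → (l ≡ᵇ i) ≡ true ⊎ elem l fin ≡ true → l < k
      lt l (inj₁ e) rewrite ≡ᵇ⁻ {l} {i} e = i<k
      lt l (inj₂ e) = fin<k e
      case : ∀ l → (l ≡ᵇ i) ≡ true ⊎ elem l fin ≡ true → deg E V (φ l) ≤ length (nb es l)
      case l (inj₁ e) rewrite ≡ᵇ⁻ {l} {i} e = h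
      case l (inj₂ e) = done e

    valid-new : ∀ {w} → V w ≡ true → (∀ {j} → j < k → w ≢ φ j) →
                Valid E V (cfg (suc k) fin es) (extend k w)
    valid-new {w} Vw fr = record
      { emb = record { inV = λ h → iv (m≤n⇒m<n∨m≡n (≤-pred h))
                     ; inj = λ h l → ij (m≤n⇒m<n∨m≡n (≤-pred h)) (m≤n⇒m<n∨m≡n (≤-pred l))
                     ; edges = All.tabulate λ {e} m → subst₂ (λ x y → E x y ≡ true)
                         (sym (extend-old (proj₁ (All.lookup wf m)))) (sym (extend-old (proj₂ (All.lookup wf m)))) (All.lookup edges m) }
      ; wf = All.map (λ { (a , b) → m<n⇒m<1+n a , m<n⇒m<1+n b }) wf
      ; fin<k = λ f → m<n⇒m<1+n (fin<k f)
      ; done = λ {i} f → subst (λ z → deg E V z ≤ length (nb es i)) (sym (extend-old (fin<k f))) (done f) }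
      where
      iv : ∀ {i} → i < k ⊎ i ≡ k → V (extend k w i) ≡ true
      iv (inj₁ h) = trans (cong V (extend-old h)) (inV h)
      iv (inj₂ refl) = trans (cong V extend-new) Vw
      ij : ∀ {i j} → i < k ⊎ i ≡ k → j < k ⊎ j ≡ k → extend k w i ≡ extend k w j → i ≡ j
      ij (inj₁ h) (inj₁ l) e = inj h l (trans (sym (extend-old h)) (trans e (extend-old l)))
      ij (inj₁ h) (inj₂ refl) e = ⊥-elim (fr h (trans (sym extend-new) (trans (sym e) (extend-old h))))
      ij (inj₂ refl) (inj₁ l) e = ⊥-elim (fr l (trans (sym extend-new) (trans e (extend-old l))))
      ij (inj₂ refl) (inj₂ refl) e = refl

    embᵇ-sound : ∀ {P js} → embᵇ c P js ≡ true → Emb E V P (λ a → φ (js ‼ a))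
    embᵇ-sound {pn , pes} {js} h = record
      { inV = λ i<n → inV (js<k i<n)
      ; inj = λ i<n j<n e → ‼-inj {js} (uniq⁻ u) (≤-trans i<n len) (≤-trans j<n len) (inj (js<k i<n) (js<k j<n) e)
      ; edges = All.tabulate λ {e} m → edges′ symm (elem⁻ {js ‼ proj₂ e} {nb es (js ‼ proj₁ e)} (allᵇ⁻ {f = λ e → elem (js ‼ proj₂ e) (nb es (js ‼ proj₁ e))} {xs = pes} e∈ m)) }
      where
      len : pn ≤ length js
      len = ≤ᵇ⁻ (proj₁ (∧-true {pn ≤ᵇ length js} h))
      h2 = proj₂ (∧-true {pn ≤ᵇ length js} h)
      u : uniqᵇ js ≡ true
      u = proj₁ (∧-true {uniqᵇ js} h2)
      h3 = proj₂ (∧-true {uniqᵇ js} h2)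
      lt : allᵇ (λ j → j <ᵇ k) js ≡ true
      lt = proj₁ (∧-true {allᵇ (λ j → j <ᵇ k) js} h3)
      e∈ : allᵇ (λ e → elem (js ‼ proj₂ e) (nb es (js ‼ proj₁ e))) pes ≡ true
      e∈ = proj₂ (∧-true {allᵇ (λ j → j <ᵇ k) js} h3)
      js<k : ∀ {i} → i < pn → js ‼ i < k
      js<k i<n = <ᵇ⁻ (allᵇ⁻ {f = λ j → j <ᵇ k} {xs = js} lt (‼∈ {js} (≤-trans i<n len)))

    embᵇ-lt : ∀ {P js a} → embᵇ c P js ≡ true → a < proj₁ P → js ‼ a < k
    embᵇ-lt {pn , pes} {js} h i<n = <ᵇ⁻ (allᵇ⁻ {f = λ j → j <ᵇ k} {xs = js} (proj₁ (∧-true {allᵇ (λ j → j <ᵇ k) js} (proj₂ (∧-true {uniqᵇ js} (proj₂ (∧-true {pn ≤ᵇ length js} h))))))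
      (‼∈ {js} (≤-trans i<n (≤ᵇ⁻ (proj₁ (∧-true {pn ≤ᵇ length js} h))))))

  filterᵇ⁺ : ∀ {A : Set} {f : A → Bool} {xs x} → x ∈ xs → f x ≡ true → x ∈ filterᵇ f xs
  filterᵇ⁺ {f = f} {y ∷ ys} (here refl) h rewrite h = here refl
  filterᵇ⁺ {f = f} {y ∷ ys} (there m) h with f y
  ... | true  = there (filterᵇ⁺ m h)
  ... | false = filterᵇ⁺ m h

  module Soundness {M : Mode} {E : Adj} {V : VSet} {Goal : Set} (S : Sem M E V Goal) where
    open Sem S
    open Mode M
    open Good good using (symm; irr; symm⁺)

    mutual
      sound : ∀ t {c φ} → Valid E V c φ → check M c t ≡ true → Goal
      sound (leaf I) {c} {φ} v h = leafed c φ I v h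
      sound (kill r js) {c} v h = ⊥-elim (killed (nth∈ {xs = kills} (<ᵇ⁻ (proj₂ (∧-true {embᵇ c (nth kills r noPat) js} h)))) _
        (Local.embᵇ-sound good v {nth kills r noPat} {js} (proj₁ (∧-true {embᵇ c (nth kills r noPat) js} h))))
      sound (iso b js) {c} {φ} v h = isoed (proj₁ (∧-true {isoOK} h)) c φ b js v (proj₂ (∧-true {isoOK} h))
      sound (grow i ts) {c} v h = sound-grow i ts v (<ᵇ⁻ (proj₁ (∧-true {i <ᵇ Cfg.k c} h))) (proj₁ (∧-true {uniqᵇ (nb (Cfg.es c) i)} h2))
                                    (proj₂ (∧-true {uniqᵇ (nb (Cfg.es c) i)} h2))
        where h2 = proj₂ (∧-true {i <ᵇ Cfg.k c} h)
      sound (rule r js ts) {c} v h = sound-rule (nth rules r noRule) (nth∈ {xs = rules} (<ᵇ⁻ (proj₂ (∧-true {ruleᵇ M c (nth rules r noRule) js ts} h)))) js ts v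
                                       (proj₁ (∧-true {ruleᵇ M c (nth rules r noRule) js ts} h))

      soundAll : ∀ ts {cs c φ} → c ∈ cs → checkAll M cs ts ≡ true → Valid E V c φ → Goal
      soundAll []       {_ ∷ _} m ()
      soundAll (t ∷ ts) {c ∷ cs} (here refl) h v = sound t v (proj₁ (∧-true {check M c t} h))
      soundAll (t ∷ ts) {c ∷ cs} (there m)   h v = soundAll ts m (proj₂ (∧-true {check M c t} h)) v

      sound-grow : ∀ i ts {c φ} → Valid E V c φ → i < Cfg.k c → uniqᵇ (nb (Cfg.es c) i) ≡ true →
                   checkAll M (growOpts M c i) ts ≡ true → Goal
      sound-grow i ts {c@(cfg k fin es)} {φ} v i<k u h with deg E V (φ i) ≤? length (nb es i)
      ... | yes d = soundAll ts (∈-++⁺ˡ fin∈) h (Local.valid-fin good v i<k d)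
        where
        fin∈ : cfg k (i ∷ fin) es ∈ finOpt M c i
        -- All neighbours are known here, so their number is at least `minDeg` and this option is
        -- indeed listed.
        fin∈ rewrite T⇒ (≤⇒≤ᵇ (≤-trans (degs (Valid.inV v i<k)) d)) = here refl
      ... | no nd with fresh {P = λ z → V z ∧ E (φ i) z} (Local.mapped-unique good v (Valid.nb<k v) (uniq⁻ u)) (Local.nb-image good v)
                         (≤-trans (s≤s (≤-reflexive (length-map φ (nb es i)))) (≤-trans (≰⇒> nd) (≤-reflexive (deg-card E V (φ i)))))
      ... | w , Pw , w∉ with Local.find good v w
      ... | inj₁ (j , j<k , refl) = soundAll ts (∈-++⁺ʳ (finOpt M c i) (∈-++⁺ˡ
              (∈-map⁺ (λ j → cfg k fin ((i , j) ∷ es)) (filterᵇ⁺ (∈-upTo⁺ j<k)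
                (∧-intro (Local.may-sound good v c4free i<k j<k eij) (not-false (elem-∉ λ m → w∉ (∈-map⁺ φ m)))))))) h
              (Local.valid-old good v i<k j<k eij)
        where
        eij : E (φ i) (φ j) ≡ true
        eij = proj₂ (∧-true {V (φ j)} Pw)
      ... | inj₂ fr = soundAll ts (∈-++⁺ʳ (finOpt M c i) (∈-++⁺ʳ (oldOpt M c i) (here refl))) h
              (Local.valid-old good (Local.valid-new good v (proj₁ (∧-true {V w} Pw)) fr) (m<n⇒m<1+n i<k) (n<1+n k)
                (subst₂ (λ x y → E x y ≡ true) (sym (Local.extend-old good v i<k)) (sym (Local.extend-new good v)) (proj₂ (∧-true {V w} Pw))))

      sound-rule : ∀ R → R ∈ rules → ∀ js ts {c φ} → Valid E V c φ → ruleᵇ M c R js ts ≡ true → Goal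
      sound-rule R@(mkRule pat low ri rj ex) R∈ js ts {c@(cfg k fin es)} {φ} v h
        with ruled R∈ (λ a → φ (js ‼ a)) (Local.embᵇ-sound good v {pat} {js} emb✓) lowdeg
        where
        emb✓ = proj₁ (∧-true {embᵇ c pat js} h)
        low✓ = proj₁ (∧-true {allᵇ (λ a → lowᵇ c (js ‼ a)) low} (proj₂ (∧-true {embᵇ c pat js} h)))
        lowdeg : ∀ {a} → a ∈ low → a < proj₁ pat → deg E V (φ (js ‼ a)) ≤ 2
        lowdeg {a} m lt = ≤-trans (Local.closed-deg≤ good v (Local.embᵇ-lt good v {pat} {js} {a} emb✓ lt) (proj₁ (∧-true {isClosed c (js ‼ a)} q)))
                                  (≤ᵇ⁻ (proj₂ (∧-true {isClosed c (js ‼ a)} q)))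
          where
          q : lowᵇ c (js ‼ a) ≡ true
          q = allᵇ⁻ {f = λ a → lowᵇ c (js ‼ a)} {xs = low} low✓ m
      ... | inj₁ done = done
      ... | inj₂ (w , Vw , pw , qw , exw) = pick (Local.find good v w)
        where
        p q : ℕ
        p = js ‼ ri
        q = js ‼ rj
        emb✓ = proj₁ (∧-true {embᵇ c pat js} h)
        h2 = proj₂ (∧-true {allᵇ (λ a → lowᵇ c (js ‼ a)) low} (proj₂ (∧-true {embᵇ c pat js} h)))
        lts = proj₁ (∧-true {allᵇ (λ a → a <ᵇ proj₁ pat) (ri ∷ rj ∷ low) ∧ allᵇ (λ a → a <ᵇ proj₁ pat) ex} h2)
        all✓ = proj₂ (∧-true {allᵇ (λ a → a <ᵇ proj₁ pat) (ri ∷ rj ∷ low) ∧ allᵇ (λ a → a <ᵇ proj₁ pat) ex} h2)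
        lt1 = proj₁ (∧-true {allᵇ (λ a → a <ᵇ proj₁ pat) (ri ∷ rj ∷ low)} lts)
        exlt : ∀ {e} → e ∈ ex → e < proj₁ pat
        exlt m = <ᵇ⁻ (allᵇ⁻ {f = λ a → a <ᵇ proj₁ pat} {xs = ex} (proj₂ (∧-true {allᵇ (λ a → a <ᵇ proj₁ pat) (ri ∷ rj ∷ low)} lts)) m)
        p<k : p < k
        p<k = Local.embᵇ-lt good v {pat} {js} {ri} emb✓ (<ᵇ⁻ (allᵇ⁻ {f = λ a → a <ᵇ proj₁ pat} {xs = ri ∷ rj ∷ low} lt1 (here refl)))
        q<k : q < k
        q<k = Local.embᵇ-lt good v {pat} {js} {rj} emb✓ (<ᵇ⁻ (allᵇ⁻ {f = λ a → a <ᵇ proj₁ pat} {xs = ri ∷ rj ∷ low} lt1 (there (here refl))))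
        valid-addIf : ∀ {es′ a b} → Valid E V (cfg k fin es′) φ → a < k → b < k → E (φ a) (φ b) ≡ true →
                      Valid E V (cfg k fin (addIf a b es′)) φ
        valid-addIf {es′} {a} {b} v′ la lb e with elem a (nb es′ b)
        ... | true  = v′
        ... | false = Local.valid-old good v′ la lb e
        pick : (∃ λ j → j < k × w ≡ φ j) ⊎ (∀ {j} → j < k → w ≢ φ j) → Goal
        pick (inj₁ (j , j<k , refl)) = soundAll ts (∈-++⁺ˡ (∈-map⁺ (λ j → cfg k fin (addIf j p (addIf j q es)))
            (filterᵇ⁺ {f = okOld M c p q (map (js ‼_) ex)} (∈-upTo⁺ j<k)
              (∧-intro (Local.may-sound good v c4free p<k j<k pw) (∧-intro (Local.may-sound good v c4free q<k j<k qw) (allᵇ⁺ exok))))))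
            all✓ (valid-addIf (valid-addIf v j<k q<k (symm⁺ qw)) j<k p<k (symm⁺ pw))
          where
          exok : ∀ {e} → e ∈ map (js ‼_) ex → (not (j ≡ᵇ e) ∧ not (elem j (nb es e))) ≡ true
          exok m with ∈-map⁻ (js ‼_) m
          ... | a , a∈ , refl = ∧-intro (not-false (≡ᵇ-≢ {j} {js ‼ a} λ e → proj₁ (exw a∈ (exlt a∈)) (cong φ e)))
                                        (not-false (elem-∉ λ m → t≢f (Valid.edges′ v symm m) (proj₂ (exw a∈ (exlt a∈)))))
        pick (inj₂ fr) = soundAll ts (∈-++⁺ʳ (map (λ j → cfg k fin (addIf j p (addIf j q es))) (filterᵇ (okOld M c p q (map (js ‼_) ex)) (upTo k))) new∈) all✓
            (Local.valid-old good (Local.valid-old good vn (m<n⇒m<1+n q<k) (n<1+n k) (ext q<k qw)) (m<n⇒m<1+n p<k) (n<1+n k) (ext p<k pw))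
          where
          vn = Local.valid-new good v Vw fr
          ext : ∀ {i} → i < k → E (φ i) w ≡ true → E (Local.extend good v k w i) (Local.extend good v k w k) ≡ true
          ext i<k e = subst₂ (λ x y → E x y ≡ true) (sym (Local.extend-old good v i<k)) (sym (Local.extend-new good v)) e
          open-at : ∀ {i} → i < k → E (φ i) w ≡ true → isClosed c i ≡ false
          open-at i<k e = ¬true λ cl → case (Local.closed-sound good v i<k cl Vw e)
            where
            case : ∀ {i} → (∃ λ j → j ∈ nb es i × w ≡ φ j) → ⊥
            case (j , m , eq) = fr (Valid.nb<k v m) eq
          new∈ : cfg (suc k) fin ((p , k) ∷ (q , k) ∷ es) ∈ (if isClosed c p ∨ isClosed c q then [] else cfg (suc k) fin ((p , k) ∷ (q , k) ∷ es) ∷ [])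
          new∈ rewrite open-at p<k pw | open-at q<k qw = here refl

  -- Deleting a closed neighbourhood read off from a configuration

  dedup⁺ : ∀ {xs x} → x ∈ xs → x ∈ dedup xs
  dedup⁺ {y ∷ ys} {x} m with elem y ys in e
  dedup⁺ {y ∷ ys} (here refl) | true  = dedup⁺ {ys} (elem⁻ {y} {ys} e)
  dedup⁺ {y ∷ ys} (there m)   | true  = dedup⁺ {ys} m
  dedup⁺ {y ∷ ys} (here refl) | false = here refl
  dedup⁺ {y ∷ ys} (there m)   | false = there (dedup⁺ {ys} m)

  record Removal (E : Adj) (V : VSet) (c : Cfg) (φ : ℕ → Vx) (I : List ℕ) : Set where
    X : List ℕ
    X = removed c I
    field
      X-unique : Unique (map φ X)
      I-unique : Unique (map φ I)
      X<k      : ∀ {i} → i ∈ X → i < Cfg.k c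
      X-nonempty : Nonempty ⟪ map φ X ⟫
      isCut    : Cut E V ⟪ map φ X ⟫ ⟪ map φ I ⟫

    card-X : card ⟪ map φ X ⟫ ≡ length X
    card-X = trans (card-list X-unique) (length-map φ X)

    card-I : card ⟪ map φ I ⟫ ≡ length I
    card-I = trans (card-list I-unique) (length-map φ I)

  sumL-map-∘ : ∀ {A B : Set} (f : B → ℕ) (g : A → B) xs → sumL (map f (map g xs)) ≡ sumL (map (f ∘ g) xs)
  sumL-map-∘ f g []       = refl
  sumL-map-∘ f g (x ∷ xs) = cong (f (g x) +_) (sumL-map-∘ f g xs)

  sumL-mono : ∀ {A : Set} {f g : A → ℕ} xs → (∀ {x} → x ∈ xs → f x ≤ g x) → sumL (map f xs) ≤ sumL (map g xs)
  sumL-mono []       h = z≤n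
  sumL-mono (x ∷ xs) h = +-mono-≤ (h (here refl)) (sumL-mono xs (h ∘ there))

  count-upper : ∀ {A : Set} (f p : A → Bool) ys → (∀ {y} → y ∈ ys → f y ≡ true → p y ≡ true) →
                sumL (map (ind ∘ f) ys) ≤ length (filterᵇ p ys)
  count-upper f p []       h = z≤n
  count-upper f p (y ∷ ys) h with f y in fy | p y in py
  ... | true  | true  = s≤s (count-upper f p ys (h ∘ there))
  ... | true  | false = ⊥-elim (t≢f (h (here refl) fy) py)
  ... | false | true  = ≤-trans (count-upper f p ys (h ∘ there)) (m≤n+m _ 1)
  ... | false | false = count-upper f p ys (h ∘ there)

  count-lower : ∀ {A : Set} (f p : A → Bool) ys → (∀ {y} → y ∈ ys → p y ≡ true → f y ≡ true) →
                length (filterᵇ p ys) ≤ sumL (map (ind ∘ f) ys)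
  count-lower f p []       h = z≤n
  count-lower f p (y ∷ ys) h with f y in fy | p y in py
  ... | true  | true  = s≤s (count-lower f p ys (h ∘ there))
  ... | true  | false = ≤-trans (count-lower f p ys (h ∘ there)) (m≤n+m _ 1)
  ... | false | true  = ⊥-elim (t≢f (h (here refl) py) fy)
  ... | false | false = count-lower f p ys (h ∘ there)

  concatMap⁺ : ∀ {f : ℕ → List ℕ} {I i j} → i ∈ I → j ∈ f i → j ∈ concatMap f I
  concatMap⁺ {f} {i ∷ I} (here refl) m = ∈-++⁺ˡ m
  concatMap⁺ {f} {x ∷ I} (there n)   m = ∈-++⁺ʳ (f x) (concatMap⁺ {f} n m)

  module Leaf {E : Adj} {V : VSet} (g : Good E V) {c : Cfg} {φ : ℕ → Vx} (v : Valid E V c φ) where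
    open Valid v
    open Cfg c
    open Good g using (symm; irr; symm⁺; cub)
    open Local g v

    module _ {I : List ℕ} (h : structᵇ c I ≡ true) where
      private
        X = removed c I
        h1 = proj₂ (∧-true {1 ≤ᵇ length I} h)
        h2 = proj₂ (∧-true {allᵇ (λ i → isClosed c i ∧ allᵇ (λ j → elem j X ∧ not (elem j I)) (nb es i)) I} h1)
        h3 = proj₂ (∧-true {uniqᵇ I} h2)
        h4 = proj₂ (∧-true {uniqᵇ X} h3)
        h5 = proj₂ (∧-true {allᵇ (λ x → elem x X) I} h4)
        uX : Unique X
        uX = uniq⁻ (proj₁ (∧-true {uniqᵇ X} h3))
        I⊆X : ∀ {i} → i ∈ I → i ∈ X
        I⊆X m = elem⁻ (allᵇ⁻ {f = λ x → elem x X} {xs = I} (proj₁ (∧-true {allᵇ (λ x → elem x X) I} h4)) m)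
        lt : ∀ {x} → x ∈ X → x < k
        lt m = <ᵇ⁻ (allᵇ⁻ {f = λ x → x <ᵇ k} {xs = X} (proj₁ (∧-true {allᵇ (λ x → x <ᵇ k) X} h5)) m)
        at : ∀ {i} → i ∈ I → (isClosed c i ∧ allᵇ (λ j → elem j X ∧ not (elem j I)) (nb es i)) ≡ true
        at m = allᵇ⁻ {f = λ i → isClosed c i ∧ allᵇ (λ j → elem j X ∧ not (elem j I)) (nb es i)} {xs = I}
                 (proj₁ (∧-true {allᵇ (λ i → isClosed c i ∧ allᵇ (λ j → elem j X ∧ not (elem j I)) (nb es i)) I} h1)) m
        nb-ok : ∀ {i j} → i ∈ I → j ∈ nb es i → (elem j X ∧ not (elem j I)) ≡ true
        nb-ok {i} m n = allᵇ⁻ {f = λ j → elem j X ∧ not (elem j I)} {xs = nb es i} (proj₂ (∧-true {isClosed c i} (at m))) n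
        nbr : ∀ {i y} → i ∈ I → V y ≡ true → E (φ i) y ≡ true → ∃ λ j → j ∈ nb es i × y ≡ φ j
        nbr {i} m Vy e = closed-sound (lt (I⊆X m)) (proj₁ (∧-true {isClosed c i} (at m))) Vy e

      uniq-nb : ∀ {x} → x ∈ X → uniqᵇ (nb es x) ≡ true
      uniq-nb m = allᵇ⁻ {f = λ x → uniqᵇ (nb es x)} {xs = X} (proj₂ (∧-true {allᵇ (λ x → x <ᵇ k) X} h5)) m

      removal : Removal E V c φ I
      removal = record
        { X-unique = mapped-unique lt uX
        ; I-unique = mapped-unique (lt ∘ I⊆X) (uniq⁻ (proj₁ (∧-true {uniqᵇ I} h2)))
        ; X<k = lt
        ; X-nonempty = nonempty I (≤ᵇ⁻ (proj₁ (∧-true {1 ≤ᵇ length I} h))) I⊆X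
        ; isCut = cut (image-⊑ lt) (λ p → inX (∈-map⁻ φ (⟪⟫⁻ {map φ I} p))) indep nbI }
        where
        nonempty : ∀ J → 1 ≤ length J → (∀ {i} → i ∈ J → i ∈ X) → Nonempty ⟪ map φ X ⟫
        nonempty (i ∷ J) _ s = φ i , ⟪⟫⁺ (∈-map⁺ φ (s (here refl)))
        inX : ∀ {x} → (∃ λ i → i ∈ I × x ≡ φ i) → ⟪ map φ X ⟫ x ≡ true
        inX (i , m , refl) = ⟪⟫⁺ (∈-map⁺ φ (I⊆X m))
        nbI : ∀ {i y} → ⟪ map φ I ⟫ i ≡ true → V y ≡ true → E i y ≡ true → ⟪ map φ X ⟫ y ≡ true
        nbI {i} p Vy e with ∈-map⁻ φ (⟪⟫⁻ {map φ I} p)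
        ... | a , m , refl with nbr m Vy e
        ... | j , n , refl = ⟪⟫⁺ (∈-map⁺ φ (elem⁻ {j} {X} (proj₁ (∧-true {elem j X} (nb-ok m n)))))
        indep : Indep E ⟪ map φ I ⟫
        indep {x} {y} p q with ∈-map⁻ φ (⟪⟫⁻ {map φ I} p) | ∈-map⁻ φ (⟪⟫⁻ {map φ I} q)
        ... | a , m , refl | b , m′ , refl = ¬true λ e → case (nbr m (inV (lt (I⊆X m′))) e)
          where
          case : (∃ λ j → j ∈ nb es a × φ b ≡ φ j) → ⊥
          case (j , n , eq) with inj (lt (I⊆X m′)) (nb<k n) eq
          ... | refl = t≢f (elem⁺ m′) (not-true (proj₂ (∧-true {elem b X} (nb-ok m n))))

    eb-XX : ∀ {X} → Unique (map φ X) → eb E ⟪ map φ X ⟫ ⟪ map φ X ⟫ ≡ sumL (map (λ i → sumL (map (λ j → ind (E (φ i) (φ j))) X)) X)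
    eb-XX {X} u = trans (eb-list {E} ⟪ map φ X ⟫ u) (trans (sumL-map-∘ (deg E ⟪ map φ X ⟫) φ X) (cong sumL (map-cong X)))
      where
      map-cong : ∀ Y → map (deg E ⟪ map φ X ⟫ ∘ φ) Y ≡ map (λ i → sumL (map (λ j → ind (E (φ i) (φ j))) X)) Y
      map-cong []      = refl
      map-cong (y ∷ Y) = cong₂ _∷_ (trans (deg-list {E} (φ y) u) (sumL-map-∘ (λ z → ind (E (φ y) z)) φ X)) (map-cong Y)

    deg-XX≤ : ∀ {X i} → Unique (map φ X) → (∀ {j} → j ∈ X → j < k) → i < k → sumL (map (λ j → ind (E (φ i) (φ j))) X) ≤ deg E V (φ i)
    deg-XX≤ {X} {i} u lt i<k = ≤-trans (≤-reflexive (sym (trans (deg-list {E} (φ i) u) (sumL-map-∘ (λ z → ind (E (φ i) z)) φ X))))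
      (deg-mono (φ i) (image-⊑ lt))

    known-bound : ∀ {X} → Unique (map φ X) → knownSum c X ≤ eb E ⟪ map φ X ⟫ ⟪ map φ X ⟫
    known-bound {X} u = ≤-trans (sumL-mono X λ {i} _ → count-lower (λ j → E (φ i) (φ j)) (λ j → elem j (nb es i)) X
      (λ {j} _ p → edges′ symm (elem⁻ p))) (≤-reflexive (sym (eb-XX {X} u)))

    -- The least possible degree is the worst case: e ≤ min (d , cnt) ≤ min (dl , cnt) + (d - dl),
    -- and a second d - dl is spare.
    min-arith : ∀ {dl cnt d e} → dl ≤ d → e ≤ d → e ≤ cnt → e + 2 * dl ≤ (dl ⊓ cnt) + 2 * d
    min-arith {dl} {cnt} {d} {e} a b f with dl ≤? cnt
    ... | yes l rewrite m≤n⇒m⊓n≡m l = lin 0 (+-mono-≤ a b) (lem dl d e)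
      where
      lem : ∀ x d e → e + 2 * x + (d + d) + 0 ≡ x + 2 * d + (x + e)
      lem = solve-∀
    ... | no l rewrite m≥n⇒m⊓n≡n (≰⇒≥ l) = lin 0 (+-mono-≤ f (+-mono-≤ a a)) (lem dl d e cnt)
      where
      lem : ∀ x d e n → e + 2 * x + (n + (d + d)) + 0 ≡ n + 2 * d + (e + (x + x))
      lem = solve-∀

    sum-arith : ∀ {A : Set} (e dl hi d : A → ℕ) xs → (∀ {x} → x ∈ xs → e x + 2 * dl x ≤ hi x + 2 * d x) →
                sumL (map e xs) + 2 * sumL (map dl xs) ≤ sumL (map hi xs) + 2 * sumL (map d xs)
    sum-arith e dl hi d []       h = z≤n
    sum-arith e dl hi d (x ∷ xs) h = lin 0 (+-mono-≤ (h (here refl)) (sum-arith e dl hi d xs (h ∘ there)))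
      (lem (e x) (dl x) (hi x) (d x) (sumL (map e xs)) (sumL (map dl xs)) (sumL (map hi xs)) (sumL (map d xs)))
      where
      lem : ∀ e l h d E L H D → e + E + 2 * (l + L) + (h + 2 * d + (H + 2 * D)) + 0 ≡ h + H + 2 * (d + D) + (e + 2 * l + (E + 2 * L))
      lem = solve-∀

    gain-bound : ∀ {I c4 m} (h : structᵇ c I ≡ true) →
      (c4 ≡ true → ∀ {x a b y} → V x ≡ true → V a ≡ true → V b ≡ true → V y ≡ true →
        E x a ≡ true → E a b ≡ true → E b y ≡ true → E x y ≡ true → b ≢ x → a ≢ y → ⊥) →
      (∀ {x} → V x ≡ true → m ≤ deg E V x) →
      let Xs = ⟪ map φ (removed c I) ⟫ in
      eb E Xs Xs + 2 * loSum c4 m c (removed c I) ≤ hiSum c4 m c (removed c I) + 2 * eb E Xs V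
    gain-bound {I} {c4} {m} h c4free mdeg = subst₂ _≤_ (cong (_+ 2 * loSum c4 m c X) (sym (eb-XX {X} u)))
        (cong (λ z → hiSum c4 m c X + 2 * z) (sym (trans (eb-list {E} V u) (sumL-map-∘ (deg E V) φ X))))
        (sum-arith (λ i → sumL (map (λ j → ind (E (φ i) (φ j))) X)) (lowDeg m c) (λ x → lowDeg m c x ⊓ within c4 c X x) (deg E V ∘ φ) X pt)
      where
      X = removed c I
      u = Removal.X-unique (removal {I} h)
      lt : ∀ {x} → x ∈ X → x < k
      lt = Removal.X<k (removal {I} h)
      pt : ∀ {i} → i ∈ X → sumL (map (λ j → ind (E (φ i) (φ j))) X) + 2 * lowDeg m c i ≤ (lowDeg m c i ⊓ within c4 c X i) + 2 * deg E V (φ i)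
      pt {i} i∈ = min-arith (⊔-lub (nb-deg (uniq-nb {I} h i∈)) ml) (deg-XX≤ u lt (lt i∈))
        (count-upper (λ j → E (φ i) (φ j)) (mayAdj c4 c i) X λ {j} j∈ e → may-sound c4free (lt i∈) (lt j∈) e)
        where
        ml : (if isClosed c i then 0 else m) ≤ deg E V (φ i)
        ml with isClosed c i
        ... | true  = z≤n
        ... | false = mdeg (inV (lt i∈))

    gain-cut : ∀ {I c4 m a b} → gainᵇ c4 m a b c I ≡ true →
      (c4 ≡ true → ∀ {x a b y} → V x ≡ true → V a ≡ true → V b ≡ true → V y ≡ true →
        E x a ≡ true → E a b ≡ true → E b y ≡ true → E x y ≡ true → b ≢ x → a ≢ y → ⊥) →
      (∀ {x} → V x ≡ true → m ≤ deg E V x) →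
      Removal E V c φ I × (let Xs = ⟪ map φ (removed c I) ⟫ in
        14 * card Xs + eb E Xs Xs + a ≤ 30 * card ⟪ map φ I ⟫ + 2 * eb E Xs V + b)
    gain-cut {I} {c4} {m} {a} {b} h c4free mdeg = R , subst₂ (λ x i → 14 * x + eb E Xs Xs + a ≤ 30 * i + 2 * eb E Xs V + b)
        (sym (Removal.card-X R)) (sym (Removal.card-I R))
        (lin 0 (+-mono-≤ (≤ᵇ⁻ {14 * length X + hiSum c4 m c X + a} (proj₂ (∧-true {structᵇ c I} h))) (gain-bound {I} {c4} {m} s c4free mdeg))
          (lem (length X) (length I) (hiSum c4 m c X) (loSum c4 m c X) (eb E Xs Xs) (eb E Xs V) a b))
      where
      s = proj₁ (∧-true {structᵇ c I} h)
      R = removal {I} s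
      X = removed c I
      Xs = ⟪ map φ X ⟫
      lem : ∀ x i hi lo e f a b → 14 * x + e + a + (30 * i + 2 * lo + b + (hi + 2 * f)) + 0
        ≡ 30 * i + 2 * f + b + (14 * x + hi + a + (e + 2 * lo))
      lem = solve-∀

  -- The exceptional graphs inside the ambient vertex set, and the search for patterns

  record F14 (E : Adj) (V : VSet) : Set where
    field
      which : Bool
      f     : Fin 14 → Vx
      f-in  : ∀ a → V (f a) ≡ true
      f-inj : ∀ {a b} → f a ≡ f b → a ≡ b
      f-sur : ∀ {x} → V x ≡ true → ∃ λ a → f a ≡ x
      f-adj : ∀ a b → E (f a) (f b) ≡ adjF which a b
      cubic : ∀ {x} → V x ≡ true → 3 ≤ deg E V x

  ∈⇒‼ : ∀ {x xs} → x ∈ xs → ∃ λ i → i < length xs × xs ‼ i ≡ x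
  ∈⇒‼ (here refl) = 0 , s≤s z≤n , refl
  ∈⇒‼ (there m) with ∈⇒‼ m
  ... | i , h , e = suc i , s≤s h , e

  sameᵇ⁻ : ∀ {a b} → sameᵇ a b ≡ true → a ≡ b
  sameᵇ⁻ {true}  {true}  h = refl
  sameᵇ⁻ {false} {false} h = refl

  -- All listed vertices have no unknown neighbours, so their image is a closed set and, by
  -- connectedness, all of `V`. For the same reason the known edges among them are all the edges.
  iso-sound : ∀ {E V c φ b js} → Good E V → Conn E V → Valid E V c φ → isoᵇ c b js ≡ true → F14 E V
  iso-sound {E} {V} {c} {φ} {b} {js} g co v h = record
    { which = b
    ; f = λ a → φ (js ‼ toℕ a)
    ; f-in = λ a → inV (<k (‼∈ {js} (idx a)))
    ; f-inj = λ {a} {a′} e → toℕ-injective (‼-inj {js} (uniq⁻ u) (idx a) (idx a′) (inj (<k (‼∈ {js} (idx a))) (<k (‼∈ {js} (idx a′))) e))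
    ; f-sur = λ p → sur (∈-map⁻ φ (⟪⟫⁻ {map φ js} (onto p)))
    ; f-adj = λ x y → trans (adj-elem (‼∈ {js} (idx x)) (‼∈ {js} (idx y)))
        (sameᵇ⁻ (allᵇ⁻ {f = λ y → sameᵇ (elem (js ‼ toℕ y) (nb es (js ‼ toℕ x))) (adjF b x y)} {xs = allFin 14}
          (allᵇ⁻ {f = λ x → allᵇ (λ y → sameᵇ (elem (js ‼ toℕ y) (nb es (js ‼ toℕ x))) (adjF b x y)) (allFin 14)} {xs = allFin 14} tab (∈-allFin x)) (∈-allFin y)))
    ; cubic = λ p → cub3 (∈-map⁻ φ (⟪⟫⁻ {map φ js} (onto p))) }
    where
    open Cfg c
    open Valid v
    open Local g v
    open Good g using (symm)
    k≡14 : k ≡ 14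
    k≡14 = ≡ᵇ⁻ (proj₁ (∧-true {k ≡ᵇ 14} h))
    h1 = proj₂ (∧-true {k ≡ᵇ 14} h)
    len : length js ≡ 14
    len = ≡ᵇ⁻ (proj₁ (∧-true {length js ≡ᵇ 14} h1))
    h2 = proj₂ (∧-true {length js ≡ᵇ 14} h1)
    u = proj₁ (∧-true {uniqᵇ js} h2)
    h3 = proj₂ (∧-true {uniqᵇ js} h2)
    h4 = proj₂ (∧-true {allᵇ (λ j → (j <ᵇ 14) ∧ isClosed c j) js} h3)
    h5 = proj₂ (∧-true {allᵇ (λ j → elem j js) (upTo 14)} h4)
    tab = proj₂ (∧-true {allᵇ (λ j → length (nb es j) ≡ᵇ 3) js} h5)
    at : ∀ {j} → j ∈ js → ((j <ᵇ 14) ∧ isClosed c j) ≡ true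
    at m = allᵇ⁻ {f = λ j → (j <ᵇ 14) ∧ isClosed c j} {xs = js} (proj₁ (∧-true {allᵇ (λ j → (j <ᵇ 14) ∧ isClosed c j) js} h3)) m
    <k : ∀ {j} → j ∈ js → j < k
    <k {j} m = ≤-trans (<ᵇ⁻ (proj₁ (∧-true {j <ᵇ 14} (at m)))) (≤-reflexive (sym k≡14))
    cl : ∀ {j} → j ∈ js → isClosed c j ≡ true
    cl {j} m = proj₂ (∧-true {j <ᵇ 14} (at m))
    idx : ∀ (a : Fin 14) → toℕ a < length js
    idx a = ≤-trans (toℕ<n a) (≤-reflexive (sym len))
    all-in : ∀ {j} → j < k → j ∈ js
    all-in {j} lt = elem⁻ (allᵇ⁻ {f = λ j → elem j js} {xs = upTo 14} (proj₁ (∧-true {allᵇ (λ j → elem j js) (upTo 14)} h4)) (∈-upTo⁺ (≤-trans lt (≤-reflexive k≡14))))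
    onto : V ⊑ ⟪ map φ js ⟫
    onto = co ⟪ map φ js ⟫ (φ (js ‼ 0) , ⟪⟫⁺ (∈-map⁺ φ (‼∈ {js} (idx zero)))) (image-⊑ <k) λ {x} {y} p Vy e → step (∈-map⁻ φ (⟪⟫⁻ {map φ js} p)) Vy e
      where
      step : ∀ {x y} → (∃ λ j → j ∈ js × x ≡ φ j) → V y ≡ true → E x y ≡ true → ⟪ map φ js ⟫ y ≡ true
      step (j , m , refl) Vy e with closed-sound (<k m) (cl m) Vy e
      ... | l , n , refl = ⟪⟫⁺ (∈-map⁺ φ (all-in (nb<k n)))
    sur : ∀ {x} → (∃ λ j → j ∈ js × x ≡ φ j) → ∃ λ a → φ (js ‼ toℕ a) ≡ x
    sur (j , m , refl) with ∈⇒‼ m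
    ... | i , lt , refl = fromℕ< lt14 , cong (λ z → φ (js ‼ z)) (toℕ-fromℕ< lt14)
      where
      lt14 : i < 14
      lt14 = ≤-trans lt (≤-reflexive len)
    adj-elem : ∀ {i j} → i ∈ js → j ∈ js → E (φ i) (φ j) ≡ elem j (nb es i)
    adj-elem {i} {j} m n with bool? (elem j (nb es i))
    ... | inj₁ t = trans (edges′ symm (elem⁻ t)) (sym t)
    ... | inj₂ f = trans (¬true λ e → t≢f (closed-nb (<k m) (<k n) (cl m) e) f) (sym f)
    cub3 : ∀ {x} → (∃ λ j → j ∈ js × x ≡ φ j) → 3 ≤ deg E V x
    cub3 (j , m , refl) = ≤-trans (≤-reflexive (sym (≡ᵇ⁻ (allᵇ⁻ {f = λ j → length (nb es j) ≡ᵇ 3} {xs = js}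
      (proj₁ (∧-true {allᵇ (λ j → length (nb es j) ≡ᵇ 3) js} h5)) m)))) (nb-deg (closed-uniq (cl m)))

  at : ∀ {n} → Vec Vx (suc n) → ℕ → Vx
  at (x ∷ xs)     zero    = x
  at (x ∷ [])     (suc i) = x
  at (x ∷ y ∷ ys) (suc i) = at (y ∷ ys) i

  at-tabulate : ∀ {n} (φ : ℕ → Vx) {i} → i < suc n → at (tabulate {n = suc n} (φ ∘ toℕ)) i ≡ φ i
  at-tabulate         φ {zero}  h             = refl
  at-tabulate {zero}  φ {suc i} (s≤s ())
  at-tabulate {suc n} φ {suc i} (s≤s h)       = at-tabulate {n} (φ ∘ suc) h

  anyVec? : ∀ n {P : Vec Vx n → Set} → (∀ v → Dec (P v)) → Dec (∃ P)
  anyVec? zero    P? = map′ ([] ,_) (λ { ([] , p) → p }) (P? [])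
  anyVec? (suc n) P? = map′ (λ { (x , v , p) → x ∷ v , p }) (λ { (x ∷ v , p) → x , v , p }) (any? λ x → anyVec? n λ v → P? (x ∷ v))

  -- An exhaustive search over vertex vectors, which makes the case distinction on the presence of a
  -- pattern constructive.
  free? : ∀ E V n es → allᵇ (λ e → (proj₁ e <ᵇ suc n) ∧ (proj₂ e <ᵇ suc n)) es ≡ true →
          Free E V (suc n , es) ⊎ ∃ (Emb E V (suc n , es))
  free? E V n es wf with anyVec? (suc n) (λ v → dec (at v))
    where
    Emb′ : (ℕ → Vx) → Set
    Emb′ φ = All (λ i → V (φ i) ≡ true) (upTo (suc n)) ×
             All (λ i → All (λ j → φ i ≡ φ j → i ≡ j) (upTo (suc n))) (upTo (suc n)) ×
             All (λ e → E (φ (proj₁ e)) (φ (proj₂ e)) ≡ true) es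
    dec : ∀ φ → Dec (Emb′ φ)
    dec φ = All.all? (λ i → V (φ i) ≟ᵇ true) _ ×-dec
            All.all? (λ i → All.all? (λ j → (φ i ≟ φ j) →-dec (i ≟ℕ j)) _) _ ×-dec
            All.all? (λ e → E (φ (proj₁ e)) (φ (proj₂ e)) ≟ᵇ true) es
  ... | yes (v , a , b , c) = inj₂ (at v , record { inV = λ h → All.lookup a (∈-upTo⁺ h)
          ; inj = λ h l → All.lookup (All.lookup b (∈-upTo⁺ h)) (∈-upTo⁺ l) ; edges = c })
  ... | no ¬p = inj₁ λ φ e → ¬p (tabulate (φ ∘ toℕ) ,
          All.tabulate (λ m → trans (cong V (at-tabulate φ (∈-upTo⁻ m))) (Emb.inV e (∈-upTo⁻ m))) ,
          All.tabulate (λ m → All.tabulate λ m′ eq → Emb.inj e (∈-upTo⁻ m) (∈-upTo⁻ m′)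
            (trans (sym (at-tabulate φ (∈-upTo⁻ m))) (trans eq (at-tabulate φ (∈-upTo⁻ m′))))) ,
          All.tabulate λ {x} m → let w = allᵇ⁻ {xs = es} wf m in
            trans (cong₂ E (at-tabulate φ (<ᵇ⁻ (proj₁ (∧-true {proj₁ x <ᵇ suc n} w)))) (at-tabulate φ (<ᵇ⁻ (proj₂ (∧-true {proj₁ x <ᵇ suc n} w)))))
                  (Emb.edge e m))

  emb-valid : ∀ {E V P φ} → Emb E V P φ → allᵇ (λ e → (proj₁ e <ᵇ proj₁ P) ∧ (proj₂ e <ᵇ proj₁ P)) (proj₂ P) ≡ true →
              Valid E V (cfg (proj₁ P) [] (proj₂ P)) φ
  emb-valid {P = P} e h = record
    { emb = record { inV = Emb.inV e ; inj = Emb.inj e ; edges = Emb.edges e }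
    ; wf = allᵇ-All (λ {x} w → <ᵇ⁻ (proj₁ (∧-true {proj₁ x <ᵇ proj₁ P} w)) , <ᵇ⁻ (proj₂ (∧-true {proj₁ x <ᵇ proj₁ P} w))) h
    ; fin<k = λ ()
    ; done = λ () }

  -- The joint induction on the number of vertices

  val-empty : ∀ {E V} → (∀ x → V x ≡ false) → Val E V 0 0
  val-empty {E} {V} h = val (λ _ → false) (λ ()) (λ ())
    (≤-trans (≤-reflexive (trans (cong (λ z → 14 * z + 0) c0) (trans (sym (+-identityʳ 0)) refl))) z≤n)
    where
    c0 : card V ≡ 0
    c0 = trans (card-cong {V} {⟪ [] ⟫} h) (card-list [])

  -- 14 · 14 = 30 · 5 + 42 + 4, with 42 the degree sum of a cubic graph on 14 vertices.
  F14-val : ∀ {E V} → Good E V → F14 E V → Val E V 0 4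
  F14-val {E} {V} g F = val S sub ind′ bd
    where
    open F14 F
    xs = fiveSet which
    S : VSet
    S = ⟪ map f xs ⟫
    sub : S ⊑ V
    sub p with ∈-map⁻ f (⟪⟫⁻ {map f xs} p)
    ... | a , m , refl = f-in a
    ind′ : Indep E S
    ind′ p q with ∈-map⁻ f (⟪⟫⁻ {map f xs} p) | ∈-map⁻ f (⟪⟫⁻ {map f xs} q)
    ... | a , m , refl | b , n , refl = trans (f-adj a b) (fiveSet-nonadj which m n)
    cS : card S ≡ 5
    cS = trans (card-list (map⁺ f-inj (fiveSet-unique which))) (trans (length-map f xs) (fiveSet-length which))
    cV : card V ≡ 14
    cV = trans (card-cong {V} {⟪ map f (allFin 14) ⟫} pt) (trans (card-list (map⁺ f-inj (allFin⁺ 14))) refl)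
      where
      pt : ∀ x → V x ≡ ⟪ map f (allFin 14) ⟫ x
      pt x with V x in v
      ... | true with f-sur v
      ... | a , refl = sym (⟪⟫⁺ (∈-map⁺ f (∈-allFin a)))
      pt x | false = sym (⟪⟫-∉ λ m → case (∈-map⁻ f m))
        where
        case : (∃ λ a → a ∈ allFin 14 × x ≡ f a) → ⊥
        case (a , _ , refl) = t≢f (f-in a) v
    ebV : 42 ≤ eb E V V
    ebV = ≤-trans (≤-reflexive (sym (cong (_* 3) cV))) (eb-lower {E} {V} {V} 3 cubic)
    bd : 14 * card V + 0 ≤ 30 * card S + (eb E V V + 4)
    bd = ≤-trans (≤-reflexive (cong (λ z → 14 * z + 0) cV))
           (≤-trans (+-monoʳ-≤ 150 (+-monoˡ-≤ 4 ebV)) (≤-reflexive (cong (λ z → 30 * z + (eb E V V + 4)) (sym cS))))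

  -- In `girth` the number k is any lower bound, up to 6, of the total deficiency. Stating it for
  -- all such k instead of the minimum lets a step hand on just the part of k that is left after a
  -- component or a closed neighbourhood has been removed.
  record IH (m : ℕ) : Set where
    field
      low   : ∀ {E V} → Good E V → card V < m → Loose E V → Free E V eightPat → Val E V 0 0
      girth : ∀ {E V} → Good E V → card V < m → Loose E V → Free E V squarePat → Free E V fivePat →
              ∀ k → k ≤ 6 → k + eb E V V ≤ 3 * card V → Val E V k 0
      conn  : ∀ {E V} → Good E V → card V < m → Conn E V → Val E V 0 2 ⊎ F14 E V

    conn₂ : ∀ {E V} → Good E V → card V < m → Conn E V → Val E V 0 4
    conn₂ g c co with conn g c co
    ... | inj₁ v = val-weaken {c = 0} {d = 2} (s≤s (s≤s z≤n)) v
    ... | inj₂ F = F14-val g F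

    -- The exceptional graphs are cubic, so a vertex of degree at most 2 rules them out.
    conn-loose : ∀ {E V u} → Good E V → card V < m → Conn E V → V u ≡ true → deg E V u ≤ 2 → Val E V 0 2
    conn-loose {u = u} g c co v d with conn g c co
    ... | inj₁ w = w
    ... | inj₂ F = ⊥-elim (<-irrefl refl (≤-trans (F14.cubic F v) d))

  NoC4 : Adj → VSet → Set
  NoC4 E V = ∀ {x a b y} → V x ≡ true → V a ≡ true → V b ≡ true → V y ≡ true →
             E x a ≡ true → E a b ≡ true → E b y ≡ true → E x y ≡ true → b ≢ x → a ≢ y → ⊥

  leaf-val : ∀ {E V c φ I c4 m a b} → Good E V → (c4 ≡ true → NoC4 E V) → (∀ {x} → V x ≡ true → m ≤ deg E V x) →
             (∀ {X} → Nonempty X → X ⊑ V → Val E (V ∖ X) 0 0) → Valid E V c φ → gainᵇ c4 m a b c I ≡ true → Val E V a b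
  leaf-val {E} {V} {c} {φ} {I} {c4} {m} {a} {b} g c4f md rest v h =
    cut-val {E} {V} {Xs} {Is} {0} {0} {a} {b} (Good.symm g) (Removal.isCut R) (rest (Removal.X-nonempty R) (Cut.X⊑V (Removal.isCut R)))
      (subst (λ z → 14 * card Xs + eb E Xs Xs + z ≤ 30 * card Is + 2 * eb E Xs V + b) (sym (+-identityʳ a)) (proj₂ gc))
    where
    Xs Is : VSet
    Xs = ⟪ map φ (removed c I) ⟫
    Is = ⟪ map φ I ⟫
    gc : Removal E V c φ I × 14 * card Xs + eb E Xs Xs + a ≤ 30 * card Is + 2 * eb E Xs V + b
    gc = Leaf.gain-cut g v {I} {c4} {m} {a} {b} h c4f md
    R : Removal E V c φ I
    R = proj₁ gc

  images : List Vx → Vx → ℕ → Vx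
  images xs d i = nth xs i d

  record Listed (E : Adj) (V : VSet) (xs : List Vx) (fin : List ℕ) (es : Edges) (d : Vx) : Set where
    field
      inV   : All (λ x → V x ≡ true) xs
      uniq  : Unique xs
      edges : All (λ e → E (images xs d (proj₁ e)) (images xs d (proj₂ e)) ≡ true) es
      done  : All (λ i → deg E V (images xs d i) ≤ length (nb es i)) fin

  nth-inj : ∀ {xs : List Vx} {d i j} → Unique xs → i < length xs → j < length xs → nth xs i d ≡ nth xs j d → i ≡ j
  nth-inj {x ∷ xs} {d} {zero}  {zero}  u h k e = refl
  nth-inj {x ∷ xs} {d} {zero}  {suc j} (x∉ ∷ u) h (s≤s k) e = ⊥-elim (All.lookup x∉ (nth∈ {xs = xs} {j} {d} k) e)
  nth-inj {x ∷ xs} {d} {suc i} {zero}  (x∉ ∷ u) (s≤s h) k e = ⊥-elim (All.lookup x∉ (nth∈ {xs = xs} {i} {d} h) (sym e))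
  nth-inj {x ∷ xs} {d} {suc i} {suc j} (x∉ ∷ u) (s≤s h) (s≤s k) e = cong suc (nth-inj u h k e)

  listed-valid : ∀ {E V xs fin es d} → Listed E V xs fin es d →
    allᵇ (λ e → (proj₁ e <ᵇ length xs) ∧ (proj₂ e <ᵇ length xs)) es ≡ true → allᵇ (_<ᵇ length xs) fin ≡ true →
    Valid E V (cfg (length xs) fin es) (images xs d)
  listed-valid {E} {V} {xs} {fin} {es} {d} L w wf = record
    { emb = record { inV = λ h → All.lookup inV (nth∈ {xs = xs} h) ; inj = λ h k e → nth-inj {xs} {d} uniq h k e ; edges = edges }
    ; wf = allᵇ-All (λ {x} w → <ᵇ⁻ (proj₁ (∧-true {proj₁ x <ᵇ length xs} w)) , <ᵇ⁻ (proj₂ (∧-true {proj₁ x <ᵇ length xs} w))) w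
    ; fin<k = λ {i} f → <ᵇ⁻ (allᵇ⁻ {f = _<ᵇ length xs} {xs = fin} wf (elem⁻ f))
    ; done = λ f → All.lookup done (elem⁻ f) }
    where open Listed L

  pair-from : ∀ {E V s t p q} → Good E V → V s ≡ true → V t ≡ true → V p ≡ true → V q ≡ true →
    E s t ≡ true → E s p ≡ true → E t q ≡ true → deg E V s ≤ 2 → deg E V t ≤ 2 → p ≢ t → q ≢ s → p ≢ q → Pair E V s t p q
  pair-from {E} {V} {s} {t} {p} {q} g Vs Vt Vp Vq st sp tq ds dt p≢t q≢s p≢q = record
    { s∈ = Vs ; t∈ = Vt ; p∈ = Vp ; q∈ = Vq ; st = st ; sp = sp ; tq = tq
    ; nbS = two {s} {t} {p} Vt Vp st sp (p≢t ∘ sym) ds ; nbT = two {t} {s} {q} Vs Vq (Good.symm⁺ g st) tq (q≢s ∘ sym) dt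
    ; p≢t = p≢t ; q≢s = q≢s ; p≢q = p≢q }
    where
    two : ∀ {x a b} → V a ≡ true → V b ≡ true → E x a ≡ true → E x b ≡ true → a ≢ b → deg E V x ≤ 2 →
          ∀ {y} → V y ≡ true → E x y ≡ true → y ≡ a ⊎ y ≡ b
    two {x} {a} {b} Va Vb xa xb a≢b d {y} Vy e
      with ⟪⟫⁻ {a ∷ b ∷ []} (full {P = λ z → V z ∧ E x z} (unique₂ a≢b)
             (⟪⟫-⊑ {V = λ z → V z ∧ E x z} (∧-intro Va xa ∷ ∧-intro Vb xb ∷ []))
             (≤-trans (≤-reflexive (sym (deg-card E V x))) d) (∧-intro Vy e))
    ... | here q = inj₁ q
    ... | there (here q) = inj₂ q

  -- Every component has a vertex of degree at most 2

  another-nb : ∀ {E V x xs} → Unique xs → (∀ {y} → y ∈ xs → V y ≡ true × E x y ≡ true) → length xs < deg E V x →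
               ∃ λ y → V y ≡ true × E x y ≡ true × y ∉ xs
  another-nb {E} {V} {x} {xs} u h l = proj₁ w , proj₁ Vw , proj₂ Vw , proj₂ (proj₂ w)
    where
    w : ∃ λ y → (V y ∧ E x y) ≡ true × y ∉ xs
    w = fresh {P = λ z → V z ∧ E x z} u (λ p → ∧-intro (proj₁ (h (⟪⟫⁻ p))) (proj₂ (h (⟪⟫⁻ p)))) (≤-trans l (≤-reflexive (deg-card E V x)))
    Vw = ∧-true {V (proj₁ w)} (proj₁ (proj₂ w))

  ∉-≢ : ∀ {x y : Vx} {xs} → x ∉ y ∷ xs → x ≢ y
  ∉-≢ h e = h (here e)

  unique₃ : ∀ {x y z : Vx} → x ≢ y → x ≢ z → y ≢ z → Unique (x ∷ y ∷ z ∷ [])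
  unique₃ a b c = (a ∷ b ∷ []) ∷ unique₂ c

  unique₄ : ∀ {x y z w : Vx} → x ≢ y → x ≢ z → x ≢ w → y ≢ z → y ≢ w → z ≢ w → Unique (x ∷ y ∷ z ∷ w ∷ [])
  unique₄ a b c d e f = (a ∷ b ∷ c ∷ []) ∷ unique₃ d e f

  module _ {m : ℕ} (ih : IH m) where
    open IH ih

    rest-low : ∀ {E V} → Good E V → card V ≤ m → Loose E V → Free E V eightPat →
               ∀ {X} → Nonempty X → X ⊑ V → Val E (V ∖ X) 0 0
    rest-low {E} {V} g c lo f8 {X} (z , Xz) X⊑V = low (good-⊑ g (∖⊑ {V} {X})) (≤-trans (card-∖< {V} {X} X⊑V Xz) c)
      (loose-∖ {E} {V} {X} g X⊑V lo) (free-⊑ {E} {V ∖ X} {V} {eightPat} (∖⊑ {V} {X}) f8)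

    -- The edge p q is already there, so suppression is impossible; a deletion in the 4-cycle p s t
    -- q gains 2 instead.
    loop-val : ∀ {E V s t p q} → Good E V → card V ≤ m → Loose E V → Free E V eightPat → Pair E V s t p q →
               E p q ≡ true → Val E V 2 0
    loop-val {E} {V} {s} {t} {p} {q} g c lo f8 P pq = Soundness.sound sem loopCert
        (listed-valid {xs = s ∷ t ∷ p ∷ q ∷ []} {fin = 0 ∷ 1 ∷ []} {d = s} L refl refl) loopOK
      where
      open Pair P
      open Good g using (adj≢)
      L : Listed E V (s ∷ t ∷ p ∷ q ∷ []) (0 ∷ 1 ∷ []) (Cfg.es loopCfg) s
      L = record { inV = s∈ ∷ t∈ ∷ p∈ ∷ q∈ ∷ []
                 ; uniq = unique₄ (adj≢ st) (adj≢ sp) (q≢s ∘ sym) (p≢t ∘ sym) (adj≢ tq) p≢q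
                 ; edges = st ∷ sp ∷ tq ∷ pq ∷ []
                 ; done = ≤-reflexive (deg-exact {E} {V} {s} {t ∷ p ∷ []} (unique₂ (p≢t ∘ sym))
                              (λ { (here refl) → t∈ , st ; (there (here refl)) → p∈ , sp }) (λ v e → h (nbS v e)))
                        ∷ ≤-reflexive (deg-exact {E} {V} {t} {s ∷ q ∷ []} (unique₂ (q≢s ∘ sym))
                              (λ { (here refl) → s∈ , Good.symm⁺ g st ; (there (here refl)) → q∈ , tq }) (λ v e → h (nbT v e))) ∷ [] }
        where
        h : ∀ {y a b : Vx} → y ≡ a ⊎ y ≡ b → y ∈ a ∷ b ∷ []
        h (inj₁ e) = here e
        h (inj₂ e) = there (here e)
      sem : Sem loopMode E V (Val E V 2 0)
      sem = record { good = g ; c4free = λ () ; degs = λ _ → z≤n ; killed = λ () ; ruled = λ ()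
                   ; leafed = λ c′ φ I v h → leaf-val {c = c′} {φ} {I} {false} {0} {2} {0} g (λ ()) (λ _ → z≤n) (rest-low g c lo f8) v h
                   ; isoed = λ () }

    -- Suppression gains 6 in the component of s, and the connected graph that it produces misses at
    -- most 4, whatever copies of F₈ the new edge creates; so 2 are left. Once p and q are not
    -- adjacent, the only obstacle is a triangle on the new edge, that is, a common neighbour.
    pair-or-common : ∀ {E V s t p q} → Good E V → card V ≤ m → Loose E V → Free E V eightPat → Pair E V s t p q →
                     Val E V 2 0 ⊎ CommonNb E V p q
    pair-or-common {E} {V} {s} {t} {p} {q} g c lo f8 P
      with bool? (E p q) | any? (λ w → (V w ≟ᵇ true) ×-dec (E p w ≟ᵇ true) ×-dec (E q w ≟ᵇ true))
    ... | inj₁ pq | _ = inj₁ (loop-val g c lo f8 P pq)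
    ... | inj₂ npq | yes w = inj₂ w
    ... | inj₂ npq | no ¬w = inj₁ (val-weaken {c = 6} {d = 4} (≤-refl {6})
            (val-union {E} {V} {K} {6} {4} {0} {0} symm K⊑V (λ {x} {y} → closed {x} {y}) vK vR))
      where
      open Pair P
      open Good g using (symm; symm⁺)
      open Comp (component {E} V s symm s∈) renaming (conn to K-conn)
      t∈K = closed s∈K t∈ st
      PK : Pair E K s t p q
      PK = record { s∈ = s∈K ; t∈ = t∈K ; p∈ = closed s∈K p∈ sp ; q∈ = closed t∈K q∈ tq ; st = st ; sp = sp ; tq = tq
                  ; nbS = λ k e → nbS (K⊑V k) e ; nbT = λ k e → nbT (K⊑V k) e ; p≢t = p≢t ; q≢s = q≢s ; p≢q = p≢q }
      module Su = Suppress (good-⊑ g K⊑V) PK npq (λ k a b → ¬w (_ , K⊑V k , a , b))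
      vK : Val E K 6 4
      vK = Su.supp-val (conn₂ Su.good (≤-trans (≤-trans (s≤s (m≤m+n _ 1)) (≤-reflexive (trans (lem (card Su.V⁻)) (sym Su.card-supp))))
                                       (≤-trans (card-mono K⊑V) c)) (Su.supp-conn K-conn))
        where
        lem : ∀ a → suc (a + 1) ≡ a + 2
        lem = solve-∀
      vR : Val E (V ∖ K) 0 0
      vR = rest-low g c lo f8 (s , s∈K) K⊑V

    -- The 5-cycle is s t q r p. If q has degree at most 2, choosing s and q removes the whole
    -- cycle. Otherwise choosing t removes s, t, q at a loss of at most 2; then p and r are adjacent
    -- of degree at most 2, and `pair-or-common` regains the 2 unless their outer neighbours have a
    -- common neighbour.
    ear-val : ∀ {E V} → Good E V → card V ≤ m → Loose E V → Free E V eightPat →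
              ∀ φ → Emb E V earPat φ → deg E V (φ 0) ≤ 2 → deg E V (φ 1) ≤ 2 →
              Val E V 0 0 ⊎ CommonNb E V (φ 5) (φ 6)
    ear-val {E} {V} g c lo f8 φ e ds dt with deg E V (φ 3) ≤? 2
    ... | yes dq = inj₁ (leaf-val {c = cfg 7 (0 ∷ 1 ∷ 3 ∷ []) (proj₂ earPat)} {φ = φ} {I = 0 ∷ 3 ∷ []} {c4 = false} {m = 0} {a = 0} {b = 0}
            g (λ ()) (λ _ → z≤n) (rest-low g c lo f8)
            (record { emb = record { inV = Emb.inV e ; inj = Emb.inj e ; edges = Emb.edges e } ; wf = Valid.wf (emb-valid e refl)
                    ; fin<k = λ {i} f → <ᵇ⁻ (allᵇ⁻ {f = _<ᵇ 7} {xs = 0 ∷ 1 ∷ 3 ∷ []} refl (elem⁻ {i} f))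
                    ; done = λ {i} f → fin-deg (elem⁻ {i} f) }) refl)
      where
      fin-deg : ∀ {i} → i ∈ 0 ∷ 1 ∷ 3 ∷ [] → deg E V (φ i) ≤ length (nb (proj₂ earPat) i)
      fin-deg (here refl) = ds
      fin-deg (there (here refl)) = dt
      fin-deg (there (there (here refl))) = dq
    ... | no dq = finish (pair-or-common {E} {V ∖ X} (good-⊑ g (∖⊑ {V} {X})) (≤-trans (≤-trans (m≤n+m _ 1) (card-∖< {V} {X} {t} X⊑V (⟪⟫⁺ {t ∷ s ∷ q ∷ []} (here refl)))) c)
            (loose-∖ {E} {V} {X} g X⊑V lo) (free-⊑ {E} {V ∖ X} {V} {eightPat} (∖⊑ {V} {X}) f8) P)
      where
      open Good g using (symm; symm⁺; irr)
      open Emb e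
      s t p q r p′ r′ : Vx
      s = φ 0
      t = φ 1
      p = φ 2
      q = φ 3
      r = φ 4
      p′ = φ 5
      r′ = φ 6
      st = edge! 0 1 refl
      sp = edge! 0 2 refl
      tq = edge! 1 3 refl
      pr = edge! 2 4 refl
      qr = edge! 3 4 refl
      pp′ = edge! 2 5 refl
      rr′ = edge! 4 6 refl
      X : VSet
      X = ⟪ t ∷ s ∷ q ∷ [] ⟫
      uX : Unique (t ∷ s ∷ q ∷ [])
      uX = unique₃ (apart {1} {0} refl refl refl) (apart {1} {3} refl refl refl) (apart {0} {3} refl refl refl)
      X⊑V : X ⊑ V
      X⊑V = ⟪⟫-⊑ {V = V} (inV! {1} refl ∷ inV! {0} refl ∷ inV! {3} refl ∷ [])
      out : ∀ {i} → (i <ᵇ 7) ≡ true → (i ≡ᵇ 1) ≡ false → (i ≡ᵇ 0) ≡ false → (i ≡ᵇ 3) ≡ false → (V ∖ X) (φ i) ≡ true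
      out {i} h a b c = ∖-intro {V} {X} (inV! h) (⟪⟫-∉ {t ∷ s ∷ q ∷ []} λ
        { (here q) → apart {i} {1} h refl a q ; (there (here q)) → apart {i} {0} h refl b q ; (there (there (here q))) → apart {i} {3} h refl c q })
      drop : ∀ {x y} → V x ≡ true → V y ≡ true → deg E V x ≤ 3 → X y ≡ true → E x y ≡ true → deg E (V ∖ X) x ≤ 2
      drop Vx Vy d Xy a = ≤-pred (≤-trans (deg-drop {E} {V} {X} X⊑V Xy a) d)
      P : Pair E (V ∖ X) p r p′ r′
      P = pair-from (good-⊑ g (∖⊑ {V} {X})) (out {2} refl refl refl refl) (out {4} refl refl refl refl) (out {5} refl refl refl refl) (out {6} refl refl refl refl)
            pr pp′ rr′ (drop (inV! {2} refl) (inV! {0} refl) (Good.cub g (inV! {2} refl)) (⟪⟫⁺ {t ∷ s ∷ q ∷ []} (there (here refl))) (symm⁺ sp))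
            (drop (inV! {4} refl) (inV! {3} refl) (Good.cub g (inV! {4} refl)) (⟪⟫⁺ {t ∷ s ∷ q ∷ []} (there (there (here refl)))) (symm⁺ qr))
            (apart {5} {4} refl refl refl) (apart {6} {2} refl refl refl) (apart {5} {6} refl refl refl)
      eXV : 7 ≤ eb E X V
      eXV = ≤-trans (+-mono-≤ {2} (two {t} {s} {q} (inV! {0} refl) (inV! {3} refl) (symm⁺ st) tq (apart {0} {3} refl refl refl))
              (+-mono-≤ {2} (two {s} {t} {p} (inV! {1} refl) (inV! {2} refl) st sp (apart {1} {2} refl refl refl))
              (+-mono-≤ {3} {deg E V q} {0} {0} (≰⇒> dq) z≤n))) (≤-reflexive (sym (eb-list {E} V uX)))
        where
        two : ∀ {x a b} → V a ≡ true → V b ≡ true → E x a ≡ true → E x b ≡ true → a ≢ b → 2 ≤ deg E V x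
        two {x} {a} {b} Va Vb xa xb n = ≤-trans (card-⟨⟩≤ {a ∷ b ∷ []} {λ z → V z ∧ E x z} (unique₂ n)
          (⟪⟫-⊑ {V = λ z → V z ∧ E x z} (∧-intro Va xa ∷ ∧-intro Vb xb ∷ []))) (≤-reflexive (sym (deg-card E V x)))
      eXX : eb E X X ≡ 4
      eXX = trans (eb-list {E} X uX) (trans (cong sumL (cong₂ _∷_ (deg-list {E} t uX) (cong₂ _∷_ (deg-list {E} s uX) (cong₂ _∷_ (deg-list {E} q uX) (refl {x = []}))))) calc)
        where
        nsq : E s q ≡ false
        nsq = ¬true λ h → Good.tri g (inV! {0} refl) (inV! {1} refl) (inV! {3} refl) st tq h
        calc : (ind (E t t) + (ind (E t s) + (ind (E t q) + 0))) + ((ind (E s t) + (ind (E s s) + (ind (E s q) + 0))) +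
               ((ind (E q t) + (ind (E q s) + (ind (E q q) + 0))) + 0)) ≡ 4
        calc rewrite irr t | irr s | irr q | symm⁺ st | tq | st | nsq | symm⁺ tq | trans (symm q s) nsq = refl
      theCut : Cut E V X ⟪ t ∷ [] ⟫
      theCut = cut X⊑V (λ {x} h → case1 (⟪⟫⁻ {t ∷ []} {x} h)) (λ {x} {y} h k → case2 (⟪⟫⁻ {t ∷ []} {x} h) (⟪⟫⁻ {t ∷ []} {y} k)) (λ {x} h v a → case3 (⟪⟫⁻ {t ∷ []} {x} h) v a)
        where
        case1 : ∀ {x} → x ∈ t ∷ [] → X x ≡ true
        case1 (here refl) = ⟪⟫⁺ {t ∷ s ∷ q ∷ []} (here refl)
        case2 : ∀ {x y} → x ∈ t ∷ [] → y ∈ t ∷ [] → E x y ≡ false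
        case2 (here refl) (here refl) = irr t
        case3 : ∀ {x y} → x ∈ t ∷ [] → V y ≡ true → E x y ≡ true → X y ≡ true
        case3 (here refl) v a with Pair.nbT (pair-from g (inV! {0} refl) (inV! {1} refl) (inV! {2} refl) (inV! {3} refl) st sp tq ds dt
              (apart {2} {1} refl refl refl) (apart {3} {0} refl refl refl) (apart {2} {3} refl refl refl)) v a
        ... | inj₁ refl = ⟪⟫⁺ {t ∷ s ∷ q ∷ []} (there (here refl))
        ... | inj₂ refl = ⟪⟫⁺ {t ∷ s ∷ q ∷ []} (there (there (here refl)))
      finish : Val E (V ∖ X) 2 0 ⊎ (CommonNb E (V ∖ X) p′ r′) →
               Val E V 0 0 ⊎ CommonNb E V p′ r′
      finish (inj₂ (w , Vw , a , b)) = inj₂ (w , ∖⊑ {V} {X} Vw , a , b)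
      finish (inj₁ v) = inj₁ (cut-val {E} {V} {X} {⟪ t ∷ [] ⟫} {2} {0} {0} {0} symm theCut v
        (subst₂ (λ x i → 14 * x + eb E X X + (0 + 0) ≤ 30 * i + 2 * eb E X V + (2 + 0)) (sym (card-list uX)) (sym (card-list {t ∷ []} ([] ∷ [])))
          (subst (λ z → 42 + z + 0 ≤ 30 + 2 * eb E X V + 2) (sym eXX) (+-monoˡ-≤ 2 (+-monoʳ-≤ 30 (*-mono-≤ (≤-refl {2}) eXV))))))

    low-sem : ∀ {E V} → Good E V → card V ≤ m → Loose E V → Free E V eightPat → (∀ {x} → V x ≡ true → 2 ≤ deg E V x) →
              Sem lowMode E V (Val E V 0 0)
    low-sem {E} {V} g c lo f8 d2 = record { good = g ; c4free = λ () ; degs = d2 ; killed = λ { (here refl) → f8 }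
      ; ruled = λ { (here refl) φ e l → path φ e l ; (there (here refl)) φ e l → ear φ e l }
      ; leafed = λ c′ φ I v h → leaf-val {c = c′} {φ} {I} {false} {2} {0} {0} g (λ ()) d2 (rest-low g c lo f8) v h
      ; isoed = λ () }
      where
      Excl : ℕ → (ℕ → Vx) → Vx → Set
      Excl n φ w = ∀ {e} → e ∈ [] → e < n → w ≢ φ e × E (φ e) w ≡ false
      path : ∀ φ → Emb E V pathPat φ → (∀ {a} → a ∈ 0 ∷ 1 ∷ [] → a < 4 → deg E V (φ a) ≤ 2) →
             Val E V 0 0 ⊎ ∃ λ w → V w ≡ true × E (φ 2) w ≡ true × E (φ 3) w ≡ true × Excl 4 φ w
      path φ e l = case (pair-or-common g c lo f8 (pair-from g (inV! {0} refl) (inV! {1} refl) (inV! {2} refl) (inV! {3} refl)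
          (edge! 0 1 refl) (edge! 0 2 refl) (edge! 1 3 refl)
          (l (here refl) (<ᵇ⁻ refl)) (l (there (here refl)) (<ᵇ⁻ refl)) (apart {2} {1} refl refl refl) (apart {3} {0} refl refl refl) (apart {2} {3} refl refl refl)))
        where
        open Emb e
        case : Val E V 2 0 ⊎ (CommonNb E V (φ 2) (φ 3)) →
               Val E V 0 0 ⊎ ∃ λ w → V w ≡ true × E (φ 2) w ≡ true × E (φ 3) w ≡ true × Excl 4 φ w
        case (inj₁ v) = inj₁ (val-weaken {c = 2} {d = 0} z≤n v)
        case (inj₂ (w , a , b , c)) = inj₂ (w , a , b , c , λ ())
      ear : ∀ φ → Emb E V earPat φ → (∀ {a} → a ∈ 0 ∷ 1 ∷ [] → a < 7 → deg E V (φ a) ≤ 2) →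
            Val E V 0 0 ⊎ ∃ λ w → V w ≡ true × E (φ 5) w ≡ true × E (φ 6) w ≡ true × Excl 7 φ w
      ear φ e l = case (ear-val g c lo f8 φ e (l (here refl) (<ᵇ⁻ refl)) (l (there (here refl)) (<ᵇ⁻ refl)))
        where
        case : Val E V 0 0 ⊎ (CommonNb E V (φ 5) (φ 6)) →
               Val E V 0 0 ⊎ ∃ λ w → V w ≡ true × E (φ 5) w ≡ true × E (φ 6) w ≡ true × Excl 7 φ w
        case (inj₁ v) = inj₁ v
        case (inj₂ (w , a , b , c)) = inj₂ (w , a , b , c , λ ())

  unique₅ : ∀ {x y z w u : Vx} → x ≢ y → x ≢ z → x ≢ w → x ≢ u → y ≢ z → y ≢ w → y ≢ u → z ≢ w → z ≢ u → w ≢ u → Unique (x ∷ y ∷ z ∷ w ∷ u ∷ [])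
  unique₅ a b c d e f g h i j = (a ∷ b ∷ c ∷ d ∷ []) ∷ unique₄ e f g h i j

  square-emb : ∀ {E V x a b y} → V x ≡ true → V a ≡ true → V b ≡ true → V y ≡ true →
               E x a ≡ true → E a b ≡ true → E b y ≡ true → E y x ≡ true → x ≢ a → x ≢ b → x ≢ y → a ≢ b → a ≢ y → b ≢ y →
               Emb E V squarePat (images (x ∷ a ∷ b ∷ y ∷ []) x)
  square-emb {x = x} {a} {b} {y} vx va vb vy e1 e2 e3 e4 d1 d2 d3 d4 d5 d6 = Valid.emb (listed-valid {xs = x ∷ a ∷ b ∷ y ∷ []} {fin = []} {es = proj₂ squarePat} {d = x} (record
    { inV = vx ∷ va ∷ vb ∷ vy ∷ [] ; uniq = unique₄ d1 d2 d3 d4 d5 d6 ; edges = e1 ∷ e2 ∷ e3 ∷ e4 ∷ [] ; done = [] }) refl refl)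

  no-square : ∀ {E V} → Good E V → Free E V squarePat → NoC4 E V
  no-square {E} {V} g fr vx va vb vy xa ab by xy b≢x a≢y = fr _ (square-emb {E} {V} vx va vb vy xa ab by (symm⁺ xy) (adj≢ xa) (b≢x ∘ sym) (adj≢ xy) (adj≢ ab) a≢y (adj≢ by))
    where open Good g

  five-emb : ∀ {E V x a b y z} → Good E V → V x ≡ true → V a ≡ true → V b ≡ true → V y ≡ true → V z ≡ true →
             E x a ≡ true → E a b ≡ true → E b y ≡ true → E y z ≡ true → E z x ≡ true → x ≢ b → x ≢ y → a ≢ y → a ≢ z → b ≢ z →
             Emb E V fivePat (images (x ∷ a ∷ b ∷ y ∷ z ∷ []) x)
  five-emb {x = x} {a} {b} {y} {z} g vx va vb vy vz e1 e2 e3 e4 e5 d1 d2 d3 d4 d5 = Valid.emb (listed-valid {xs = x ∷ a ∷ b ∷ y ∷ z ∷ []} {fin = []} {es = proj₂ fivePat} {d = x} (record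
    { inV = vx ∷ va ∷ vb ∷ vy ∷ vz ∷ []
    ; uniq = unique₅ (adj≢ e1) d1 d2 (adj≢ e5 ∘ sym) (adj≢ e2) d3 d4 (adj≢ e3) d5 (adj≢ e4)
    ; edges = e1 ∷ e2 ∷ e3 ∷ e4 ∷ e5 ∷ [] ; done = [] }) refl refl)
    where open Good g

  sameEdgeᵇ : ℕ → ℕ → ℕ → ℕ → Bool
  sameEdgeᵇ a b c d = ((a ≡ᵇ c) ∧ (b ≡ᵇ d)) ∨ ((a ≡ᵇ d) ∧ (b ≡ᵇ c))

  Joins : Vx → Vx → Vx → Vx → Set
  Joins p q x y = (x ≡ p × y ≡ q) ⊎ (x ≡ q × y ≡ p)

  -- By injectivity at most one edge of the pattern falls on p q.
  old-edge : ∀ {E V P φ p q a b c d} → Emb (addE E p q) V P φ → a < proj₁ P → b < proj₁ P → c < proj₁ P → d < proj₁ P →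
             Joins p q (φ a) (φ b) → addE E p q (φ c) (φ d) ≡ true → sameEdgeᵇ a b c d ≡ false → E (φ c) (φ d) ≡ true
  old-edge {E} {V} {P} {φ} {p} {q} {a} {b} {c} {d} e a< b< c< d< ab cd ne with addE⁻ {E} {p} {q} {φ c} {φ d} cd
  ... | inj₁ h = h
  ... | inj₂ h = ⊥-elim (case ab h)
    where
    open Emb e
    eq : ∀ {i j} → i ≡ j → (i ≡ᵇ j) ≡ true
    eq {i} refl = ≡ᵇ-refl i
    same : a ≡ c → b ≡ d → ⊥
    same h k = t≢f (∨-left {(a ≡ᵇ c) ∧ (b ≡ᵇ d)} (∧-intro (eq h) (eq k))) ne
    cross : a ≡ d → b ≡ c → ⊥
    cross h k = t≢f (∨-right {(a ≡ᵇ c) ∧ (b ≡ᵇ d)} (∧-intro (eq h) (eq k))) ne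
    case : Joins p q (φ a) (φ b) → Joins p q (φ c) (φ d) → ⊥
    case (inj₁ (x , y)) (inj₁ (z , w)) = same (inj a< c< (trans x (sym z))) (inj b< d< (trans y (sym w)))
    case (inj₁ (x , y)) (inj₂ (z , w)) = cross (inj a< d< (trans x (sym w))) (inj b< c< (trans y (sym z)))
    case (inj₂ (x , y)) (inj₁ (z , w)) = cross (inj a< d< (trans x (sym w))) (inj b< c< (trans y (sym z)))
    case (inj₂ (x , y)) (inj₂ (z , w)) = same (inj a< c< (trans x (sym z))) (inj b< d< (trans y (sym w)))

  module _ {E : Adj} {V : VSet} {φ : ℕ → Vx} (g : Good E V) (fr5 : Free E V fivePat) where

    -- The vertices 0, 1, 5, 7, 3 of F₈ form a 5-cycle.
    eight-five : Emb E V eightPat φ → ⊥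
    eight-five e = fr5 _ (five-emb g (inV! {0} refl) (inV! {1} refl) (inV! {5} refl) (inV! {7} refl) (inV! {3} refl)
      (edge! 0 1 refl) (edge! 1 5 refl) (edge! 5 7 refl)
      (Good.symm⁺ g (edge! 3 7 refl)) (edge! 3 0 refl)
      (apart {0} {5} refl refl refl) (apart {0} {7} refl refl refl) (apart {1} {7} refl refl refl) (apart {1} {3} refl refl refl) (apart {5} {3} refl refl refl))
      where
      open Emb e

  -- Every edge of the eight-vertex graph is avoided by its 4-cycle or by one of its 5-cycles.
  girth-addE : ∀ {E V U p q} → Good E V → Free E V squarePat → Free E V fivePat → U ⊑ V → Free (addE E p q) U eightPat
  girth-addE {E} {V} {U} {p} {q} g fr4 fr5 U⊑V φ e = go (edge? 0 1 refl) (edge? 1 2 refl) (edge? 2 3 refl) (edge? 3 0 refl)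
    where
    open Emb e
    V! : ∀ {i} → (i <ᵇ 8) ≡ true → V (φ i) ≡ true
    V! h = U⊑V (inV (<ᵇ⁻ h))
    edge? : ∀ i j → edgeᵇ i j (proj₂ eightPat) ≡ true → E (φ i) (φ j) ≡ true ⊎ Joins p q (φ i) (φ j)
    edge? i j h = addE⁻ {E} {p} {q} {φ i} {φ j} (edge! i j h)
    old : ∀ {a b} → (a <ᵇ 8) ≡ true → (b <ᵇ 8) ≡ true → Joins p q (φ a) (φ b) → ∀ c d → edgeᵇ c d (proj₂ eightPat) ≡ true →
          (c <ᵇ 8) ≡ true → (d <ᵇ 8) ≡ true → sameEdgeᵇ a b c d ≡ false → E (φ c) (φ d) ≡ true
    old a b J c d m c< d< ne = old-edge {E} {U} {eightPat} e (<ᵇ⁻ a) (<ᵇ⁻ b) (<ᵇ⁻ c<) (<ᵇ⁻ d<) J (edge! c d m) ne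
    open Good g using (symm⁺)
    via3 : E (φ 2) (φ 3) ≡ true → E (φ 3) (φ 0) ≡ true → E (φ 0) (φ 4) ≡ true → E (φ 4) (φ 6) ≡ true → E (φ 2) (φ 6) ≡ true → ⊥
    via3 a b c d f = fr5 _ (five-emb g (V! {2} refl) (V! {3} refl) (V! {0} refl) (V! {4} refl) (V! {6} refl) a b c d (symm⁺ f)
      (apart {2} {0} refl refl refl) (apart {2} {4} refl refl refl) (apart {3} {4} refl refl refl) (apart {3} {6} refl refl refl) (apart {0} {6} refl refl refl))
    via1 : E (φ 0) (φ 1) ≡ true → E (φ 1) (φ 2) ≡ true → E (φ 0) (φ 4) ≡ true → E (φ 4) (φ 6) ≡ true → E (φ 2) (φ 6) ≡ true → ⊥
    via1 a b c d f = fr5 _ (five-emb g (V! {0} refl) (V! {1} refl) (V! {2} refl) (V! {6} refl) (V! {4} refl) a b f (symm⁺ d) (symm⁺ c)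
      (apart {0} {2} refl refl refl) (apart {0} {6} refl refl refl) (apart {1} {6} refl refl refl) (apart {1} {4} refl refl refl) (apart {2} {4} refl refl refl))
    go : E (φ 0) (φ 1) ≡ true ⊎ Joins p q (φ 0) (φ 1) → E (φ 1) (φ 2) ≡ true ⊎ Joins p q (φ 1) (φ 2) →
         E (φ 2) (φ 3) ≡ true ⊎ Joins p q (φ 2) (φ 3) → E (φ 3) (φ 0) ≡ true ⊎ Joins p q (φ 3) (φ 0) → ⊥
    go (inj₂ J) _ _ _ = let o = old {0} {1} refl refl J in via3 (o 2 3 refl refl refl refl) (o 3 0 refl refl refl refl) (o 0 4 refl refl refl refl) (o 4 6 refl refl refl refl) (o 2 6 refl refl refl refl)
    go _ (inj₂ J) _ _ = let o = old {1} {2} refl refl J in via3 (o 2 3 refl refl refl refl) (o 3 0 refl refl refl refl) (o 0 4 refl refl refl refl) (o 4 6 refl refl refl refl) (o 2 6 refl refl refl refl)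
    go _ _ (inj₂ J) _ = let o = old {2} {3} refl refl J in via1 (o 0 1 refl refl refl refl) (o 1 2 refl refl refl refl) (o 0 4 refl refl refl refl) (o 4 6 refl refl refl refl) (o 2 6 refl refl refl refl)
    go _ _ _ (inj₂ J) = let o = old {3} {0} refl refl J in via1 (o 0 1 refl refl refl refl) (o 1 2 refl refl refl refl) (o 0 4 refl refl refl refl) (o 4 6 refl refl refl refl) (o 2 6 refl refl refl refl)
    go (inj₁ a) (inj₁ b) (inj₁ c) (inj₁ d) = fr4 _ (square-emb {E} {V} (V! {0} refl) (V! {1} refl) (V! {2} refl) (V! {3} refl) a b c d
      (apart {0} {1} refl refl refl) (apart {0} {2} refl refl refl) (apart {0} {3} refl refl refl) (apart {1} {2} refl refl refl) (apart {1} {3} refl refl refl) (apart {2} {3} refl refl refl))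

  star₀ : ∀ {E V x} → V x ≡ true → deg E V x ≤ 0 → Valid E V (cfg 1 (0 ∷ []) []) (images (x ∷ []) x)
  star₀ {x = x} v d = listed-valid {xs = x ∷ []} {fin = 0 ∷ []} {es = []} {d = x} (record { inV = v ∷ [] ; uniq = [] ∷ [] ; edges = [] ; done = d ∷ [] }) refl refl

  star₁ : ∀ {E V x y} → Good E V → V x ≡ true → V y ≡ true → E x y ≡ true → deg E V x ≤ 1 →
          Valid E V (cfg 2 (0 ∷ []) ((0 , 1) ∷ [])) (images (x ∷ y ∷ []) x)
  star₁ {x = x} {y} g v w e d = listed-valid {xs = x ∷ y ∷ []} {fin = 0 ∷ []} {es = (0 , 1) ∷ []} {d = x}
    (record { inV = v ∷ w ∷ [] ; uniq = unique₂ (Good.adj≢ g e) ; edges = e ∷ [] ; done = d ∷ [] }) refl refl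

  star₂ : ∀ {E V x} → Good E V → V x ≡ true → 2 ≤ deg E V x → deg E V x ≤ 2 → ∃ λ φ → Valid E V (cfg 3 (0 ∷ []) ((0 , 1) ∷ (0 , 2) ∷ [])) φ
  star₂ {E} {V} {x} g v l d = _ , listed-valid {xs = x ∷ a ∷ b ∷ []} {fin = 0 ∷ []} {es = (0 , 1) ∷ (0 , 2) ∷ []} {d = x}
    (record { inV = v ∷ proj₁ (proj₂ A) ∷ proj₁ (proj₂ B) ∷ [] ; uniq = unique₃ (adj≢ xa) (adj≢ xb) (λ e → ∉-≢ (proj₂ (proj₂ (proj₂ B))) (sym e))
            ; edges = xa ∷ xb ∷ [] ; done = d ∷ [] }) refl refl
    where
    open Good g
    A = another-nb {E} {V} {x} [] (λ ()) (≤-trans (s≤s z≤n) l)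
    a = proj₁ A
    xa = proj₁ (proj₂ (proj₂ A))
    B = another-nb {E} {V} {x} {a ∷ []} ([] ∷ []) (λ { (here refl) → proj₁ (proj₂ A) , xa }) l
    b = proj₁ B
    xb = proj₁ (proj₂ (proj₂ B))

  eb-cut : ∀ {E V X} → Symm E → X ⊑ V → eb E V V + eb E X X ≡ eb E (V ∖ X) (V ∖ X) + 2 * eb E X V
  eb-cut {E} {V} {X} sy s = trans (cong (_+ eb E X X) (eb-split {E} sy spl)) (trans (lem (eb E (V ∖ X) (V ∖ X)) (eb E X X) (eb E X (V ∖ X)))
      (cong (λ z → eb E (V ∖ X) (V ∖ X) + 2 * z) (sym (eb-splitʳ {E} X spl))))
    where
    spl = split-∖ {V} {X} s
    lem : ∀ a b c → a + b + 2 * c + b ≡ a + 2 * (c + b)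
    lem = solve-∀

  module _ {m : ℕ} (ih : IH m) where
    open IH ih

    -- A vertex of degree at most 1 is chosen at once; otherwise looseness supplies a vertex of
    -- degree exactly 2, the root of `lowCert`.
    low-thm : ∀ {E V} → Good E V → card V ≤ m → Loose E V → Free E V eightPat → Val E V 0 0
    low-thm {E} {V} g c lo f8 with any? (λ x → (V x ≟ᵇ true) ×-dec (deg E V x ≤? 1))
    ... | yes (x , v , d) with deg E V x ≤? 0
    ...   | yes d0 = leaf-val {c = cfg 1 (0 ∷ []) []} {I = 0 ∷ []} {false} {0} {0} {0} g (λ ()) (λ _ → z≤n) (rest-low ih g c lo f8) (star₀ v d0) refl
    ...   | no nd with another-nb {E} {V} {x} [] (λ ()) (≰⇒> nd)
    ...     | y , w , e , _ = leaf-val {c = cfg 2 (0 ∷ []) ((0 , 1) ∷ [])} {I = 0 ∷ []} {false} {0} {0} {0} g (λ ()) (λ _ → z≤n) (rest-low ih g c lo f8) (star₁ g v w e d) refl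
    low-thm {E} {V} g c lo f8 | no ¬l with any? (λ x → V x ≟ᵇ true)
    ... | no ¬v = val-empty λ x → ¬true λ v → ¬v (x , v)
    ... | yes ne with lo V ne (λ v → v) (λ _ v _ → v)
    ...   | u , v , d = Soundness.sound (low-sem ih g c lo f8 (λ {x} w → ≰⇒> λ l → ¬l (x , w , l))) lowCert (proj₂ st) lowOK
      where st = star₂ {E} {V} {u} g v (≰⇒> λ l → ¬l (u , v , l)) d

  -- Girth at least 6

  module _ {m : ℕ} (ih : IH m) where
    open IH ih

    smaller : ∀ {V X x} → card V ≤ m → X ⊑ V → X x ≡ true → card (V ∖ X) < m
    smaller {V} {X} {x} c s h = ≤-trans (card-∖< {V} {X} {x} s h) c

    supp-card< : ∀ {V K : VSet} {a} → card K ≡ a + 2 → K ⊑ V → card V ≤ m → a < m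
    supp-card< {V} {K} {a} eq K⊑V c = ≤-trans (≤-trans (s≤s (m≤m+n a 1)) (≤-reflexive (trans (lem a) (sym eq)))) (≤-trans (card-mono K⊑V) c)
      where
      lem : ∀ a → suc (a + 1) ≡ a + 2
      lem = solve-∀

    -- The girth makes suppression legal: an edge p q would close a 4-cycle with s and t, and a
    -- common neighbour of p and q a 5-cycle.
    girth-pair : ∀ {E V s t p q} → Good E V → card V ≤ m → Loose E V → Free E V squarePat → Free E V fivePat →
                 ∀ k → k ≤ 6 → k + eb E V V ≤ 3 * card V → Pair E V s t p q → Val E V k 0
    girth-pair {E} {V} {s} {t} {p} {q} g c lo fr4 fr5 k k≤6 dk P = result (any? (λ u → (V⁻ u ≟ᵇ true) ×-dec (deg E V u ≤? 2)))
      where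
      open Pair P
      open Good g using (symm; symm⁺; adj≢)
      open Comp (component {E} V s symm s∈) renaming (conn to K-conn)
      fr8 : Free E V eightPat
      fr8 φ e = eight-five g fr5 e
      gK = good-⊑ g K⊑V
      t∈K = closed s∈K t∈ st
      PK : Pair E K s t p q
      PK = record { s∈ = s∈K ; t∈ = t∈K ; p∈ = closed s∈K p∈ sp ; q∈ = closed t∈K q∈ tq ; st = st ; sp = sp ; tq = tq
                  ; nbS = λ k e → nbS (K⊑V k) e ; nbT = λ k e → nbT (K⊑V k) e ; p≢t = p≢t ; q≢s = q≢s ; p≢q = p≢q }
      npq : E p q ≡ false
      npq = ¬true λ e → fr4 _ (square-emb {E} {V} s∈ t∈ q∈ p∈ st tq (symm⁺ e) (symm⁺ sp) (adj≢ st) (q≢s ∘ sym) (adj≢ sp) (adj≢ tq) (p≢t ∘ sym) (p≢q ∘ sym))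
      noc : ∀ {w} → K w ≡ true → E p w ≡ true → E q w ≡ true → ⊥
      noc {w} kw pw qw = fr5 _ (five-emb g s∈ t∈ q∈ (K⊑V kw) p∈ st tq qw (symm⁺ pw) (symm⁺ sp) (q≢s ∘ sym)
        (λ { refl → case qw }) (λ { refl → p≢t′ pw }) (p≢t ∘ sym) (p≢q ∘ sym))
        where
        case : E q s ≡ true → ⊥
        case e with nbS q∈ (symm⁺ e)
        ... | inj₁ h = adj≢ tq (sym h)
        ... | inj₂ h = p≢q (sym h)
        p≢t′ : E p t ≡ true → ⊥
        p≢t′ e with nbT p∈ (symm⁺ e)
        ... | inj₁ h = adj≢ sp (sym h)
        ... | inj₂ h = p≢q h
      module Su = Suppress gK PK npq noc
      open Su using (V⁻; E⁺)
      c⁻ : card V⁻ < m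
      c⁻ = supp-card< {V} {K} Su.card-supp K⊑V c
      conn⁻ : Conn E⁺ V⁻
      conn⁻ = Su.supp-conn K-conn
      deg⁻ : ∀ {u} → V⁻ u ≡ true → deg E⁺ V⁻ u ≡ deg E V u
      deg⁻ v = trans (Su.deg-supp v) (sym (closed-deg {E} {V} {K} K⊑V closed (Su.V⁻⊑V v)))
      vR : Val E (V ∖ K) 0 0
      vR = rest-low ih g c lo fr8 (s , s∈K) K⊑V
      result : Dec (∃ λ u → V⁻ u ≡ true × deg E V u ≤ 2) → Val E V k 0
      result (yes (u , v , d)) = val-weaken {a = k} {0} {6} {0} (≤-trans (≤-reflexive (+-identityʳ k)) k≤6)
        (val-union {E} {V} {K} {6} {0} {0} {0} symm K⊑V closed
          (Su.supp-val (low Su.good c⁻ (loose-low conn⁻ v (≤-trans (≤-reflexive (deg⁻ v)) d))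
            (girth-addE gK (free-⊑ {E} {K} {V} {squarePat} K⊑V fr4) (free-⊑ {E} {K} {V} {fivePat} K⊑V fr5) Su.V⁻⊑V))) vR)
      -- The suppressed component is cubic and may be exceptional, so only 6 - 4 = 2 is certain.
      result (no ¬u) with k ≤? 2
      ... | yes k≤2 = val-weaken {a = k} {0} {6} {4} (≤-trans (+-monoˡ-≤ 4 k≤2) ≤-refl)
        (val-union {E} {V} {K} {6} {4} {0} {0} symm K⊑V closed (Su.supp-val (conn₂ Su.good c⁻ conn⁻)) vR)
      -- The component of s has deficiency at most 2, so at least k - 2 lies in the rest, where the
      -- induction hypothesis applies.
      ... | no k≰2 = subst (λ z → Val E V z 0) (trans (+-comm 2 j) jk) (val-weaken {a = 2 + j} {0} {6 + j} {4}
            (≤-reflexive (lem6 j)) (val-union {E} {V} {K} {6} {4} {j} {0} symm K⊑V closed (Su.supp-val (conn₂ Su.good c⁻ conn⁻))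
          (girth (good-⊑ g (∖⊑ {V} {K})) (smaller c K⊑V s∈K) (loose-∖ {E} {V} {K} g K⊑V lo)
            (free-⊑ {E} {V ∖ K} {V} {squarePat} (∖⊑ {V} {K}) fr4) (free-⊑ {E} {V ∖ K} {V} {fivePat} (∖⊑ {V} {K}) fr5) j j≤6 dj)))
        where
        j = k ∸ 2
        jk : j + 2 ≡ k
        jk = m∸n+n≡m (≤-trans (m≤n+m _ 1) (≰⇒> k≰2))
        j≤6 : j ≤ 6
        j≤6 = ≤-trans (m∸n≤m k 2) k≤6
        lem6 : ∀ j → 2 + j + 4 ≡ 6 + j + 0
        lem6 = solve-∀
        eK : 3 * card K ≤ eb E K K + 2
        eK = subst₂ (λ a b → 3 * a ≤ b + 2) (sym Su.card-supp) (sym Su.eb-supp)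
          (lin 0 (eb-lower {E⁺} {V⁻} {V⁻} 3 λ {x} v → ≤-trans (≰⇒> λ d → ¬u (x , v , d)) (≤-reflexive (sym (deg⁻ v)))) (lem (card V⁻) (eb E⁺ V⁻ V⁻)))
          where
          lem : ∀ a e → 3 * (a + 2) + e + 0 ≡ e + 4 + 2 + a * 3
          lem = solve-∀
        dj : j + eb E (V ∖ K) (V ∖ K) ≤ 3 * card (V ∖ K)
        dj = lin 0 (+-mono-≤ (subst₂ (λ a b → a ≤ b) (cong₂ _+_ (sym jk) eV) (cong (3 *_) (card-split spl)) dk) eK)
               (lem j (eb E (V ∖ K) (V ∖ K)) (eb E K K) (card (V ∖ K)) (card K))
          where
          spl = split-∖ {V} {K} K⊑V
          eV : eb E V V ≡ eb E (V ∖ K) (V ∖ K) + eb E K K + 2 * 0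
          eV = trans (eb-split {E} symm spl) (cong (λ z → eb E (V ∖ K) (V ∖ K) + eb E K K + 2 * z) (closed-edges {E} {V} {K} closed))
          lem : ∀ j e f a b → j + e + (3 * (a + b) + (f + 2)) + 0 ≡ 3 * a + (j + 2 + (e + f + 2 * 0) + 3 * b)
          lem = solve-∀

    rest-girth : ∀ {E V X x} → Good E V → card V ≤ m → Loose E V → Free E V squarePat → Free E V fivePat → X ⊑ V → X x ≡ true →
                 ∀ j → j ≤ 6 → j + eb E (V ∖ X) (V ∖ X) ≤ 3 * card (V ∖ X) → Val E (V ∖ X) j 0
    rest-girth {E} {V} {X} g c lo fr4 fr5 s h j = girth (good-⊑ g (∖⊑ {V} {X})) (smaller c s h) (loose-∖ {E} {V} {X} g s lo)
      (free-⊑ {E} {V ∖ X} {V} {squarePat} (∖⊑ {V} {X}) fr4) (free-⊑ {E} {V ∖ X} {V} {fivePat} (∖⊑ {V} {X}) fr5) j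

    -- Deleting X = N[I] with 30 |I| ≤ 11 |X| and nonnegative gain does not decrease the total deficiency Σ (3 − deg).
    girth-sem : ∀ {E V} → Good E V → card V ≤ m → Loose E V → Free E V squarePat → Free E V fivePat →
                ∀ k → k ≤ 6 → k + eb E V V ≤ 3 * card V → (∀ {x} → V x ≡ true → 2 ≤ deg E V x) → Sem girthMode E V (Val E V k 0)
    girth-sem {E} {V} g c lo fr4 fr5 k k≤6 dk d2 = record { good = g ; c4free = λ () ; degs = d2
      ; killed = λ { (here refl) → fr4 ; (there (here refl)) → fr5 }
      ; ruled = λ { (here refl) φ e l → inj₁ (path φ e l) }
      ; leafed = λ c′ φ I v h → lf c′ φ I v (proj₁ (∧-true {gainᵇ false 2 0 0 c′ I} h)) (≤ᵇ⁻ (proj₂ (∧-true {gainᵇ false 2 0 0 c′ I} h)))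
      ; isoed = λ () }
      where
      open Good g using (symm)
      path : ∀ φ → Emb E V pathPat φ → (∀ {a} → a ∈ 0 ∷ 1 ∷ [] → a < 4 → deg E V (φ a) ≤ 2) → Val E V k 0
      path φ e l = girth-pair g c lo fr4 fr5 k k≤6 dk (pair-from g (inV! {0} refl) (inV! {1} refl) (inV! {2} refl) (inV! {3} refl)
          (edge! 0 1 refl) (edge! 0 2 refl) (edge! 1 3 refl)
          (l (here refl) (<ᵇ⁻ refl)) (l (there (here refl)) (<ᵇ⁻ refl)) (apart {2} {1} refl refl refl) (apart {3} {0} refl refl refl) (apart {2} {3} refl refl refl))
        where
        open Emb e
      lf : ∀ c′ φ I → Valid E V c′ φ → gainᵇ false 2 0 0 c′ I ≡ true → 30 * length I ≤ 11 * length (removed c′ I) → Val E V k 0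
      lf c′ φ I v h small = cut-val {E} {V} {Xs} {Is} {k} {0} {k} {0} symm (Removal.isCut R)
          (rest-girth {x = proj₁ (Removal.X-nonempty R)} g c lo fr4 fr5 X⊑V (proj₂ (Removal.X-nonempty R)) k k≤6 dk′)
          (lin 0 (proj₂ gc) (lem₁ (card Xs) (eb E Xs Xs) (card Is) (eb E Xs V) k))
        where
        Xs Is : VSet
        Xs = ⟪ map φ (removed c′ I) ⟫
        Is = ⟪ map φ I ⟫
        gc : Removal E V c′ φ I × 14 * card Xs + eb E Xs Xs + 0 ≤ 30 * card Is + 2 * eb E Xs V + 0
        gc = Leaf.gain-cut g v {I} {false} {2} {0} {0} h (λ ()) d2
        R : Removal E V c′ φ I
        R = proj₁ gc
        X⊑V : Xs ⊑ V
        X⊑V = Cut.X⊑V (Removal.isCut R)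
        lem₁ : ∀ x e i f k → 14 * x + e + (k + 0) + (30 * i + 2 * f + 0) + 0 ≡ 30 * i + 2 * f + (k + 0) + (14 * x + e + 0)
        lem₁ = solve-∀
        small′ : 30 * card Is ≤ 11 * card Xs
        small′ = subst₂ (λ a b → 30 * a ≤ 11 * b) (sym (Removal.card-I R)) (sym (Removal.card-X R)) small
        dk′ : k + eb E (V ∖ Xs) (V ∖ Xs) ≤ 3 * card (V ∖ Xs)
        dk′ = lin 0 (+-mono-≤ (subst (k + eb E V V ≤_) (cong (3 *_) (card-split (split-∖ {V} {Xs} X⊑V))) dk)
                (+-mono-≤ (proj₂ gc) (+-mono-≤ small′ (≤-reflexive (sym (eb-cut {E} {V} {Xs} symm X⊑V))))))
                (lem₂ k (eb E V V) (eb E (V ∖ Xs) (V ∖ Xs)) (card (V ∖ Xs)) (card Xs) (card Is) (eb E Xs Xs) (eb E Xs V))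
          where
          lem₂ : ∀ k v e a x i f g → k + e + (3 * (a + x) + (30 * i + 2 * g + 0 + (11 * x + (v + f)))) + 0
            ≡ 3 * a + (k + v + (14 * x + f + 0 + (30 * i + (e + 2 * g))))
          lem₂ = solve-∀

    girth-thm : ∀ {E V} → Good E V → card V ≤ m → Loose E V → Free E V squarePat → Free E V fivePat →
                ∀ k → k ≤ 6 → k + eb E V V ≤ 3 * card V → Val E V k 0
    girth-thm {E} {V} g c lo fr4 fr5 k k≤6 dk with any? (λ x → (V x ≟ᵇ true) ×-dec (deg E V x ≤? 1))
    girth-thm {E} {V} g c lo fr4 fr5 k k≤6 dk | yes (x , v , d) with deg E V x ≤? 0
    -- An isolated vertex alone gains 30 - 14 = 16, more than the largest k.
    ...   | yes d0 = val-weaken {a = k} {0} {16} {0} (≤-trans (≤-reflexive (+-identityʳ k)) (≤-trans k≤6 (m≤m+n 6 10)))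
            (leaf-val {c = cfg 1 (0 ∷ []) []} {I = 0 ∷ []} {false} {0} {16} {0} g (λ ()) (λ _ → z≤n)
              (rest-low ih g c lo (λ φ e → eight-five g fr5 e)) (star₀ v d0) refl)
    ...   | no nd with another-nb {E} {V} {x} [] (λ ()) (≰⇒> nd)
    ...     | y , w , e , _ with k ≤? 4
    ...       | yes k≤4 = val-weaken {a = k} {0} {4} {0} (≤-trans (≤-reflexive (+-identityʳ k)) k≤4)
                (leaf-val {c = cfg 2 (0 ∷ []) ((0 , 1) ∷ [])} {I = 0 ∷ []} {false} {0} {4} {0} g (λ ()) (λ _ → z≤n)
                  (rest-low ih g c lo (λ φ e → eight-five g fr5 e)) (star₁ g v w e d) refl)
    -- Choosing x gains at least 4, and removing x and y lowers the total deficiency by at most 4,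
    -- so the rest supplies k - 4.
    ...       | no k≰4 = subst (λ z → Val E V z 0) jk (cut-val {E} {V} {Xs} {Is} {j} {0} {j + 4} {0} symm (Removal.isCut R)
                  (rest-girth {x = proj₁ (Removal.X-nonempty R)} g c lo fr4 fr5 X⊑V (proj₂ (Removal.X-nonempty R)) j (≤-trans (m∸n≤m k 4) k≤6) dj)
                  (lin 0 gn (lem₁ (eb E Xs Xs) (eb E Xs V) (card Xs) (card Is) j)))
      where
      open Good g using (symm)
      j = k ∸ 4
      jk : j + 4 ≡ k
      jk = m∸n+n≡m (≤-trans (m≤n+m _ 1) (≰⇒> k≰4))
      c′ = cfg 2 (0 ∷ []) ((0 , 1) ∷ [])
      φ = images (x ∷ y ∷ []) x
      Xs Is : VSet
      Xs = ⟪ map φ (removed c′ (0 ∷ [])) ⟫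
      Is = ⟪ map φ (0 ∷ []) ⟫
      gc : Removal E V c′ φ (0 ∷ []) × 14 * card Xs + eb E Xs Xs + 4 ≤ 30 * card Is + 2 * eb E Xs V + 0
      gc = Leaf.gain-cut g (star₁ g v w e d) {0 ∷ []} {false} {0} {4} {0} refl (λ ()) (λ _ → z≤n)
      R : Removal E V c′ φ (0 ∷ [])
      R = proj₁ gc
      gn = proj₂ gc
      X⊑V : Xs ⊑ V
      X⊑V = Cut.X⊑V (Removal.isCut R)
      lem₁ : ∀ e f x i j → 14 * x + e + (j + 4 + 0) + (30 * i + 2 * f + 0) + 0 ≡ 30 * i + 2 * f + (j + 0) + (14 * x + e + 4)
      lem₁ = solve-∀
      cX : card Xs ≡ 2
      cX = Removal.card-X R
      cI : card Is ≡ 1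
      cI = Removal.card-I R
      dj : j + eb E (V ∖ Xs) (V ∖ Xs) ≤ 3 * card (V ∖ Xs)
      dj = lin 0 (+-mono-≤ (subst₂ _≤_ (cong (_+ eb E V V) (sym jk)) (cong (3 *_) (trans (card-split (split-∖ {V} {Xs} X⊑V)) (cong (card (V ∖ Xs) +_) cX))) dk)
              (+-mono-≤ (subst₂ (λ a b → 14 * a + eb E Xs Xs + 4 ≤ 30 * b + 2 * eb E Xs V + 0) cX cI gn) (≤-reflexive (sym (eb-cut {E} {V} {Xs} symm X⊑V)))))
              (lem₂ j (eb E V V) (eb E (V ∖ Xs) (V ∖ Xs)) (card (V ∖ Xs)) (eb E Xs Xs) (eb E Xs V))
        where
        lem₂ : ∀ j v e a f g → j + e + (3 * (a + 2) + (30 * 1 + 2 * g + 0 + (v + f))) + 0 ≡ 3 * a + (j + 4 + v + (14 * 2 + f + 4 + (e + 2 * g)))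
        lem₂ = solve-∀
    girth-thm {E} {V} g c lo fr4 fr5 k k≤6 dk | no ¬l with any? (λ x → V x ≟ᵇ true)
    ... | no ¬v = subst (λ z → Val E V z 0) (sym k≡0) (val-empty λ x → ¬true λ v → ¬v (x , v))
      where
      k≡0 : k ≡ 0
      k≡0 = n≤0⇒n≡0 (≤-trans (m≤m+n k _) (≤-trans dk (≤-reflexive (trans (cong (3 *_) (trans (card-cong {V} {⟪ [] ⟫} (λ x → ¬true λ v → ¬v (x , v))) (card-list []))) refl))))
    ... | yes ne with lo V ne (λ v → v) (λ _ v _ → v)
    ...   | u , v , d = Soundness.sound (girth-sem g c lo fr4 fr5 k k≤6 dk (λ {x} w → ≰⇒> λ l → ¬l (x , w , l))) girthCert (proj₂ st) girthOK
      where st = star₂ {E} {V} {u} g v (≰⇒> λ l → ¬l (u , v , l)) d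

  opaque
    unfolding eb
    eb-addE-∑ : ∀ {E V p q} → E p q ≡ false → E q p ≡ false → p ≢ q → V p ≡ true → V q ≡ true → eb (addE E p q) V V ≡ eb E V V + (ind (V p) + ind (V q))
    eb-addE-∑ {E} {V} {p} {q} npq nqp p≢q Vp Vq = begin
      ∑ (λ x → ind (V x) * deg (addE E p q) V x)
        ≡⟨ sum-cong-≗ (λ x → trans (cong (ind (V x) *_) (deg-addE {E} {V} {p} {q} {x} npq nqp p≢q Vp Vq)) (lem (ind (V x)) (deg E V x) (ind (does (x ≟ p))) (ind (does (x ≟ q))))) ⟩
      ∑ (λ x → ind (V x) * deg E V x + (ind (does (x ≟ p)) * ind (V x) + ind (does (x ≟ q)) * ind (V x)))
        ≡⟨ ∑-distrib-+ (λ x → ind (V x) * deg E V x) (λ x → ind (does (x ≟ p)) * ind (V x) + ind (does (x ≟ q)) * ind (V x)) ⟩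
      eb E V V + ∑ (λ x → ind (does (x ≟ p)) * ind (V x) + ind (does (x ≟ q)) * ind (V x))
        ≡⟨ cong (eb E V V +_) (trans (∑-distrib-+ (λ x → ind (does (x ≟ p)) * ind (V x)) (λ x → ind (does (x ≟ q)) * ind (V x)))
             (cong₂ _+_ (∑-δ p (ind ∘ V)) (∑-δ q (ind ∘ V)))) ⟩
      eb E V V + (ind (V p) + ind (V q)) ∎
      where
      open ≡-Reasoning
      lem : ∀ v d a b → v * (d + (a + b)) ≡ v * d + (a * v + b * v)
      lem = solve-∀
  eb-addE : ∀ {E V p q} → Symm E → E p q ≡ false → p ≢ q → V p ≡ true → V q ≡ true → eb (addE E p q) V V ≡ eb E V V + 2
  eb-addE {E} {V} {p} {q} sy npq p≢q Vp Vq = trans (eb-addE-∑ {E} {V} {p} {q} npq (trans (sy q p) npq) p≢q Vp Vq)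
    (cong₂ (λ a b → eb E V V + (ind a + ind b)) Vp Vq)

  -- Connected graphs containing the eight-vertex graph

  module Touch {m : ℕ} (ih : IH m) {E : Adj} {W : VSet} (g : Good E W) where
    open IH ih
    open Good g using (symm; symm⁺)

    Touches : VSet → VSet → Set
    Touches V X = ∀ U → Nonempty U → U ⊑ V → Closed E V U → Meets E U X

    -- Each component has value at least −2, which is paid by one of its edges to X.
    touch : ∀ {X} → X ⊑ W → ∀ n V → card V ≤ n → card V < m → V ⊑ W ∖ X → Touches V X → Val E V 0 (2 * eb E V X)
    touch {X} X⊑W zero V cn cm V⊑ t = val-weaken {c = 0} {d = 0} z≤n (val-empty λ x → ¬true λ v → <-irrefl refl (≤-trans (mem≤card {V} v) cn))
    touch {X} X⊑W (suc n) V cn cm V⊑ t with any? (λ x → V x ≟ᵇ true)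
    ... | no ¬v = val-weaken {c = 0} {d = 0} z≤n (val-empty λ x → ¬true λ v → ¬v (x , v))
    ... | yes (s , Vs) = val-weaken {E} {V} {0} {2 * eb E V X} {0} {2 + 2 * eb E (V ∖ K) X}
            (subst (λ z → 2 + 2 * eb E (V ∖ K) X ≤ 2 * z) (sym (eb-splitˡ {E} X (split-∖ {V} {K} K⊑V)))
              (lin 0 (*-mono-≤ (≤-refl {2}) pos) (lem (eb E (V ∖ K) X) (eb E K X))))
            (val-union {E} {V} {K} {0} {2} {0} {2 * eb E (V ∖ K) X} symm K⊑V closed vK vR)
      where
      open Comp (component {E} V s symm Vs) renaming (conn to K-conn)
      lem : ∀ a b → 2 + 2 * a + 2 * b + 0 ≡ 2 * (a + b) + 2 * 1
      lem = solve-∀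
      hit = t K (s , s∈K) K⊑V closed
      u = proj₁ hit
      Ku = proj₁ (proj₂ hit)
      x = proj₁ (proj₂ (proj₂ hit))
      Xx = proj₁ (proj₂ (proj₂ (proj₂ hit)))
      ux = proj₂ (proj₂ (proj₂ (proj₂ hit)))
      pos : 1 ≤ eb E K X
      pos = ≤-trans (deg-pos {E} {X} Xx ux) (eb-pos {E} {K} {X} Ku)
      K⊑W : K ⊑ W
      K⊑W k = ∖⊑ {W} {X} (V⊑ (K⊑V k))
      vK : Val E K 0 2
      -- The edge u x leaves K, so u has degree at most 2 in K and K is not exceptional.
      vK = conn-loose (good-⊑ g K⊑W) (≤-trans (s≤s (card-mono K⊑V)) cm) K-conn Ku
        (≤-pred (≤-trans (≤-trans (s≤s (deg-mono u (λ k → V⊑ (K⊑V k)))) (deg-drop {E} {W} {X} X⊑W Xx ux)) (Good.cub g (K⊑W Ku))))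
      c< : card (V ∖ K) < card V
      c< = card-∖< {V} {K} {s} K⊑V s∈K
      vR : Val E (V ∖ K) 0 (2 * eb E (V ∖ K) X)
      vR = touch X⊑W n (V ∖ K) (≤-pred (≤-trans c< cn)) (≤-trans (s≤s (≤-trans (m≤n+m _ 1) c<)) cm) (λ p → V⊑ (∖⊑ {V} {K} p))
        (λ U ne U⊑ cl → t U ne (λ p → ∖⊑ {V} {K} (U⊑ p)) (λ p v e → cl p (∖-intro {V} {K} v (¬true λ k →
          t≢f (closed k (∖⊑ {V} {K} (U⊑ p)) (symm⁺ e)) (∖-not {V} {K} (U⊑ p)))) e))

  module Eight {m : ℕ} (ih : IH m) {E : Adj} {V : VSet} (g : Good E V) (c : card V ≤ m) (co : Conn E V)
    {φ : ℕ → Vx} (e8 : Emb E V eightPat φ) where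
    open IH ih
    open Good g using (symm; symm⁺; irr; cub)
    open Touch ih g

    cfg8 : Cfg
    cfg8 = cfg 8 [] (proj₂ eightPat)

    v8 : Valid E V cfg8 φ
    v8 = emb-valid e8 refl

    open Local g v8
    open Valid v8 using (inV; inj; nb<k)

    lt8 : ∀ {i} → i ∈ upTo 8 → i < 8
    lt8 = ∈-upTo⁻

    opaque
      X : VSet
      X = ⟪ map φ (upTo 8) ⟫

      X⊑V : X ⊑ V
      X⊑V = image-⊑ lt8

      φ∈X : ∀ {i} → i < 8 → X (φ i) ≡ true
      φ∈X h = ⟪⟫⁺ (∈-map⁺ φ (∈-upTo⁺ h))

      X⁻ : ∀ {x} → X x ≡ true → ∃ λ j → j ∈ upTo 8 × x ≡ φ j
      X⁻ {x} h = ∈-map⁻ φ (⟪⟫⁻ {map φ (upTo 8)} {x} h)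

      cX : card X ≡ 8
      cX = card-list (mapped-unique lt8 (uniq⁻ refl))

      eXX : 20 ≤ eb E X X
      eXX = Leaf.known-bound g v8 {upTo 8} (mapped-unique lt8 (uniq⁻ refl))

    R : VSet
    R = V ∖ X

    R⊑V : R ⊑ V
    R⊑V = ∖⊑ {V} {X}

    spl : Split V R X
    spl = split-∖ {V} {X} X⊑V

    touches-R : ∀ {V₁} → V₁ ⊑ R → Closed E R V₁ → Touches V₁ X
    touches-R {V₁} s cl U ne U⊑ clU with meets? E U X
    ... | inj₁ h = h
    ... | inj₂ h = ⊥-elim (t≢f (φ∈X (s≤s z≤n)) (∖-not {V} {X} (s (U⊑ (co U ne (λ p → R⊑V (s (U⊑ p)))
            (closed-lift {E} {V} {X} h (λ p r e → clU p (cl (s′ p) r e) e)) (inV (s≤s z≤n)))))))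
      where
      s′ : ∀ {x} → U x ≡ true → V₁ x ≡ true
      s′ = U⊑

    R<m : card R < m
    R<m = ≤-trans (card-∖< {V} {X} {φ 0} X⊑V (φ∈X (s≤s z≤n))) c

    terminals : List ℕ
    terminals = 4 ∷ 5 ∷ 6 ∷ 7 ∷ []

    term<8 : ∀ {j} → j ∈ terminals → j < 8
    term<8 m = <ᵇ⁻ (allᵇ⁻ {f = _<ᵇ 8} {xs = terminals} refl m)

    inner-closed : ∀ {i} → i < 4 → isClosed cfg8 i ≡ true
    inner-closed {i} h = allᵇ⁻ {f = isClosed cfg8} {xs = upTo 4} refl (∈-upTo⁺ h)

    inner-nb : ∀ {i y} → i < 4 → V y ≡ true → E (φ i) y ≡ true → X y ≡ true
    inner-nb {i} i<4 Vy e = in-X (closed-sound (≤-trans i<4 (m≤m+n 4 4)) (inner-closed i<4) Vy e)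
      where
      in-X : ∀ {y} → (∃ λ j → j ∈ nb (proj₂ eightPat) i × y ≡ φ j) → X y ≡ true
      in-X (j , n , refl) = φ∈X (nb<k {i} n)

    -- A terminal already has two neighbours inside F₈, so at most one is left for R.
    only : ∀ {j p y} → j ∈ terminals → R p ≡ true → R y ≡ true → E (φ j) p ≡ true → E (φ j) y ≡ true → y ≡ p
    only {j} {p} {y} j∈ Rp Ry ep ey = decide (y ≟ p)
      where
      decide : Dec (y ≡ p) → y ≡ p
      decide (yes eq) = eq
      decide (no ne)  = ⊥-elim (<-irrefl refl (≤-trans (≤-trans (+-mono-≤ {2} two (one ne)) (≤-reflexive (+-comm (deg E X (φ j)) (deg E R (φ j)))))
           (≤-trans (≤-reflexive (sym (deg-split {E} (φ j) spl))) (cub (inV (term<8 j∈))))))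
        where
        one : y ≢ p → 2 ≤ deg E R (φ j)
        one ne = ≤-trans (card-⟨⟩≤ {y ∷ p ∷ []} {λ z → R z ∧ E (φ j) z} (unique₂ ne)
          (⟪⟫-⊑ {V = λ z → R z ∧ E (φ j) z} (∧-intro Ry ey ∷ ∧-intro Rp ep ∷ []))) (≤-reflexive (sym (deg-card E R (φ j))))
        two : 2 ≤ deg E X (φ j)
        two = ≤-trans (≤ᵇ⁻ {2} (allᵇ⁻ {f = λ j → 2 ≤ᵇ length (nb (proj₂ eightPat) j)} {xs = terminals} refl j∈))
          (≤-trans (≤-reflexive (sym (length-map φ (nb (proj₂ eightPat) j)))) (≤-trans (card-⟨⟩≤ {map φ (nb (proj₂ eightPat) j)} {λ z → X z ∧ E (φ j) z}
            (mapped-unique (λ n → nb<k {j} n) (uniq⁻ (allᵇ⁻ {f = λ j → uniqᵇ (nb (proj₂ eightPat) j)} {xs = terminals} refl j∈)))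
            (λ p → sub (∈-map⁻ φ (⟪⟫⁻ {map φ (nb (proj₂ eightPat) j)} p)))) (≤-reflexive (sym (deg-card E X (φ j))))))
          where
          sub : ∀ {z} → (∃ λ l → l ∈ nb (proj₂ eightPat) j × z ≡ φ l) → (X z ∧ E (φ j) z) ≡ true
          sub (l , n , refl) = ∧-intro (φ∈X (nb<k {j} n)) (Valid.edges′ v8 {j} {l} symm n)

    FreeTerm : VSet → Set
    FreeTerm S = ∃ λ j → j ∈ terminals × (∀ {y} → S y ≡ true → E (φ j) y ≡ false)

    -- The free terminal and a diagonal of the 4-cycle are chosen: 14 · 8 = 30 · 3 + 20 + 2, where
    -- 20 is twice the ten edges of F₈. Each edge between R and X adds 2 to the degree sum, which
    -- cancels the debt of the given value.
    add : (v : Val E R 0 (2 * eb E R X)) → FreeTerm (Val.S v) → Val E V 0 2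
    add (val S S⊑ iS bS) (j , j∈ , fr) = build (pick j∈)
      where
      nonadj : ∀ i l → i < 4 → l < 8 → elem l (nb (proj₂ eightPat) i) ≡ false → E (φ i) (φ l) ≡ false
      nonadj i l h k f = ¬true λ e → t≢f (closed-nb (≤-trans h (m≤m+n 4 4)) k (inner-closed h) e) f
      Triple : Set
      Triple = ∃ λ b → ∃ λ d → b < 4 × d < 4 × E (φ b) (φ j) ≡ false × E (φ d) (φ j) ≡ false × E (φ b) (φ d) ≡ false × (b ≡ᵇ d) ≡ false × 4 ≤ j
      triple : ∀ b d → b < 4 → d < 4 → elem j (nb (proj₂ eightPat) b) ≡ false → elem j (nb (proj₂ eightPat) d) ≡ false →
               elem d (nb (proj₂ eightPat) b) ≡ false → (b ≡ᵇ d) ≡ false → 4 ≤ j → Triple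
      triple b d b< d< x y z n l = b , d , b< , d< , nonadj b j b< (term<8 j∈) x , nonadj d j d< (term<8 j∈) y , nonadj b d b< (≤-trans d< (m≤m+n 4 4)) z , n , l
      -- Of the two diagonals of the 4-cycle, the one that avoids the neighbour of the terminal.
      pick : j ∈ terminals → Triple
      pick (here refl) = triple 1 3 (<ᵇ⁻ refl) (<ᵇ⁻ refl) refl refl refl refl (≤ᵇ⁻ refl)
      pick (there (here refl)) = triple 0 2 (<ᵇ⁻ refl) (<ᵇ⁻ refl) refl refl refl refl (≤ᵇ⁻ refl)
      pick (there (there (here refl))) = triple 1 3 (<ᵇ⁻ refl) (<ᵇ⁻ refl) refl refl refl refl (≤ᵇ⁻ refl)
      pick (there (there (there (here refl)))) = triple 0 2 (<ᵇ⁻ refl) (<ᵇ⁻ refl) refl refl refl refl (≤ᵇ⁻ refl)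
      build : Triple → Val E V 0 2
      build (b , d , b<4 , d<4 , njb , njd , nbd , b≢d , 4≤j) = val (S ∪ I) sub ind′ bound
        where
        j<8 = term<8 j∈
        b<8 = ≤-trans b<4 (m≤m+n 4 4)
        d<8 = ≤-trans d<4 (m≤m+n 4 4)
        js : List ℕ
        js = j ∷ b ∷ d ∷ []
        I : VSet
        I = ⟪ map φ js ⟫
        ne : ∀ {i l} → i < 8 → l < 8 → (i ≡ᵇ l) ≡ false → φ i ≢ φ l
        ne {i} h k f eq = t≢f (subst (λ z → (i ≡ᵇ z) ≡ true) (inj h k eq) (≡ᵇ-refl i)) f
        far : ∀ {i} → i < 4 → (j ≡ᵇ i) ≡ false
        far {i} h = ≡ᵇ-≢ {j} {i} λ { refl → <-irrefl refl (≤-trans h 4≤j) }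
        uI : Unique (map φ js)
        uI = unique₃ (ne j<8 b<8 (far b<4)) (ne j<8 d<8 (far d<4)) (ne b<8 d<8 b≢d)
        I⊑X : I ⊑ X
        I⊑X = ⟪⟫-⊑ {V = X} (φ∈X j<8 ∷ φ∈X b<8 ∷ φ∈X d<8 ∷ [])
        dis : ∀ {x} → S x ≡ true → I x ≡ true → ⊥
        dis s i = t≢f (I⊑X i) (∖-not {V} {X} (S⊑ s))
        sub : S ∪ I ⊑ V
        sub {x} p with S x in sx
        ... | true  = R⊑V (S⊑ sx)
        ... | false = X⊑V (I⊑X p)
        inner : ∀ {i y} → i < 4 → S y ≡ true → E (φ i) y ≡ false
        inner h s = ¬true λ e → t≢f (inner-nb h (R⊑V (S⊑ s)) e) (∖-not {V} {X} (S⊑ s))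
        cross : ∀ {x y} → x ∈ map φ js → S y ≡ true → E x y ≡ false
        cross (here refl) s = fr s
        cross (there (here refl)) s = inner b<4 s
        cross (there (there (here refl))) s = inner d<4 s
        indI : ∀ {x y} → x ∈ map φ js → y ∈ map φ js → E x y ≡ false
        indI (here refl) (here refl) = irr _
        indI (here refl) (there (here refl)) = trans (symm _ _) njb
        indI (here refl) (there (there (here refl))) = trans (symm _ _) njd
        indI (there (here refl)) (here refl) = njb
        indI (there (here refl)) (there (here refl)) = irr _
        indI (there (here refl)) (there (there (here refl))) = nbd
        indI (there (there (here refl))) (here refl) = njd
        indI (there (there (here refl))) (there (here refl)) = trans (symm _ _) nbd
        indI (there (there (here refl))) (there (there (here refl))) = irr _
        ind′ : Indep E (S ∪ I)
        ind′ {x} {y} p q with S x in sx | S y in sy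
        ... | true  | true  = iS sx sy
        ... | true  | false = trans (symm x y) (cross (⟪⟫⁻ {map φ js} q) sx)
        ... | false | true  = cross (⟪⟫⁻ {map φ js} p) sy
        ... | false | false = indI (⟪⟫⁻ {map φ js} p) (⟪⟫⁻ {map φ js} q)
        bound : 14 * card V + 0 ≤ 30 * card (S ∪ I) + (eb E V V + 2)
        bound = subst₂ _≤_ (cong (λ z → 14 * z + 0) (sym (trans (card-split spl) (cong (card R +_) cX))))
          (cong₂ (λ a b → 30 * a + (b + 2)) (sym (trans (card-split (split-∪ {S} {I} dis)) (cong (card S +_) (card-list uI))))
            (sym (trans (eb-split {E} symm spl) (cong (λ z → eb E R R + eb E X X + 2 * z) (eb-comm X R symm)))))
          (lin 0 (+-mono-≤ bS eXX) (lem (card R) (card S) (eb E R R) (eb E R X) (eb E X X)))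
          where
          lem : ∀ r s e t x → 14 * (r + 8) + 0 + (30 * s + (e + 2 * t) + x) + 0 ≡ 30 * (s + 3) + (e + x + 2 * t + 2) + (14 * r + 0 + 20)
          lem = solve-∀

    -- The terminal must also have no neighbour in the other part of R, so that any set on that side
    -- can be combined with this one.
    FreeVal : VSet → ℕ → Set
    FreeVal V₁ b = Σ (Val E V₁ 0 b) λ v → ∃ λ j → j ∈ terminals ×
      (∀ {y} → Val.S v y ≡ true → E (φ j) y ≡ false) × (∀ {y} → (R ∖ V₁) y ≡ true → E (φ j) y ≡ false)

    -- p is the only neighbour of the terminal in R, so a set avoiding p leaves the terminal free.
    -- Two sets compete: S from `V₁`, and `T₁` from `V₁` without p, where p counts as part of the
    -- deleted set.
    module Half {V₁ : VSet} (V₁⊑R : V₁ ⊑ R) (cl : Closed E R V₁) {p : Vx} (V₁p : V₁ p ≡ true) {j : ℕ} (j<8 : j < 8)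
      (px : E p (φ j) ≡ true) where

      Xx : X (φ j) ≡ true
      Xx = φ∈X j<8

      V₁<m : card V₁ < m
      V₁<m = ≤-trans (s≤s (card-mono V₁⊑R)) R<m
      v₁ : Val E V₁ 0 (2 * eb E V₁ X)
      v₁ = touch {X} X⊑V (card V₁) V₁ ≤-refl V₁<m V₁⊑R (touches-R V₁⊑R cl)
      open Val v₁
      j∈ : j ∈ terminals
      j∈ = term (j <? 4)
        where
        up : ∀ {j} → j < 8 → ¬ (j < 4) → j ∈ terminals
        up {0} _ n = ⊥-elim (n (<ᵇ⁻ refl))
        up {1} _ n = ⊥-elim (n (<ᵇ⁻ refl))
        up {2} _ n = ⊥-elim (n (<ᵇ⁻ refl))
        up {3} _ n = ⊥-elim (n (<ᵇ⁻ refl))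
        up {4} _ _ = here refl
        up {5} _ _ = there (here refl)
        up {6} _ _ = there (there (here refl))
        up {7} _ _ = there (there (there (here refl)))
        up {suc (suc (suc (suc (suc (suc (suc (suc i)))))))} h _ = ⊥-elim (<⇒<ᵇ h)
        term : Dec (j < 4) → j ∈ terminals
        term (yes h) = ⊥-elim (t≢f (inner-nb h (R⊑V (V₁⊑R V₁p)) (symm⁺ px)) (∖-not {V} {X} (V₁⊑R V₁p)))
        term (no h)  = up j<8 h
      off : ∀ {y} → R y ≡ true → y ≢ p → E (φ j) y ≡ false
      off Ry ne = ¬true λ e → ne (only j∈ (V₁⊑R V₁p) Ry (symm⁺ px) e)
      outside : ∀ {y} → (R ∖ V₁) y ≡ true → E (φ j) y ≡ false
      outside h = off (∖⊑ {R} {V₁} h) λ { refl → t≢f V₁p (∖-not {R} {V₁} h) }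
      freeing : ∀ {T₁} → T₁ ⊑ V₁ → T₁ p ≡ false → ∀ {y} → T₁ y ≡ true → E (φ j) y ≡ false
      freeing s np t = off (V₁⊑R (s t)) λ { refl → t≢f t np }
      P W X′ : VSet
      P = ⟪ p ∷ [] ⟫
      W = V₁ ∖ P
      X′ = X ∪ P
      only-p : ∀ {y} → P y ≡ true → y ≡ p
      only-p {y} = ⟪⟫-single {p} {y}
      Pp : P p ≡ true
      Pp = ⟪⟫⁺ {p ∷ []} (here refl)
      P⊑V₁ : P ⊑ V₁
      P⊑V₁ {y} h = subst (λ z → V₁ z ≡ true) (sym (only-p {y} h)) V₁p
      splW : Split V₁ W P
      splW = split-∖ {V₁} {P} P⊑V₁
      Xp : X p ≡ false
      Xp = ∖-not {V} {X} (V₁⊑R V₁p)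
      splX : Split X′ X P
      splX = split-∪ {X} {P} λ {y} a b → t≢f (subst (λ z → X z ≡ true) (only-p {y} b) a) Xp
      W⊑ : W ⊑ V ∖ X′
      W⊑ {y} h = ∖-intro {V} {X′} (R⊑V (V₁⊑R (∖⊑ {V₁} {P} h))) (or (∖-not {V} {X} (V₁⊑R (∖⊑ {V₁} {P} h))) (∖-not {V₁} {P} h))
        where
        or : ∀ {a b} → a ≡ false → b ≡ false → (a ∨ b) ≡ false
        or refl refl = refl
      X′⊑V : X′ ⊑ V
      X′⊑V {y} h = case (∨-case {X y} h)
        where
        case : X y ≡ true ⊎ P y ≡ true → V y ≡ true
        case (inj₁ xy) = X⊑V xy
        case (inj₂ py) = subst (λ z → V z ≡ true) (sym (only-p {y} py)) (R⊑V (V₁⊑R V₁p))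
      touches-W : Touches W X′
      touches-W U ne U⊑ clU = from (meets? E U X′)
        where
        absurd : Apart E U X′ →
                 Meets E U X → ⊥
        absurd h (u , Uu , z , Xz , uz) = h Uu (∨-left Xz) uz
        from : Meets E U X′ ⊎ Apart E U X′ →
               Meets E U X′
        from (inj₁ h) = h
        from (inj₂ h) = ⊥-elim (absurd h (touches-R V₁⊑R cl U ne (λ q → ∖⊑ {V₁} {P} (U⊑ q))
          (closed-lift {E} {V₁} {P} {U} (λ {u} {x} a b e → h a (∨-right {X x} b) e) clU)))
      vW : Val E W 0 (2 * eb E W X′)
      vW = touch {X′} X′⊑V (card W) W ≤-refl (≤-trans (s≤s (card-mono (∖⊑ {V₁} {P}))) V₁<m) W⊑ touches-W
      T₁ : VSet
      T₁ = Val.S vW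
      T₁⊑V₁ : T₁ ⊑ V₁
      T₁⊑V₁ t = ∖⊑ {V₁} {P} (Val.S⊑V vW t)
      T₁p : T₁ p ≡ false
      T₁p = ¬true λ t → t≢f Pp (∖-not {V₁} {P} (Val.S⊑V vW t))
      ePP : eb E P P ≡ 0
      ePP = eb-zero {E} {P} {P} λ {x} {y} a b e → t≢f (subst₂ (λ a b → E a b ≡ true) (only-p {x} a) (only-p {y} b) e) (irr p)
      eV₁ : eb E V₁ V₁ ≡ eb E W W + 0 + 2 * eb E P W
      eV₁ = trans (eb-split {E} symm splW) (cong (λ z → eb E W W + z + 2 * eb E P W) ePP)
      eWX′ : eb E W X′ ≡ eb E W X + eb E P W
      eWX′ = trans (eb-splitʳ {E} W splX) (cong (eb E W X +_) (eb-comm W P symm))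
      ePX : 1 ≤ eb E P X
      ePX = ≤-trans (deg-pos {E} {X} Xx px) (eb-pos {E} {P} {X} Pp)
      eV₁X : eb E V₁ X ≡ eb E W X + eb E P X
      eV₁X = eb-splitˡ {E} X splW
      cV₁ : card V₁ ≡ card W + 1
      cV₁ = trans (card-split splW) (cong (card W +_) (card-list {p ∷ []} ([] ∷ [])))
      -- Beyond the bound for `T₁` there are 30 for the larger set, -14 for the vertex p and 2 for
      -- an edge from p to X: 18 in total.
      strong : card T₁ < card S → 14 * card V₁ + 18 ≤ 30 * card S + (eb E V₁ V₁ + 2 * eb E V₁ X)
      strong lt = subst₂ (λ a b → 14 * a + 18 ≤ 30 * card S + (b + 2 * eb E V₁ X)) (sym cV₁) (sym eV₁)
        (subst (λ z → 14 * (card W + 1) + 18 ≤ 30 * card S + (eb E W W + 0 + 2 * eb E P W + 2 * z)) (sym eV₁X)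
          (lin 0 (+-mono-≤ (subst (λ z → 14 * card W + 0 ≤ 30 * card T₁ + (eb E W W + 2 * z)) eWX′ (Val.bound vW)) (+-mono-≤ (*-mono-≤ (≤-refl {30}) lt) (*-mono-≤ (≤-refl {2}) ePX)))
            (lem (card W) (card T₁) (card S) (eb E W W) (eb E P W) (eb E W X) (eb E P X))))
        where
        lem : ∀ w t s e f g h → 14 * (w + 1) + 18 + (30 * t + (e + 2 * (g + f)) + (30 * s + 2 * h)) + 0
          ≡ 30 * s + (e + 0 + 2 * f + 2 * (g + h)) + (14 * w + 0 + (30 * (1 + t) + 2 * 1))
        lem = solve-∀
      Result : Set
      Result = FreeVal V₁ (2 * eb E V₁ X) ⊎ (Val E V₁ 18 (2 * eb E V₁ X) × FreeVal V₁ (2 * eb E V₁ X + 12))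
      decide : ∀ b → S p ≡ b → Result
      decide false np = inj₁ (v₁ , j , j∈ , freeing S⊑V np , outside)
      decide true Sp = compare (card T₁ <? card S)
        where
        compare : Dec (card T₁ < card S) → Result
        compare (no ge) = inj₁ (val T₁ T₁⊑V₁ (Val.indep vW) (≤-trans bound (+-monoˡ-≤ _ (*-mono-≤ (≤-refl {30}) (≮⇒≥ ge)))) , j , j∈ , freeing T₁⊑V₁ T₁p , outside)
        -- Omitting p from S costs 30, of which 18 are covered, so the debt is 12.
        compare (yes lt) = inj₂ (val S S⊑V indep (strong lt) , val (S ∖ P) (λ h → S⊑V (∖⊑ {S} {P} h)) (λ a b → indep (∖⊑ {S} {P} a) (∖⊑ {S} {P} b)) weak
                     , j , j∈ , freeing (λ h → S⊑V (∖⊑ {S} {P} h)) notp , outside)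
          where
          notp : (S ∖ P) p ≡ false
          notp = ¬true λ h → t≢f Pp (∖-not {S} {P} h)
          cS : card S ≡ card (S ∖ P) + 1
          cS = trans (card-split (split-∖ {S} {P} λ {y} h → subst (λ z → S z ≡ true) (sym (only-p {y} h)) Sp)) (cong (card (S ∖ P) +_) (card-list {p ∷ []} ([] ∷ [])))
          weak : 14 * card V₁ + 0 ≤ 30 * card (S ∖ P) + (eb E V₁ V₁ + (2 * eb E V₁ X + 12))
          weak = lin 0 (subst (λ z → 14 * card V₁ + 18 ≤ 30 * z + (eb E V₁ V₁ + 2 * eb E V₁ X)) cS (strong lt))
                   (lem (card V₁) (card (S ∖ P)) (eb E V₁ V₁) (2 * eb E V₁ X))
            where
            lem : ∀ v s e f → 14 * v + 0 + (30 * (s + 1) + (e + f)) + 0 ≡ 30 * s + (e + (f + 12)) + (14 * v + 18)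
            lem = solve-∀

      result : Result
      result = decide (S p) refl

    -- One side of a disconnected R: either its set leaves a terminal free, or it has much to spare.
    half : ∀ {V₁} → V₁ ⊑ R → Closed E R V₁ → Nonempty V₁ →
           FreeVal V₁ (2 * eb E V₁ X) ⊎ (Val E V₁ 18 (2 * eb E V₁ X) × FreeVal V₁ (2 * eb E V₁ X + 12))
    half {V₁} V₁⊑R cl ne = from (touches-R V₁⊑R cl V₁ ne (λ p → p) (λ _ v _ → v))
      where
      from : Meets E V₁ X →
             FreeVal V₁ (2 * eb E V₁ X) ⊎ (Val E V₁ 18 (2 * eb E V₁ X) × FreeVal V₁ (2 * eb E V₁ X + 12))
      from (p , V₁p , x , Xx , px) = locate (X⁻ Xx)
        where
        locate : (∃ λ j → j ∈ upTo 8 × x ≡ φ j) → FreeVal V₁ (2 * eb E V₁ X) ⊎ (Val E V₁ 18 (2 * eb E V₁ X) × FreeVal V₁ (2 * eb E V₁ X + 12))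
        locate (j , jm , eq) = Half.result V₁⊑R cl V₁p (lt8 jm) (subst (λ z → E p z ≡ true) eq px)

  module EightRules {m : ℕ} (ih : IH m) {E : Adj} {V : VSet} (g : Good E V) (c : card V ≤ m) (co : Conn E V)
    {φ : ℕ → Vx} (e8 : Emb E V eightPat φ) where
    open IH ih
    open Good g using (symm; symm⁺; irr; cub)
    open Touch ih g
    open Eight ih g c co e8

    touch-R : Val E R 0 (2 * eb E R X)
    touch-R = touch {X} X⊑V (card R) R ≤-refl R<m (λ r → r) (touches-R (λ r → r) (λ _ r _ → r))

    disconnected : ∀ {U} → Proper E R U → Val E V 0 2
    disconnected {U} (ne , U⊑ , clU , (w , Rw , Uw)) = finish (half {U} (λ {x} → U⊑ x) cl₁ ne) (half {R ∖ U} (∖⊑ {R} {U}) cl₂ (w , ∖-intro {R} {U} Rw Uw))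
      where
      cl₁ : Closed E R U
      cl₁ {x} {y} = clU x y
      cl₂ : Closed E R (R ∖ U)
      cl₂ {x} {y} p r e = ∖-intro {R} {U} r (¬true λ u → t≢f (clU y x u (∖⊑ {R} {U} p) (symm⁺ e)) (∖-not {R} {U} p))
      e₁ e₂ : ℕ
      e₁ = eb E U X
      e₂ = eb E (R ∖ U) X
      et : eb E R X ≡ e₂ + e₁
      et = eb-splitˡ {E} X (split-∖ {R} {U} (λ {x} → U⊑ x))
      join : ∀ {a b a′ b′} → (v₁ : Val E U a (2 * e₁ + b)) (v₂ : Val E (R ∖ U) a′ (2 * e₂ + b′)) → b + b′ ≤ a + a′ →
             (∃ λ j → j ∈ terminals × (∀ {y} → Val.S v₁ y ≡ true → E (φ j) y ≡ false) × (∀ {y} → Val.S v₂ y ≡ true → E (φ j) y ≡ false)) → Val E V 0 2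
      join {a} {b} {a′} {b′} v₁ v₂ le (j , j∈ , f₁ , f₂) = add
        (val-weaken {E} {R} {0} {2 * eb E R X} {a + a′} {2 * e₁ + b + (2 * e₂ + b′)}
          (subst (λ z → 2 * e₁ + b + (2 * e₂ + b′) ≤ a + a′ + 2 * z) (sym et) (lin 0 le (lem e₁ e₂ a b a′ b′)))
          (val-union {E} {R} {U} symm (λ {x} → U⊑ x) cl₁ v₁ v₂)) (j , j∈ , λ {y} s → pick (∨-case {Val.S v₂ y} s))
        where
        lem : ∀ x y a b c d → 2 * x + b + (2 * y + d) + (a + c) + 0 ≡ a + c + 2 * (y + x) + (b + d)
        lem = solve-∀
        pick : ∀ {y} → Val.S v₂ y ≡ true ⊎ Val.S v₁ y ≡ true → E (φ j) y ≡ false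
        pick (inj₁ s) = f₂ s
        pick (inj₂ s) = f₁ s
      pad : ∀ {W a k} → Val E W a k → Val E W a (k + 0)
      pad {W} {a} {k} v = subst (Val E W a) (sym (+-identityʳ k)) v
      in₁ : ∀ {y} → U y ≡ true → (R ∖ (R ∖ U)) y ≡ true
      in₁ {y} u = ∖-intro {R} {R ∖ U} (U⊑ y u) (¬true λ h → t≢f u (∖-not {R} {U} h))
      first : ∀ {b a′} → FreeVal U (2 * e₁ + b) → Val E (R ∖ U) a′ (2 * e₂) → b ≤ a′ → Val E V 0 2
      first {b} {a′} (v₁ , j , j∈ , f , o) v₂ le = join {0} {b} {a′} {0} v₁ v₂′ (≤-trans (≤-reflexive (+-identityʳ b)) le) (j , j∈ , f , λ s → o (Val.S⊑V v₂′ s))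
        where v₂′ = pad v₂
      second : ∀ {b a} → Val E U a (2 * e₁) → FreeVal (R ∖ U) (2 * e₂ + b) → b ≤ a → Val E V 0 2
      second {b} {a} v₁ (v₂ , j , j∈ , f , o) le = join {a} {0} {0} {b} v₁′ v₂ (≤-trans le (m≤m+n a 0)) (j , j∈ , (λ s → o (in₁ (Val.S⊑V v₁′ s))) , f)
        where v₁′ = pad v₁
      free+0 : ∀ {W k} → FreeVal W k → FreeVal W (k + 0)
      free+0 {W} {k} f = subst (FreeVal W) (sym (+-identityʳ k)) f
      finish : FreeVal U (2 * e₁) ⊎ (Val E U 18 (2 * e₁) × FreeVal U (2 * e₁ + 12)) →
               FreeVal (R ∖ U) (2 * e₂) ⊎ (Val E (R ∖ U) 18 (2 * e₂) × FreeVal (R ∖ U) (2 * e₂ + 12)) → Val E V 0 2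
      finish (inj₁ f₁) (inj₁ (v₂ , _)) = first {0} {0} (free+0 f₁) v₂ z≤n
      finish (inj₁ f₁) (inj₂ (v₂ , _)) = first {0} {18} (free+0 f₁) v₂ z≤n
      finish (inj₂ (v₁ , f₁)) (inj₁ f₂) = second {0} {18} v₁ (free+0 f₂) z≤n
      -- Neither side is known to free a terminal at no cost; the 18 to spare on one side pay the 12
      -- on the other.
      finish (inj₂ (v₁ , f₁)) (inj₂ (v₂ , f₂)) = first {12} {18} f₁ v₂ (m≤m+n 12 6)

    hasOut : ∀ j → Dec (∃ λ y → R y ≡ true × E (φ j) y ≡ true)
    hasOut j = any? (λ y → (R y ≟ᵇ true) ×-dec (E (φ j) y ≟ᵇ true))

    -- A set missing p or q leaves a terminal free, which is all that `add` asks for. If R is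
    -- connected and every terminal has a neighbour in R, an added edge p q enforces this; only a
    -- common neighbour of p and q in R forbids the edge, as it would create a triangle.
    pair-rule : ∀ {j₁ j₂ p q} → j₁ ∈ terminals → j₂ ∈ terminals → R p ≡ true → R q ≡ true → E (φ j₁) p ≡ true → E (φ j₂) q ≡ true →
                p ≢ q → Val E V 0 2 ⊎ CommonNb E V p q
    pair-rule {j₁} {j₂} {p} {q} j₁∈ j₂∈ Rp Rq ep eq p≢q = step₁ (All.all? hasOut terminals)
      where
      Goal : Set
      Goal = Val E V 0 2 ⊎ CommonNb E V p q
      miss : (v : Val E R 0 (2 * eb E R X)) → Val.S v p ≡ false ⊎ Val.S v q ≡ false → Val E V 0 2
      miss v (inj₁ np) = add v (j₁ , j₁∈ , λ s → ¬true λ e → t≢f (subst (λ z → Val.S v z ≡ true) (only j₁∈ Rp (Val.S⊑V v s) ep e) s) np)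
      miss v (inj₂ nq) = add v (j₂ , j₂∈ , λ s → ¬true λ e → t≢f (subst (λ z → Val.S v z ≡ true) (only j₂∈ Rq (Val.S⊑V v s) eq e) s) nq)
      not-both : ∀ {S : VSet} → (S p ≡ true → S q ≡ true → ⊥) → S p ≡ false ⊎ S q ≡ false
      not-both {S} h = case (bool? (S p))
        where
        case : S p ≡ true ⊎ S p ≡ false → S p ≡ false ⊎ S q ≡ false
        case (inj₁ t) = inj₂ (¬true (h t))
        case (inj₂ f) = inj₁ f
      someFree : ∀ js → (∀ {j} → j ∈ js → j ∈ terminals) → ¬ All (λ j → ∃ λ y → R y ≡ true × E (φ j) y ≡ true) js → ∃ λ j → j ∈ terminals × ¬ (∃ λ y → R y ≡ true × E (φ j) y ≡ true)
      someFree [] s h = ⊥-elim (h [])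
      someFree (j ∷ js) s h = case (hasOut j)
        where
        case : Dec (∃ λ y → R y ≡ true × E (φ j) y ≡ true) → ∃ λ j → j ∈ terminals × ¬ (∃ λ y → R y ≡ true × E (φ j) y ≡ true)
        case (no n) = j , s (here refl) , n
        case (yes o) = someFree js (s ∘ there) λ a → h (o ∷ a)
      step₃ : Conn E R → All (λ j → ∃ λ y → R y ≡ true × E (φ j) y ≡ true) terminals → Goal
      step₃ coR outs = adjacent (bool? (E p q))
        where
        three : 3 ≤ eb E R X
        three = ≤-trans (≤-trans (m≤n+m 3 1) four) (≤-trans (≤-reflexive (sym (eb-list {E} R u4))) sub)
          where
          ts : List Vx
          ts = map φ terminals
          u4 : Unique ts
          u4 = Local.mapped-unique g v8 term<8 (uniq⁻ refl)
          four : 4 ≤ sumL (map (deg E R) ts)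
          four = +-mono-≤ {1} (one (here refl)) (+-mono-≤ {1} (one (there (here refl))) (+-mono-≤ {1} (one (there (there (here refl)))) (+-mono-≤ {1} {_} {0} {0} (one (there (there (there (here refl))))) z≤n)))
            where
            one : ∀ {j} → j ∈ terminals → 1 ≤ deg E R (φ j)
            one m = let o = All.lookup outs m in deg-pos {E} {R} (proj₁ (proj₂ o)) (proj₂ (proj₂ o))
          ts⊑X : ⟪ ts ⟫ ⊑ X
          ts⊑X {x} h = let w = ∈-map⁻ φ {xs = terminals} (⟪⟫⁻ {ts} {x} h) in
            subst (λ z → X z ≡ true) (sym (proj₂ (proj₂ w))) (φ∈X (term<8 (proj₁ (proj₂ w))))
          sub : eb E ⟪ ts ⟫ R ≤ eb E R X
          sub = ≤-trans (≤-trans (m≤n+m _ (eb E (X ∖ ⟪ ts ⟫) R)) (≤-reflexive (sym (eb-splitˡ {E} R (split-∖ {X} {⟪ ts ⟫} ts⊑X))))) (≤-reflexive (eb-comm X R symm))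
        adjacent : E p q ≡ true ⊎ E p q ≡ false → Goal
        adjacent (inj₁ pq) = inj₁ (miss touch-R (not-both {Val.S touch-R} λ sp sq → t≢f pq (Val.indep touch-R sp sq)))
        adjacent (inj₂ npq) = common (any? (λ w → (R w ≟ᵇ true) ×-dec (E p w ≟ᵇ true) ×-dec (E q w ≟ᵇ true)))
          where
          common : Dec (CommonNb E R p q) → Goal
          common (yes (w , Rw , a , b)) = inj₂ (w , R⊑V Rw , a , b)
          common (no nw) = inj₁ (miss v (not-both {Val.S v} λ sp sq → t≢f (addE-pq {E} {p} {q}) (Val.indep v⁺ sp sq)))
            where
            E⁺ : Adj
            E⁺ = addE E p q
            gR : Good E R
            gR = good-⊑ g R⊑V
            low-deg : ∀ {j x} → j ∈ terminals → R x ≡ true → E (φ j) x ≡ true → deg E R x ≤ 2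
            low-deg j∈ Rx e = ≤-pred (≤-trans (deg-drop {E} {V} {X} X⊑V (φ∈X (term<8 j∈)) (symm⁺ e)) (cub (R⊑V Rx)))
            deg⁺ : ∀ {x} → R x ≡ true → Dec (x ≡ p) → Dec (x ≡ q) → deg E R x + (ind (does (x ≟ p)) + ind (does (x ≟ q))) ≤ 3
            deg⁺ {x} Rx (yes refl) (yes refl) = ⊥-elim (p≢q refl)
            deg⁺ {x} Rx (yes refl) (no n) rewrite does-refl x | does-≢ n = +-monoˡ-≤ 1 (low-deg j₁∈ Rx ep)
            deg⁺ {x} Rx (no n) (yes refl) rewrite does-refl x | does-≢ n = +-monoˡ-≤ 1 (low-deg j₂∈ Rx eq)
            deg⁺ {x} Rx (no n) (no n′) rewrite does-≢ n | does-≢ n′ = ≤-trans (≤-reflexive (+-identityʳ _)) (Good.cub gR Rx)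
            g⁺ : Good E⁺ R
            g⁺ = record { symm = addE-sym symm ; irr = addE-irr g p≢q
                        ; tri = addE-tri gR p≢q (λ Rw a b → nw (_ , Rw , a , b))
                        ; cub = λ {x} Rx → ≤-trans (≤-reflexive (deg-addE {E} {R} {p} {q} {x} npq (trans (symm q p) npq) p≢q Rp Rq)) (deg⁺ Rx (x ≟ p) (x ≟ q)) }
            co⁺ : Conn E⁺ R
            co⁺ U ne U⊑ cl = coR U ne U⊑ λ {x} {y} u r e → cl u r (addE⁺ {E} {p} {q} {x} {y} e)
            v⁺ : Val E⁺ R 0 4
            v⁺ = conn₂ g⁺ R<m co⁺
            v : Val E R 0 (2 * eb E R X)
            v = val (Val.S v⁺) (Val.S⊑V v⁺) (λ {x} {y} a b → addE-false {E} {p} {q} {x} {y} (Val.indep v⁺ a b))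
              -- The added edge costs 2 and a possibly exceptional graph 4, covered by three of the
              -- edges between R and X.
              (lin 0 (+-mono-≤ (subst (λ z → 14 * card R + 0 ≤ 30 * card (Val.S v⁺) + (z + 4)) (eb-addE {E} {R} symm npq p≢q Rp Rq) (Val.bound v⁺)) three2)
                (lem (card R) (card (Val.S v⁺)) (eb E R R) (eb E R X)))
              where
              three2 : 2 * 3 ≤ 2 * eb E R X
              three2 = *-mono-≤ (≤-refl {2}) three
              lem : ∀ r s e t → 14 * r + 0 + (30 * s + (e + 2 + 4) + 2 * t) + 0 ≡ 30 * s + (e + 2 * t) + (14 * r + 0 + 2 * 3)
              lem = solve-∀
      step₂ : All (λ j → ∃ λ y → R y ≡ true × E (φ j) y ≡ true) terminals → Conn E R ⊎ ∃ (Proper E R) → Goal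
      step₂ outs (inj₁ coR) = step₃ coR outs
      step₂ outs (inj₂ (U , P)) = inj₁ (disconnected P)
      step₁ : Dec (All (λ j → ∃ λ y → R y ≡ true × E (φ j) y ≡ true) terminals) → Goal
      step₁ (yes outs) = step₂ outs (conn? E R)
      step₁ (no n) = let f = someFree terminals (λ x → x) n in
        inj₁ (add touch-R (proj₁ f , proj₁ (proj₂ f) , λ {y} s → ¬true λ e → proj₂ (proj₂ f) (y , Val.S⊑V touch-R s , e)))

  module _ {m : ℕ} (ih : IH m) {E : Adj} {V : VSet} (g : Good E V) (c : card V ≤ m) (co : Conn E V) where
    open IH ih
    open Good g using (symm; symm⁺; irr; cub)

    eight-rule : ∀ {j₁ j₂ φ} → j₁ ∈ 4 ∷ 5 ∷ 6 ∷ 7 ∷ [] → j₂ ∈ 4 ∷ 5 ∷ 6 ∷ 7 ∷ [] → Emb E V (10 , (j₁ , 8) ∷ (j₂ , 9) ∷ proj₂ eightPat) φ →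
                 Val E V 0 2 ⊎ CommonNb E V (φ 8) (φ 9)
    eight-rule {j₁} {j₂} {φ} j₁∈ j₂∈ e = EightRules.pair-rule ih g c co e8 j₁∈ j₂∈ (out (<ᵇ⁻ refl) (λ h → <-irrefl refl h)) (out (<ᵇ⁻ refl) (λ h → <-irrefl refl (≤-trans (m≤n+m _ 1) h)))
        (edge (here refl)) (edge (there (here refl))) (λ h → 8≢9 (inj (<ᵇ⁻ refl) (<ᵇ⁻ refl) h))
      where
      open Emb e
      8≢9 : 8 ≢ 9
      8≢9 ()
      e8 : Emb E V eightPat φ
      e8 = record { inV = λ h → inV (≤-trans h (m≤m+n 8 2)) ; inj = λ h k → inj (≤-trans h (m≤m+n 8 2)) (≤-trans k (m≤m+n 8 2))
                  ; edges = All.tail (All.tail edges) }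
      out : ∀ {i} → i < 10 → ¬ (i < 8) → Eight.R ih g c co e8 (φ i) ≡ true
      out {i} h n = ∖-intro {V} {Eight.X ih g c co e8} (inV h) (¬true λ x → no-X (Eight.X⁻ ih g c co e8 x))
        where
        no-X : (∃ λ j → j ∈ upTo 8 × φ i ≡ φ j) → ⊥
        no-X (j , jm , eq) = n (subst (_< 8) (sym (inj h (≤-trans (∈-upTo⁻ jm) (m≤m+n 8 2)) eq)) (∈-upTo⁻ jm))

    crude-val : ∀ {cf φ I} → Valid E V cf φ → crudeᵇ cf I ≡ true → Val E V 0 2
    crude-val {cf} {φ} {I} v h = cut-val {E} {V} {Xs} {Is} {0} {2 * eb E (V ∖ Xs) Xs} {0} {2} symm (Removal.isCut R)
        (Touch.touch ih g {Xs} X⊑V (card (V ∖ Xs)) (V ∖ Xs) ≤-refl (≤-trans (card-∖< {V} {Xs} X⊑V (proj₂ ne)) c) (λ p → p) touches)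
        (subst (λ z → 14 * card Xs + eb E Xs Xs + (0 + 2 * eb E (V ∖ Xs) Xs) ≤ 30 * card Is + 2 * z + (0 + 2)) (sym eXV)
          (lin 0 (+-mono-≤ (subst₂ (λ a b → 14 * a ≤ 30 * b + knownSum cf (removed cf I) + 2) (sym (Removal.card-X R)) (sym (Removal.card-I R)) (≤ᵇ⁻ {14 * length (removed cf I)} (proj₂ (∧-true {structᵇ cf I} h))))
              (Leaf.known-bound g v {removed cf I} (Removal.X-unique R)))
            (lem (card Xs) (card Is) (knownSum cf (removed cf I)) (eb E Xs Xs) (eb E (V ∖ Xs) Xs))))
      where
      Xs Is : VSet
      Xs = ⟪ map φ (removed cf I) ⟫
      Is = ⟪ map φ I ⟫
      R : Removal E V cf φ I
      R = Leaf.removal g v {I} (proj₁ (∧-true {structᵇ cf I} h))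
      X⊑V : Xs ⊑ V
      X⊑V = Cut.X⊑V (Removal.isCut R)
      ne = Removal.X-nonempty R
      eXV : eb E Xs V ≡ eb E (V ∖ Xs) Xs + eb E Xs Xs
      eXV = trans (eb-splitʳ {E} Xs (split-∖ {V} {Xs} X⊑V)) (cong (_+ eb E Xs Xs) (eb-comm Xs (V ∖ Xs) symm))
      touches : Touch.Touches ih g (V ∖ Xs) Xs
      touches U neU U⊑ cl = from (meets? E U Xs)
        where
        from : Meets E U Xs ⊎ Apart E U Xs →
               Meets E U Xs
        from (inj₁ h) = h
        from (inj₂ h) = ⊥-elim (t≢f (proj₂ ne) (∖-not {V} {Xs} (U⊑ (co U neU (λ p → ∖⊑ {V} {Xs} (U⊑ p)) (closed-lift {E} {V} {Xs} {U} h cl) (X⊑V (proj₂ ne))))))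
      lem : ∀ x i k e f → 14 * x + e + (0 + 2 * f) + (30 * i + k + 2 + e) + 0 ≡ 30 * i + 2 * (f + e) + (0 + 2) + (14 * x + k)
      lem = solve-∀

    eight-thm : ∀ {φ} → Emb E V eightPat φ → Val E V 0 2
    eight-thm {φ} e = Soundness.sound sem eightCert (emb-valid e refl) eightOK
      where
      -- An isolated x would form a closed set by itself, but `V` contains more than one vertex of
      -- F₈.
      degs : ∀ {x} → V x ≡ true → 1 ≤ deg E V x
      degs {x} v = decide (1 ≤? deg E V x)
        where
        Xx : VSet
        Xx = ⟪ x ∷ [] ⟫
        single : ∀ {y} → Xx y ≡ true → y ≡ x
        single {y} = ⟪⟫-single {x} {y}
        decide : Dec (1 ≤ deg E V x) → 1 ≤ deg E V x
        decide (yes d) = d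
        decide (no n) = ⊥-elim (0≢1 (Emb.inj e (<ᵇ⁻ refl) (<ᵇ⁻ refl) (trans (single (all (Emb.inV e {0} (<ᵇ⁻ refl)))) (sym (single (all (Emb.inV e {1} (<ᵇ⁻ refl))))))))
          where
          0≢1 : 0 ≢ 1
          0≢1 ()
          all : V ⊑ Xx
          all = co Xx (x , ⟪⟫⁺ {x ∷ []} (here refl)) (λ {y} h → subst (λ z → V z ≡ true) (sym (single {y} h)) v)
            λ {y} {z} h vz yz → ⊥-elim (n (deg-pos {E} {V} vz (subst (λ w → E w z ≡ true) (single {y} h) yz)))
      Excl : (ℕ → Vx) → Vx → Set
      Excl φ w = ∀ {e} → e ∈ [] → e < 10 → w ≢ φ e × E (φ e) w ≡ false
      wrap : ∀ {φ} → Val E V 0 2 ⊎ (CommonNb E V (φ 8) (φ 9)) →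
             Val E V 0 2 ⊎ ∃ λ w → V w ≡ true × E (φ 8) w ≡ true × E (φ 9) w ≡ true × Excl φ w
      wrap (inj₁ v) = inj₁ v
      wrap (inj₂ (w , a , b , c)) = inj₂ (w , a , b , c , λ ())
      sem : Sem eightMode E V (Val E V 0 2)
      sem = record { good = g ; c4free = λ () ; degs = degs ; killed = λ ()
                   ; ruled = λ { (here refl) φ e _ → wrap {φ} (eight-rule {4} {6} (here refl) (there (there (here refl))) e)
                               ; (there (here refl)) φ e _ → wrap {φ} (eight-rule {4} {5} (here refl) (there (here refl)) e) }
                   ; leafed = λ cf φ I v h → crude-val {cf} {φ} {I} v h
                   ; isoed = λ () }

  -- Connected cubic graphs

  Bridge : Adj → VSet → VSet → Vx → Vx → Set
  Bridge E A B q t = ∀ {x y} → A x ≡ true → B y ≡ true → E x y ≡ true → x ≡ q × y ≡ t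

  bridge-union : ∀ {E V B q t a b a′ b′} → Symm E → B ⊑ V → Bridge E (V ∖ B) B q t →
                 (v₁ : Val E (V ∖ B) a b) (v₂ : Val E B a′ b′) → Val.S v₁ q ≡ false ⊎ Val.S v₂ t ≡ false → Val E V (a + a′) (b + b′)
  bridge-union {E} {V} {B} {q} {t} {a} {b} {a′} {b′} sy B⊑V br (val S S⊑ iS bS) (val R R⊑ iR bR) free =
    val (S ∪ R) sub ind′ (subst₂ _≤_ (cong (λ z → 14 * z + (a + a′)) (sym cV)) (cong₂ (λ z w → 30 * z + (w + (b + b′))) (sym cS) (sym eV)) final)
    where
    A = V ∖ B
    spl = split-∖ {V} {B} B⊑V
    cV = card-split spl
    cS = card-split (split-∪ {S} {R} λ s r → t≢f (R⊑ r) (∖-not {V} {B} (S⊑ s)))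
    eV = eb-split {E} sy spl
    sub : S ∪ R ⊑ V
    sub {x} p = case (∨-case {S x} p)
      where
      case : S x ≡ true ⊎ R x ≡ true → V x ≡ true
      case (inj₁ s) = ∖⊑ {V} {B} (S⊑ s)
      case (inj₂ r) = B⊑V (R⊑ r)
    cross : ∀ {x y} → S x ≡ true → R y ≡ true → E x y ≡ false
    cross {x} {y} s r = ¬true λ e → clash (br (S⊑ s) (R⊑ r) e) free
      where
      clash : x ≡ q × y ≡ t → S q ≡ false ⊎ R t ≡ false → ⊥
      clash (refl , _) (inj₁ f) = t≢f s f
      clash (_ , refl) (inj₂ f) = t≢f r f
    ind′ : Indep E (S ∪ R)
    ind′ {x} {y} p q = case (∨-case {S x} p) (∨-case {S y} q)
      where
      case : S x ≡ true ⊎ R x ≡ true → S y ≡ true ⊎ R y ≡ true → E x y ≡ false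
      case (inj₁ p) (inj₁ q) = iS p q
      case (inj₁ p) (inj₂ q) = cross p q
      case (inj₂ p) (inj₁ q) = trans (sy x y) (cross q p)
      case (inj₂ p) (inj₂ q) = iR p q
    final : 14 * (card A + card B) + (a + a′) ≤ 30 * (card S + card R) + (eb E A A + eb E B B + 2 * eb E B A + (b + b′))
    -- The edges between the two sides only increase the degree sum, so they form the slack.
    final = lin (2 * eb E B A) (+-mono-≤ bS bR) (lem (card A) (card B) (card S) (card R) (eb E A A) (eb E B B) (eb E B A) a b a′ b′)
      where
      lem : ∀ v k s r e f h a b c d → 14 * (v + k) + (a + c) + (30 * s + (e + b) + (30 * r + (f + d))) + 2 * h
        ≡ 30 * (s + r) + (e + f + 2 * h + (b + d)) + (14 * v + a + (14 * k + c))
      lem = solve-∀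

  -- If the vertex q is in every good set of W, then W has 16 to spare.
  avoid : ∀ {E W q} → Good E W → W q ≡ true → Val E W 0 0 → Val E (W ∖ ⟪ q ∷ [] ⟫) 0 0 →
          (Σ (Val E W 0 0) λ v → Val.S v q ≡ false) ⊎ (Val E W 16 0 × Σ (Val E W 0 14) λ v → Val.S v q ≡ false)
  avoid {E} {W} {q} g Wq (val S S⊑ iS bS) (val T₁ T⊑ iT bT) = decide (S q) refl
    where
    open Good g using (symm; irr)
    Q W⁻ : VSet
    Q = ⟪ q ∷ [] ⟫
    W⁻ = W ∖ Q
    only : ∀ {y} → Q y ≡ true → y ≡ q
    only {y} = ⟪⟫-single {q} {y}
    Qq : Q q ≡ true
    Qq = ⟪⟫⁺ {q ∷ []} (here refl)
    spl : Split W W⁻ Q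
    spl = split-∖ {W} {Q} λ {y} h → subst (λ z → W z ≡ true) (sym (only {y} h)) Wq
    T⊑W : T₁ ⊑ W
    T⊑W t = ∖⊑ {W} {Q} (T⊑ t)
    Tq : T₁ q ≡ false
    Tq = ¬true λ t → t≢f Qq (∖-not {W} {Q} (T⊑ t))
    cQ : card Q ≡ 1
    cQ = card-list {q ∷ []} ([] ∷ [])
    cW : card W ≡ card W⁻ + 1
    cW = trans (card-split spl) (cong (card W⁻ +_) cQ)
    eW : eb E W⁻ W⁻ ≤ eb E W W
    eW = ≤-trans (≤-trans (m≤m+n _ (eb E Q Q)) (m≤m+n _ (2 * eb E Q W⁻))) (≤-reflexive (sym (eb-split {E} symm spl)))
    Result : Set
    Result = (Σ (Val E W 0 0) λ v → Val.S v q ≡ false) ⊎ (Val E W 16 0 × Σ (Val E W 0 14) λ v → Val.S v q ≡ false)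
    decide : ∀ b → S q ≡ b → Result
    decide false n = inj₁ (val S S⊑ iS bS , n)
    decide true Sq = compare (card T₁ <? card S)
      where
      compare : Dec (card T₁ < card S) → Result
      compare (no ge) = inj₁ (val T₁ T⊑W iT (≤-trans bS (+-monoˡ-≤ _ (*-mono-≤ (≤-refl {30}) (≮⇒≥ ge)))) , Tq)
      compare (yes lt) = inj₂ (val S S⊑ iS strong , val (S ∖ Q) (λ h → S⊑ (∖⊑ {S} {Q} h)) (λ a b → iS (∖⊑ {S} {Q} a) (∖⊑ {S} {Q} b)) weak , ¬true λ h → t≢f Qq (∖-not {S} {Q} h))
        where
        -- S is larger by at least one vertex and only q was deleted: 30 - 14 = 16. Dropping q from
        -- S then leaves a debt of 30 - 16 = 14.
        strong : 14 * card W + 16 ≤ 30 * card S + (eb E W W + 0)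
        strong = subst (λ z → 14 * z + 16 ≤ 30 * card S + (eb E W W + 0)) (sym cW)
          (lin 0 (+-mono-≤ bT (+-mono-≤ eW (*-mono-≤ (≤-refl {30}) lt))) (lem (card W⁻) (card T₁) (card S) (eb E W⁻ W⁻) (eb E W W)))
          where
          lem : ∀ w t s e f → 14 * (w + 1) + 16 + (30 * t + (e + 0) + (f + 30 * s)) + 0 ≡ 30 * s + (f + 0) + (14 * w + 0 + (e + 30 * (1 + t)))
          lem = solve-∀
        cS : card S ≡ card (S ∖ Q) + 1
        cS = trans (card-split (split-∖ {S} {Q} λ {y} h → subst (λ z → S z ≡ true) (sym (only {y} h)) Sq)) (cong (card (S ∖ Q) +_) cQ)
        weak : 14 * card W + 0 ≤ 30 * card (S ∖ Q) + (eb E W W + 14)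
        weak = lin 0 (subst (λ z → 14 * card W + 16 ≤ 30 * z + (eb E W W + 0)) cS strong) (lem (card W) (card (S ∖ Q)) (eb E W W))
          where
          lem : ∀ w s e → 14 * w + 0 + (30 * (s + 1) + (e + 0)) + 0 ≡ 30 * s + (e + 14) + (14 * w + 16)
          lem = solve-∀

  module Cubic {m : ℕ} (ih : IH m) {E : Adj} {V : VSet} (g : Good E V) (c : card V ≤ m) (co : Conn E V)
    (f8 : Free E V eightPat) (cubic : ∀ {x} → V x ≡ true → 3 ≤ deg E V x) where
    open IH ih
    open Good g using (symm; symm⁺; irr; cub; adj≢)

    Goal : Set
    Goal = Val E V 0 2 ⊎ F14 E V

    rest-loose : ∀ {X} → Nonempty X → X ⊑ V → Loose E (V ∖ X)
    rest-loose ne s = loose-conn {E} {V} g s ne co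

    rest-free : ∀ {X} → Free E (V ∖ X) eightPat
    rest-free {X} = free-⊑ {E} {V ∖ X} {V} {eightPat} (∖⊑ {V} {X}) f8

    rest-val : ∀ {X} → Nonempty X → X ⊑ V → Val E (V ∖ X) 0 0
    rest-val {X} ne s = low (good-⊑ g (∖⊑ {V} {X})) (≤-trans (card-∖< {V} {X} s (proj₂ ne)) c) (rest-loose ne s) (rest-free {X})

    square-val : ∀ {φ} → Emb E V squarePat φ → Val E V 0 2
    square-val e = Soundness.sound sem squareCert (emb-valid e refl) squareOK
      where
      sem : Sem squareMode E V (Val E V 0 2)
      sem = record { good = g ; c4free = λ () ; degs = cubic ; killed = λ { (here refl) → f8 } ; ruled = λ ()
                   ; leafed = λ c′ φ I v h → leaf-val {c = c′} {φ} {I} {false} {3} {0} {2} g (λ ()) cubic rest-val v h ; isoed = λ () }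

    -- Both sides have λ ≥ 0, and their sets can clash only at q t. If one side can avoid its end,
    -- they combine. Otherwise both have 16 to spare, and this amount on the side of t pays the 14
    -- for dropping q.
    bridge-val : ∀ {B q t} → B ⊑ V → V q ≡ true → B q ≡ false → B t ≡ true → Bridge E (V ∖ B) B q t → Val E V 0 2
    bridge-val {B} {q} {t} B⊑V Vq Bq Bt br = finish
        (avoid {E} {A} {q} gA Aq vA (low (good-⊑ gA (∖⊑ {A} {⟪ q ∷ [] ⟫})) (≤-trans (card-∖< {A} {⟪ q ∷ [] ⟫} {q} (one {A} Aq) (⟪⟫⁺ {q ∷ []} (here refl))) (card≤ (∖⊑ {V} {B})))
          (loose-∖ {E} {A} {⟪ q ∷ [] ⟫} gA (one {A} Aq) lA) (λ φ e → f8 φ (wide (λ h → ∖⊑ {V} {B} (∖⊑ {A} {⟪ q ∷ [] ⟫} h)) e))))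
        (avoid {E} {B} {t} gB Bt vB (low (good-⊑ gB (∖⊑ {B} {⟪ t ∷ [] ⟫})) (≤-trans (card-∖< {B} {⟪ t ∷ [] ⟫} {t} (one {B} Bt) (⟪⟫⁺ {t ∷ []} (here refl))) (card≤ B⊑V))
          (loose-∖ {E} {B} {⟪ t ∷ [] ⟫} gB (one {B} Bt) lB) (λ φ e → f8 φ (wide (λ h → B⊑V (∖⊑ {B} {⟪ t ∷ [] ⟫} h)) e))))
      where
      A : VSet
      A = V ∖ B
      wide : ∀ {U W φ} → U ⊑ W → Emb E U eightPat φ → Emb E W eightPat φ
      wide s e = record { inV = λ h → s (Emb.inV e h) ; inj = Emb.inj e ; edges = Emb.edges e }
      card≤ : ∀ {U} → U ⊑ V → card U ≤ m
      card≤ s = ≤-trans (card-mono s) c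
      one : ∀ {W : VSet} {x} → W x ≡ true → ⟪ x ∷ [] ⟫ ⊑ W
      one {W} Wx = ⟪⟫-⊑ {V = W} (Wx ∷ [])
      Aq : A q ≡ true
      Aq = ∖-intro {V} {B} Vq Bq
      gA = good-⊑ g (∖⊑ {V} {B})
      gB = good-⊑ g B⊑V
      lA : Loose E A
      lA = rest-loose {B} (t , Bt) B⊑V
      vA : Val E A 0 0
      vA = rest-val {B} (t , Bt) B⊑V
      lB : Loose E B
      lB U ne U⊑ cl = from (meets? E U A)
        where
        from : Meets E U A ⊎ Apart E U A → ∃ λ u → U u ≡ true × deg E B u ≤ 2
        from (inj₁ (u , Uu , x , Ax , ux)) = u , Uu , ≤-pred (≤-trans (lin 0 (deg-pos {E} {A} Ax ux) (trans (lem (deg E B u) (deg E A u)) (cong (_+ 1) (sym (deg-split u (split-∖ {V} {B} B⊑V)))))) (cub (B⊑V (U⊑ Uu))))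
          where
          lem : ∀ a b → suc a + b + 0 ≡ b + a + 1
          lem = solve-∀
        from (inj₂ h) = ⊥-elim (t≢f (U⊑ (co U ne (λ p → B⊑V (U⊑ p)) (λ {x} {y} p Vy e → in-B p Vy e (bool? (B y))) Vq)) Bq)
          where
          in-B : ∀ {x y} → U x ≡ true → V y ≡ true → E x y ≡ true → B y ≡ true ⊎ B y ≡ false → U y ≡ true
          in-B p Vy e (inj₁ By) = cl p By e
          in-B p Vy e (inj₂ nBy) = ⊥-elim (h p (∖-intro {V} {B} Vy nBy) e)
      vB : Val E B 0 0
      vB = low-val (card≤ B⊑V)
        where
        low-val : card B ≤ m → Val E B 0 0
        low-val h = low gB (≤-trans (≤-trans (≤-trans (s≤s (m≤m+n (card B) 0)) (+-mono-≤ (mem≤card {A} Aq) (≤-reflexive (+-identityʳ (card B))))) (≤-reflexive (sym (card-split (split-∖ {V} {B} B⊑V))))) c)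
          lB (λ φ e → f8 φ (wide B⊑V e))
      finish : (Σ (Val E A 0 0) λ v → Val.S v q ≡ false) ⊎ (Val E A 16 0 × Σ (Val E A 0 14) λ v → Val.S v q ≡ false) →
               (Σ (Val E B 0 0) λ v → Val.S v t ≡ false) ⊎ (Val E B 16 0 × Σ (Val E B 0 14) λ v → Val.S v t ≡ false) → Val E V 0 2
      finish (inj₁ (v₁ , n)) _ = val-weaken {c = 0} {d = 0} z≤n (bridge-union {E} {V} {B} {q} {t} symm B⊑V br v₁ vB (inj₁ n))
      finish _ (inj₁ (v₂ , n)) = val-weaken {c = 0} {d = 0} z≤n (bridge-union {E} {V} {B} {q} {t} symm B⊑V br vA v₂ (inj₂ n))
      finish (inj₂ (_ , v₁ , n)) (inj₂ (v₂ , _)) = val-weaken {c = 16} {d = 14} (m≤m+n 14 4) (bridge-union {E} {V} {B} {q} {t} symm B⊑V br v₁ v₂ (inj₁ n))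

    -- In a cubic triangle-free graph N[v] spans 3 edges and has degree sum 12, so the loss is 56 +
    -- 6 - 30 - 24 = 8. Of these, 2 are tolerated and `lift` asks for the other 6. The six edges
    -- leaving N[v] give the rest a total deficiency of 6, which is `gap`.
    record Star (v : Vx) : Set where
      field
        X    : VSet
        v∈X  : X v ≡ true
        X⊑V  : X ⊑ V
        nb∈X : ∀ {y} → V y ≡ true → E v y ≡ true → X y ≡ true
        X⁻   : ∀ {y} → X y ≡ true → y ≡ v ⊎ E v y ≡ true
        lift : Val E (V ∖ X) 6 0 → Val E V 0 2
        gap  : 6 + eb E (V ∖ X) (V ∖ X) ≤ 3 * card (V ∖ X)

    star : ∀ {v} → V v ≡ true → Star v
    star {v} Vv = record { X = X ; v∈X = Cut.I⊑X (Removal.isCut R) {v} v∈I ; X⊑V = X⊑V ; nb∈X = λ {y} → Cut.nbI (Removal.isCut R) {v} {y} v∈I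
      ; X⁻ = λ {y} h → from (⟪⟫⁻ {map φ (removed cf (0 ∷ []))} {y} h)
      ; lift = λ w → cut-val {E} {V} {X} {I} {6} {0} {0} {2} symm (Removal.isCut R) w bd
      ; gap = gap }
      where
      A = another-nb {E} {V} {v} [] (λ ()) (≤-trans (s≤s z≤n) (cubic Vv))
      a = proj₁ A
      B = another-nb {E} {V} {v} {a ∷ []} ([] ∷ []) (λ { (here refl) → proj₁ (proj₂ A) , proj₁ (proj₂ (proj₂ A)) }) (≤-trans (s≤s (s≤s z≤n)) (cubic Vv))
      b = proj₁ B
      a≢b : a ≢ b
      a≢b e = ∉-≢ (proj₂ (proj₂ (proj₂ B))) (sym e)
      D = another-nb {E} {V} {v} {a ∷ b ∷ []} (unique₂ a≢b) (λ { (here refl) → proj₁ (proj₂ A) , proj₁ (proj₂ (proj₂ A)) ; (there (here refl)) → proj₁ (proj₂ B) , proj₁ (proj₂ (proj₂ B)) }) (cubic Vv)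
      d = proj₁ D
      va = proj₁ (proj₂ (proj₂ A))
      vb = proj₁ (proj₂ (proj₂ B))
      vd = proj₁ (proj₂ (proj₂ D))
      d∉ = proj₂ (proj₂ (proj₂ D))
      φ : ℕ → Vx
      φ = images (v ∷ a ∷ b ∷ d ∷ []) v
      cf : Cfg
      cf = cfg 4 [] ((0 , 1) ∷ (0 , 2) ∷ (0 , 3) ∷ [])
      vl : Valid E V cf φ
      vl = listed-valid {xs = v ∷ a ∷ b ∷ d ∷ []} {fin = []} {es = (0 , 1) ∷ (0 , 2) ∷ (0 , 3) ∷ []} {d = v} (record
        { inV = Vv ∷ proj₁ (proj₂ A) ∷ proj₁ (proj₂ B) ∷ proj₁ (proj₂ D) ∷ []
        ; uniq = unique₄ (adj≢ va) (adj≢ vb) (adj≢ vd) a≢b (λ e → d∉ (here (sym e))) (λ e → d∉ (there (here (sym e))))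
        ; edges = va ∷ vb ∷ vd ∷ [] ; done = [] }) refl refl
      X I : VSet
      X = ⟪ map φ (removed cf (0 ∷ [])) ⟫
      I = ⟪ map φ (0 ∷ []) ⟫
      gc : Removal E V cf φ (0 ∷ []) × 14 * card X + eb E X X + 0 ≤ 30 * card I + 2 * eb E X V + 8
      gc = Leaf.gain-cut g vl {0 ∷ []} {false} {3} {0} {8} refl (λ ()) cubic
      R : Removal E V cf φ (0 ∷ [])
      R = proj₁ gc
      X⊑V : X ⊑ V
      X⊑V = Cut.X⊑V (Removal.isCut R)
      v∈I : I v ≡ true
      v∈I = ⟪⟫⁺ {v ∷ []} (here refl)
      from : ∀ {y} → y ∈ map φ (removed cf (0 ∷ [])) → y ≡ v ⊎ E v y ≡ true
      from (here refl) = inj₁ refl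
      from (there (here refl)) = inj₂ va
      from (there (there (here refl))) = inj₂ vb
      from (there (there (there (here refl)))) = inj₂ vd
      bd : 14 * card X + eb E X X + (0 + 0) ≤ 30 * card I + 2 * eb E X V + (6 + 2)
      bd = proj₂ gc
      gap : 6 + eb E (V ∖ X) (V ∖ X) ≤ 3 * card (V ∖ X)
      gap = lin 0 (+-mono-≤ (subst₂ (λ x i → 14 * x + eb E X X + 0 ≤ 30 * i + 2 * eb E X V + 8) (Removal.card-X R) (Removal.card-I R) (proj₂ gc))
              (+-mono-≤ (subst (eb E V V ≤_) (cong (_* 3) (trans (card-split (split-∖ {V} {X} X⊑V)) (cong (card (V ∖ X) +_) (Removal.card-X R)))) (eb-upper {E} {V} {V} 3 cub))
                (≤-reflexive (sym (eb-cut {E} {V} {X} symm X⊑V)))))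
              (lem (card (V ∖ X)) (eb E X X) (eb E X V) (eb E V V) (eb E (V ∖ X) (V ∖ X)))
        where
        lem : ∀ w x y v h → 6 + h + (30 * 1 + 2 * y + 8 + ((w + 4) * 3 + (v + x))) + 0 ≡ 3 * w + (14 * 4 + x + 0 + (v + (h + 2 * y)))
        lem = solve-∀

    girth-val : Free E V squarePat → Free E V fivePat → Val E V 0 2
    girth-val fr4 fr5 = decide (any? λ x → V x ≟ᵇ true)
      where
      decide : Dec (∃ λ x → V x ≡ true) → Val E V 0 2
      decide (no n) = val-weaken {c = 0} {d = 0} z≤n (val-empty λ x → ¬true λ v → n (x , v))
      decide (yes (v , Vv)) = lift (girth (good-⊑ g (∖⊑ {V} {X})) (≤-trans (card-∖< {V} {X} {v} X⊑V v∈X) c) (rest-loose {X} (v , v∈X) X⊑V)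
          (free-⊑ {E} {V ∖ X} {V} {squarePat} (∖⊑ {V} {X}) fr4) (free-⊑ {E} {V ∖ X} {V} {fivePat} (∖⊑ {V} {X}) fr5) 6 ≤-refl gap)
        where open Star (star Vv)

  -- 5-cycles in cubic graphs without 4-cycles

  module CubicRules {m : ℕ} (ih : IH m) {E : Adj} {V : VSet} (g : Good E V) (c : card V ≤ m) (co : Conn E V)
    (f8 : Free E V eightPat) (cubic : ∀ {x} → V x ≡ true → 3 ≤ deg E V x) (fr4 : Free E V squarePat) where
    open IH ih
    open Good g using (symm; symm⁺; irr; cub; adj≢; tri)
    open Cubic ih g c co f8 cubic

    noC4 : NoC4 E V
    noC4 = no-square g fr4

    gain-goal : ∀ {cf φ I} → Valid E V cf φ → gainᵇ true 3 0 2 cf I ≡ true → Goal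
    gain-goal {cf} {φ} {I} v h = inj₁ (leaf-val {c = cf} {φ} {I} {true} {3} {0} {2} g (λ _ → noC4) cubic rest-val v h)

    -- s t is the edge opposite to v in the 5-cycle v x s t y, and p, q are the third neighbours of
    -- s and t.
    record Pent (v x s t y p q : Vx) : Set where
      field
        v∈ : V v ≡ true
        x∈ : V x ≡ true
        s∈ : V s ≡ true
        t∈ : V t ≡ true
        y∈ : V y ≡ true
        p∈ : V p ≡ true
        q∈ : V q ≡ true
        vx : E v x ≡ true
        vy : E v y ≡ true
        xs : E x s ≡ true
        yt : E y t ≡ true
        st : E s t ≡ true
        sp : E s p ≡ true
        tq : E t q ≡ true
        s≢v : s ≢ v
        t≢v : t ≢ v
        p≢x : p ≢ x
        p≢t : p ≢ t
        q≢y : q ≢ y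
        q≢s : q ≢ s

    module Center {v x s t y p q : Vx} (P : Pent v x s t y p q) where
      open Pent P
      open Star (star v∈)

      H : VSet
      H = V ∖ X

      H⊑V : H ⊑ V
      H⊑V = ∖⊑ {V} {X}

      in-H : ∀ {z} → V z ≡ true → z ≢ v → (E v z ≡ true → ⊥) → H z ≡ true
      in-H {z} Vz ne na = ∖-intro {V} {X} Vz (¬true λ h → case (X⁻ h))
        where
        case : z ≡ v ⊎ E v z ≡ true → ⊥
        case (inj₁ e) = ne e
        case (inj₂ e) = na e

      not-X : ∀ {z} → H z ≡ true → X z ≡ true → ⊥
      not-X h k = t≢f k (∖-not {V} {X} h)

      x∈X : X x ≡ true
      x∈X = nb∈X x∈ vx

      y∈X : X y ≡ true
      y∈X = nb∈X y∈ vy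

      Hs : H s ≡ true
      Hs = in-H s∈ s≢v (tri v∈ x∈ s∈ vx xs)

      Ht : H t ≡ true
      Ht = in-H t∈ t≢v (tri v∈ y∈ t∈ vy yt)

      Hp : H p ≡ true
      Hp = in-H p∈ (λ { refl → tri v∈ x∈ s∈ vx xs (symm⁺ sp) }) λ e → noC4 v∈ x∈ s∈ p∈ vx xs sp e s≢v (p≢x ∘ sym)

      Hq : H q ≡ true
      Hq = in-H q∈ (λ { refl → tri v∈ y∈ t∈ vy yt (symm⁺ tq) }) λ e → noC4 v∈ y∈ t∈ q∈ vy yt tq e t≢v (q≢y ∘ sym)

      p≢q : p ≢ q
      p≢q refl = tri s∈ t∈ q∈ st tq sp

      npq : E p q ≡ false
      npq = ¬true λ e → noC4 p∈ s∈ t∈ q∈ (symm⁺ sp) st tq e (p≢t ∘ sym) (q≢s ∘ sym)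

      gH : Good E H
      gH = good-⊑ g H⊑V

      loseX : ∀ {z u} → V z ≡ true → X u ≡ true → E z u ≡ true → deg E H z ≤ 2
      loseX Vz Xu e = ≤-pred (≤-trans (deg-drop {E} {V} {X} X⊑V Xu e) (cub Vz))

      PH : Pair E H s t p q
      PH = pair-from gH Hs Ht Hp Hq st sp tq (loseX s∈ x∈X (symm⁺ xs)) (loseX t∈ y∈X (symm⁺ yt)) p≢t q≢s p≢q

      Common Tight Result : Set
      Common = CommonNb E H p q
      Tight  = Σ VSet λ K → K s ≡ true × K ⊑ H × Closed E H K × (∀ {u} → K u ≡ true → u ≢ s → u ≢ t → 3 ≤ deg E H u)
      Result = Goal ⊎ Common ⊎ Tight

      module Suppressed (noc : ∀ {w} → H w ≡ true → E p w ≡ true → E q w ≡ true → ⊥) where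
        open Comp (component {E} H s symm Hs) renaming (conn to K-conn; closed to K-closed; K⊑V to K⊑H)
        K⊑V : K ⊑ V
        K⊑V k = H⊑V (K⊑H k)
        gK : Good E K
        gK = good-⊑ g K⊑V
        t∈K = K-closed s∈K Ht st
        PK : Pair E K s t p q
        PK = record { s∈ = s∈K ; t∈ = t∈K ; p∈ = K-closed s∈K Hp sp ; q∈ = K-closed t∈K Hq tq ; st = st ; sp = sp ; tq = tq
                    ; nbS = λ k e → Pair.nbS PH (K⊑H k) e ; nbT = λ k e → Pair.nbT PH (K⊑H k) e ; p≢t = p≢t ; q≢s = q≢s ; p≢q = p≢q }
        module Su = Suppress gK PK npq (λ k a b → noc (K⊑H k) a b)
        open Su using (V⁻; E⁺; V⁻⊑V)

        X<m : card (V ∖ X) < m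
        X<m = ≤-trans (card-∖< {V} {X} {v} X⊑V v∈X) c

        -- The 6 gained by suppression are exactly what `lift` asks for, so the suppressed component
        -- itself must not lose anything; this is why it has to be loose and without F₈.
        good-case : ∀ {u} → V⁻ u ≡ true → deg E H u ≤ 2 → Free E⁺ V⁻ eightPat → Val E V 0 2
        good-case {u} vu d fr = lift (val-union {E} {H} {K} {6} {0} {0} {0} symm K⊑H K-closed
          (Su.supp-val (low Su.good (supp-card< ih {H} {K} Su.card-supp K⊑H (≤-trans (m≤n+m _ 1) X<m))
            (loose-low (Su.supp-conn K-conn) vu (≤-trans (≤-reflexive (trans (Su.deg-supp vu) (sym (closed-deg {E} {H} {K} K⊑H K-closed (V⁻⊑V vu))))) d)) fr))
          (low (good-⊑ gH (∖⊑ {H} {K})) (≤-trans (s≤s (card-mono (∖⊑ {H} {K}))) X<m) (loose-∖ {E} {H} {K} gH K⊑H (rest-loose {X} (v , v∈X) X⊑V))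
            (free-⊑ {E} {H ∖ K} {V} {eightPat} (λ h → H⊑V (∖⊑ {H} {K} h)) f8)))

        -- The eight-vertex graph using the new edge p q, with that edge subdivided by s and t.
        split-goal : ∀ {ψ} → Emb E⁺ V⁻ eightPat ψ → p ≡ ψ 0 → q ≡ ψ 1 → Goal
        split-goal {ψ} e refl refl = Soundness.sound sem splitCert
            (listed-valid {xs = xs₁₃} {fin = []} {es = Cfg.es splitCfg} {d = s} L refl refl) splitOK
          where
          open Emb e using (inV; inj; edge!)
          xs₈ xs₅ xs₁₃ : List Vx
          xs₈ = map ψ (upTo 8)
          xs₅ = s ∷ t ∷ x ∷ y ∷ v ∷ []
          xs₁₃ = xs₈ ++ xs₅
          J : Joins p q (ψ 0) (ψ 1)
          J = inj₁ (refl , refl)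
          old : ∀ a b → edgeᵇ a b (proj₂ eightPat) ≡ true → (a <ᵇ 8) ≡ true → (b <ᵇ 8) ≡ true → sameEdgeᵇ 0 1 a b ≡ false → E (ψ a) (ψ b) ≡ true
          old a b h a< b< ne = old-edge {E} {V⁻} {eightPat} e (<ᵇ⁻ {0} {8} refl) (<ᵇ⁻ {1} {8} refl) (<ᵇ⁻ a<) (<ᵇ⁻ b<) J (edge! a b h) ne
          V! : ∀ {i} → i < 8 → V⁻ (ψ i) ≡ true
          V! h = inV h
          uniq₈ : Unique xs₈
          uniq₈ = unique-map ψ (λ a b eq → inj (∈-upTo⁻ a) (∈-upTo⁻ b) eq) (uniq⁻ {upTo 8} refl)
          x≢y : x ≢ y
          x≢y refl = tri s∈ t∈ x∈ st (symm⁺ yt) (symm⁺ xs)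
          uniq₅ : Unique xs₅
          uniq₅ = unique₅ (adj≢ st) (adj≢ xs ∘ sym) (λ { refl → tri v∈ x∈ s∈ vx xs vy }) s≢v (λ { refl → tri v∈ y∈ t∈ vy yt vx }) (adj≢ yt ∘ sym) t≢v x≢y (adj≢ vx ∘ sym) (adj≢ vy ∘ sym)
          disj : ∀ {z} → z ∈ xs₈ × z ∈ xs₅ → ⊥
          disj {z} (a , b) = go (∈-map⁻ ψ a) b
            where
            go : (∃ λ i → i ∈ upTo 8 × z ≡ ψ i) → z ∈ xs₅ → ⊥
            go (i , im , refl) (here eq) = Su.V⁻≢s (V! (∈-upTo⁻ im)) eq
            go (i , im , refl) (there (here eq)) = Su.V⁻≢t (V! (∈-upTo⁻ im)) eq
            go (i , im , refl) (there (there (here eq))) = not-X (K⊑H (V⁻⊑V (V! (∈-upTo⁻ im)))) (subst (λ z → X z ≡ true) (sym eq) x∈X)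
            go (i , im , refl) (there (there (there (here eq)))) = not-X (K⊑H (V⁻⊑V (V! (∈-upTo⁻ im)))) (subst (λ z → X z ≡ true) (sym eq) y∈X)
            go (i , im , refl) (there (there (there (there (here eq))))) = not-X (K⊑H (V⁻⊑V (V! (∈-upTo⁻ im)))) (subst (λ z → X z ≡ true) (sym eq) v∈X)
          in8 : ∀ {i} → (i <ᵇ 8) ≡ true → V (ψ i) ≡ true
          in8 h = K⊑V (V⁻⊑V (V! (<ᵇ⁻ h)))
          L : Listed E V xs₁₃ [] (Cfg.es splitCfg) s
          L = record
            { inV = in8 {0} refl ∷ in8 {1} refl ∷ in8 {2} refl ∷ in8 {3} refl ∷ in8 {4} refl ∷ in8 {5} refl ∷ in8 {6} refl ∷ in8 {7} refl ∷ s∈ ∷ t∈ ∷ x∈ ∷ y∈ ∷ v∈ ∷ []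
            ; uniq = ++⁺ uniq₈ uniq₅ disj
            ; edges = symm⁺ sp ∷ st ∷ tq
                ∷ old 1 2 refl refl refl refl ∷ old 2 3 refl refl refl refl ∷ old 3 0 refl refl refl refl
                ∷ old 0 4 refl refl refl refl
                ∷ old 1 5 refl refl refl refl
                ∷ old 2 6 refl refl refl refl
                ∷ old 3 7 refl refl refl refl
                ∷ old 4 6 refl refl refl refl
                ∷ old 5 7 refl refl refl refl
                ∷ symm⁺ xs ∷ symm⁺ yt ∷ symm⁺ vx ∷ symm⁺ vy ∷ []
            ; done = [] }
          sem : Sem splitMode E V Goal
          sem = record { good = g ; c4free = λ _ → noC4 ; degs = cubic ; killed = λ { (here refl) → fr4 } ; ruled = λ ()
                       ; leafed = λ cf φ I v h → gain-goal {cf} {φ} {I} v h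
                       ; isoed = λ _ cf φ b js v h → inj₂ (iso-sound {b = b} {js} g co v h) }

        -- One of the edges of the 4-cycle is new, and the symmetries of the eight-vertex graph move it to (0 , 1).
        eight-goal : ∃ (Emb E⁺ V⁻ eightPat) → Goal
        eight-goal (ψ , e) = go (edge? 0 1 refl) (edge? 1 2 refl) (edge? 2 3 refl) (edge? 3 0 refl)
          where
          open Emb e using (inV; edge!; apart)
          edge? : ∀ i j → edgeᵇ i j (proj₂ eightPat) ≡ true → E (ψ i) (ψ j) ≡ true ⊎ Joins p q (ψ i) (ψ j)
          edge? i j h = addE⁻ {E} {p} {q} {ψ i} {ψ j} (edge! i j h)
          turn : ∀ js → embᵇ (cfg 8 [] (proj₂ eightPat)) eightPat js ≡ true → p ≡ ψ (js ‼ 0) → q ≡ ψ (js ‼ 1) → Goal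
          turn js h a b = split-goal {λ i → ψ (js ‼ i)} (Local.embᵇ-sound Su.good (emb-valid e refl) {eightPat} {js} h) a b
          in8 : ∀ {i} → (i <ᵇ 8) ≡ true → V (ψ i) ≡ true
          in8 h = K⊑V (V⁻⊑V (inV (<ᵇ⁻ h)))
          go : E (ψ 0) (ψ 1) ≡ true ⊎ Joins p q (ψ 0) (ψ 1) → E (ψ 1) (ψ 2) ≡ true ⊎ Joins p q (ψ 1) (ψ 2) →
               E (ψ 2) (ψ 3) ≡ true ⊎ Joins p q (ψ 2) (ψ 3) → E (ψ 3) (ψ 0) ≡ true ⊎ Joins p q (ψ 3) (ψ 0) → Goal
          go (inj₂ (inj₁ (a , b))) _ _ _ = turn (0 ∷ 1 ∷ 2 ∷ 3 ∷ 4 ∷ 5 ∷ 6 ∷ 7 ∷ []) refl (sym a) (sym b)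
          go (inj₂ (inj₂ (a , b))) _ _ _ = turn (1 ∷ 0 ∷ 3 ∷ 2 ∷ 5 ∷ 4 ∷ 7 ∷ 6 ∷ []) refl (sym b) (sym a)
          go _ (inj₂ (inj₁ (a , b))) _ _ = turn (1 ∷ 2 ∷ 3 ∷ 0 ∷ 5 ∷ 6 ∷ 7 ∷ 4 ∷ []) refl (sym a) (sym b)
          go _ (inj₂ (inj₂ (a , b))) _ _ = turn (2 ∷ 1 ∷ 0 ∷ 3 ∷ 6 ∷ 5 ∷ 4 ∷ 7 ∷ []) refl (sym b) (sym a)
          go _ _ (inj₂ (inj₁ (a , b))) _ = turn (2 ∷ 3 ∷ 0 ∷ 1 ∷ 6 ∷ 7 ∷ 4 ∷ 5 ∷ []) refl (sym a) (sym b)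
          go _ _ (inj₂ (inj₂ (a , b))) _ = turn (3 ∷ 2 ∷ 1 ∷ 0 ∷ 7 ∷ 6 ∷ 5 ∷ 4 ∷ []) refl (sym b) (sym a)
          go _ _ _ (inj₂ (inj₁ (a , b))) = turn (3 ∷ 0 ∷ 1 ∷ 2 ∷ 7 ∷ 4 ∷ 5 ∷ 6 ∷ []) refl (sym a) (sym b)
          go _ _ _ (inj₂ (inj₂ (a , b))) = turn (0 ∷ 3 ∷ 2 ∷ 1 ∷ 4 ∷ 7 ∷ 6 ∷ 5 ∷ []) refl (sym b) (sym a)
          go (inj₁ a) (inj₁ b) (inj₁ d) (inj₁ f) = ⊥-elim (fr4 _ (square-emb {E} {V} (in8 {0} refl) (in8 {1} refl) (in8 {2} refl) (in8 {3} refl) a b d f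
            (apart {0} {1} refl refl refl) (apart {0} {2} refl refl refl) (apart {0} {3} refl refl refl) (apart {1} {2} refl refl refl) (apart {1} {3} refl refl refl) (apart {2} {3} refl refl refl)))

        result : Result
        result = decide (any? λ u → (V⁻ u ≟ᵇ true) ×-dec (deg E H u ≤? 2))
          where
          decide : Dec (∃ λ u → V⁻ u ≡ true × deg E H u ≤ 2) → Result
          decide (yes (u , vu , d)) = free (free? E⁺ V⁻ 7 (proj₂ eightPat) refl)
            where
            free : Free E⁺ V⁻ eightPat ⊎ ∃ (Emb E⁺ V⁻ eightPat) → Result
            free (inj₁ fr) = inj₁ (inj₁ (good-case vu d fr))
            free (inj₂ e)  = inj₁ (eight-goal e)
          decide (no n) = inj₂ (inj₂ (K , s∈K , K⊑H , K-closed , λ {u} k a b → ≰⇒> λ d → n (u , Su.V⁻-intro k a b , d)))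

      center : Result
      center = decide (any? λ w → (H w ≟ᵇ true) ×-dec (E p w ≟ᵇ true) ×-dec (E q w ≟ᵇ true))
        where
        decide : Dec Common → Result
        decide (yes w) = inj₂ (inj₁ w)
        decide (no n)  = Suppressed.result λ h a b → n (_ , h , a , b)

    -- The common neighbour closes a second 5-cycle through s t. It lies outside N[v] because the
    -- suppression takes place there; this is what the `exclude` list of the rule records.
    pent-rule : ∀ {v x s t y p q} → Pent v x s t y p q → Goal ⊎ ∃ λ w → V w ≡ true × E p w ≡ true × E q w ≡ true × w ≢ v × E v w ≡ false
    pent-rule {v} {x} {s} {t} {y} {p} {q} P = conclude C.center
      where
      open Pent P
      module C = Center P
      open C using (H; H⊑V; not-X; x∈X; y∈X; Hs; Ht; Hp; Hq; loseX)
      Found : Set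
      Found = ∃ λ w → V w ≡ true × E p w ≡ true × E q w ≡ true × w ≢ v × E v w ≡ false
      -- If K hangs on x and y alone, the edge t y can be suppressed after deleting N[x] instead of N[v], or else q t is a bridge.
      tight : C.Tight → (∃ λ z → V z ≡ true × E y z ≡ true × z ∉ v ∷ t ∷ []) → Goal
      tight (K , Ks , K⊑H , clK , t3) (z , z∈ , yz , z∉) = conclude₂ D.center
        where
        open Star (star v∈) using (v∈X; X⊑V; nb∈X)
        Kt : K t ≡ true
        Kt = clK Ks Ht st
        Kp : K p ≡ true
        Kp = clK Ks Hp sp
        Kq : K q ≡ true
        Kq = clK Kt Hq tq
        q≢t : q ≢ t
        q≢t e = adj≢ tq (sym e)
        -- u keeps degree 3 after the deletion of N[v], so none of its neighbours was deleted.
        stays : ∀ {u w} → K u ≡ true → u ≢ s → u ≢ t → V w ≡ true → E u w ≡ true → K w ≡ true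
        stays {u} {w} Ku a b Vw e = clK Ku (∖-intro {V} {Star.X (star v∈)} Vw (¬true λ h → <-irrefl refl (≤-trans (t3 Ku a b) (loseX (H⊑V (K⊑H Ku)) h e)))) e
        out : ∀ {u} → K u ≡ true → Star.X (star v∈) u ≡ true → ⊥
        out k h = not-X (K⊑H k) h
        z≢v : z ≢ v
        z≢v e = z∉ (here e)
        z≢t : z ≢ t
        z≢t e = z∉ (there (here e))
        -- The same 5-cycle seen from x, with t y as the opposite edge.
        Q : Pent x s t y v q z
        Q = record { v∈ = x∈ ; x∈ = s∈ ; s∈ = t∈ ; t∈ = y∈ ; y∈ = v∈ ; p∈ = q∈ ; q∈ = z∈
                   ; vx = xs ; vy = symm⁺ vx ; xs = st ; yt = vy ; st = symm⁺ yt ; sp = tq ; tq = yz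
                   ; s≢v = λ { refl → out Kt x∈X } ; t≢v = λ { refl → tri s∈ t∈ x∈ st (symm⁺ yt) (symm⁺ xs) }
                   ; p≢x = q≢s ; p≢t = q≢y ; q≢y = z≢v ; q≢s = z≢t }
        module D = Center Q
        far : E q y ≡ true → ⊥
        far e = tri t∈ q∈ y∈ tq e (symm⁺ yt)
        -- Starting from q, the vertices w, z and y would in turn stay in K, but y lies in N[v].
        common : D.Common → ⊥
        common (w , Dw , qw , zw) = out (stays Kz z≢s z≢t y∈ (symm⁺ yz)) y∈X
          where
          w≢s : w ≢ s
          w≢s refl = D.not-X Dw D.x∈X
          z≢s : z ≢ s
          z≢s refl = tri s∈ t∈ y∈ st (symm⁺ yt) (symm⁺ yz)
          w≢t : w ≢ t
          w≢t refl = tri y∈ z∈ t∈ yz zw yt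
          Kw : K w ≡ true
          Kw = stays Kq q≢s q≢t (D.H⊑V Dw) qw
          Kz : K z ≡ true
          Kz = stays Kw w≢s w≢t z∈ (symm⁺ zw)
        tight₂ : D.Tight → Goal
        tight₂ (L , Lt , L⊑ , clL , l3) = inj₁ (bridge-val {B} {q} {t} (∖⊑ {V} {Z}) q∈ Bq Bt bridge)
          where
          Lq : L q ≡ true
          Lq = clL Lt D.Hp tq
          p∉L : L p ≡ true → ⊥
          p∉L Lp = <-irrefl refl (≤-trans (l3 Lp p≢t (λ { refl → out Kp y∈X })) (D.loseX p∈ D.x∈X (symm⁺ sp)))
          -- An edge leaving Z ends in s or t. At s it would have to start in p, but p is not in L,
          -- having lost its neighbour s with N[x]; hence q t is the only such edge.
          Z B : VSet
          Z = (λ u → K u ∧ L u) ∖ ⟪ s ∷ t ∷ [] ⟫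
          B = V ∖ Z
          Z-intro : ∀ {u} → K u ≡ true → L u ≡ true → u ≢ s → u ≢ t → Z u ≡ true
          Z-intro a b c d = ∖-intro {λ u → K u ∧ L u} {⟪ s ∷ t ∷ [] ⟫} (∧-intro a b) (⟪⟫-∉ {s ∷ t ∷ []} λ { (here e) → c e ; (there (here e)) → d e })
          Z-K : ∀ {u} → Z u ≡ true → K u ≡ true
          Z-K {u} h = proj₁ (∧-true {K u} (∖⊑ {λ u → K u ∧ L u} {⟪ s ∷ t ∷ [] ⟫} {u} h))
          Z-L : ∀ {u} → Z u ≡ true → L u ≡ true
          Z-L {u} h = proj₂ (∧-true {K u} (∖⊑ {λ u → K u ∧ L u} {⟪ s ∷ t ∷ [] ⟫} {u} h))
          Z≢s : ∀ {u} → Z u ≡ true → u ≢ s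
          Z≢s {u} h refl = t≢f (⟪⟫⁺ {s ∷ t ∷ []} {s} (here refl)) (∖-not {λ u → K u ∧ L u} {⟪ s ∷ t ∷ [] ⟫} {s} h)
          Z≢t : ∀ {u} → Z u ≡ true → u ≢ t
          Z≢t {u} h refl = t≢f (⟪⟫⁺ {s ∷ t ∷ []} {t} (there (here refl))) (∖-not {λ u → K u ∧ L u} {⟪ s ∷ t ∷ [] ⟫} {t} h)
          Bq : B q ≡ false
          Bq = ¬true λ h → t≢f (Z-intro Kq Lq q≢s q≢t) (∖-not {V} {Z} {q} h)
          Bt : B t ≡ true
          Bt = ∖-intro {V} {Z} t∈ (¬true λ h → Z≢t h refl)
          bridge : Bridge E (V ∖ B) B q t
          bridge {a} {b} Aa Bb e = decide (b ≟ s) (b ≟ t)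
            where
            Za : Z a ≡ true
            Za = case (bool? (Z a))
              where
              case : Z a ≡ true ⊎ Z a ≡ false → Z a ≡ true
              case (inj₁ h) = h
              case (inj₂ h) = ⊥-elim (t≢f (∖-intro {V} {Z} (∖⊑ {V} {B} {a} Aa) h) (∖-not {V} {B} {a} Aa))
            Vb : V b ≡ true
            Vb = ∖⊑ {V} {Z} {b} Bb
            Kb : K b ≡ true
            Kb = stays (Z-K Za) (Z≢s Za) (Z≢t Za) Vb e
            decide : Dec (b ≡ s) → Dec (b ≡ t) → a ≡ q × b ≡ t
            decide (yes refl) _ = ⊥-elim (case (Pair.nbS C.PH (K⊑H (Z-K Za)) (symm⁺ e)))
              where
              case : a ≡ t ⊎ a ≡ p → ⊥
              case (inj₁ h) = Z≢t Za h
              case (inj₂ refl) = p∉L (Z-L Za)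
            decide (no _) (yes refl) = case (Pair.nbT C.PH (K⊑H (Z-K Za)) (symm⁺ e)) , refl
              where
              case : a ≡ s ⊎ a ≡ q → a ≡ q
              case (inj₁ h) = ⊥-elim (Z≢s Za h)
              case (inj₂ h) = h
            decide (no b≢s) (no b≢t) = ⊥-elim (t≢f (Z-intro Kb (clL (Z-L Za) Db e) b≢s b≢t) (∖-not {V} {Z} {b} Bb))
              where
              Db : D.H b ≡ true
              Db = D.in-H Vb (λ { refl → out Kb x∈X }) λ xb → out (stays Kb b≢s b≢t x∈ (symm⁺ xb)) x∈X
        conclude₂ : D.Result → Goal
        conclude₂ (inj₁ r) = r
        conclude₂ (inj₂ (inj₁ w)) = ⊥-elim (common w)
        conclude₂ (inj₂ (inj₂ T₁)) = tight₂ T₁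
      conclude : C.Result → Goal ⊎ Found
      conclude (inj₁ r) = inj₁ r
      conclude (inj₂ (inj₁ (w , Hw , pw , qw))) = inj₂ (w , H⊑V Hw , pw , qw , (λ { refl → not-X Hw (Star.v∈X (star v∈)) }) ,
        ¬true λ e → not-X Hw (Star.nb∈X (star v∈) (H⊑V Hw) e))
      conclude (inj₂ (inj₂ T₁)) = inj₁ (tight T₁ (another-nb {E} {V} {y} {v ∷ t ∷ []} (unique₂ (t≢v ∘ sym)) (λ { (here refl) → v∈ , symm⁺ vy ; (there (here refl)) → t∈ , yt }) (cubic y∈)))

    five-goal : ∀ {φ} → Emb E V fivePat φ → Goal
    five-goal e = Soundness.sound sem pentCert (emb-valid e refl) pentOK
      where
      rl : ∀ φ → Emb E V pentPat φ → Goal ⊎ ∃ λ w → V w ≡ true × E (φ 5) w ≡ true × E (φ 6) w ≡ true ×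
           (∀ {e} → e ∈ 0 ∷ [] → e < 7 → w ≢ φ e × E (φ e) w ≡ false)
      rl φ e = wrap (pent-rule (record
          { v∈ = inV! {0} refl ; x∈ = inV! {1} refl ; s∈ = inV! {2} refl ; t∈ = inV! {3} refl ; y∈ = inV! {4} refl ; p∈ = inV! {5} refl ; q∈ = inV! {6} refl
          ; vx = edge! 0 1 refl ; vy = edge! 0 4 refl ; xs = edge! 1 2 refl ; yt = edge! 4 3 refl
          ; st = edge! 2 3 refl ; sp = edge! 2 5 refl ; tq = edge! 3 6 refl
          ; s≢v = apart {2} {0} refl refl refl ; t≢v = apart {3} {0} refl refl refl ; p≢x = apart {5} {1} refl refl refl ; p≢t = apart {5} {3} refl refl refl
          ; q≢y = apart {6} {4} refl refl refl ; q≢s = apart {6} {2} refl refl refl }))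
        where
        open Emb e
        wrap : Goal ⊎ (∃ λ w → V w ≡ true × E (φ 5) w ≡ true × E (φ 6) w ≡ true × w ≢ φ 0 × E (φ 0) w ≡ false) →
               Goal ⊎ ∃ λ w → V w ≡ true × E (φ 5) w ≡ true × E (φ 6) w ≡ true × (∀ {e} → e ∈ 0 ∷ [] → e < 7 → w ≢ φ e × E (φ e) w ≡ false)
        wrap (inj₁ r) = inj₁ r
        wrap (inj₂ (w , a , b , d , e , f)) = inj₂ (w , a , b , d , λ { (here refl) _ → e , f })
      sem : Sem pentMode E V Goal
      sem = record { good = g ; c4free = λ _ → noC4 ; degs = cubic ; killed = λ { (here refl) → fr4 }
                   ; ruled = λ { (here refl) φ e _ → rl φ e }
                   ; leafed = λ cf φ I v h → gain-goal {cf} {φ} {I} v h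
                   ; isoed = λ _ cf φ b js v h → inj₂ (iso-sound {b = b} {js} g co v h) }

  -- The order of the tests matters: the vertex of degree at most 2 is used without F₈, the 4-cycle
  -- in a cubic graph without F₈, and the 5-cycle when there are no 4-cycles either.
  conn-thm : ∀ {m} → IH m → ∀ {E V} → Good E V → card V ≤ m → Conn E V → Val E V 0 2 ⊎ F14 E V
  conn-thm ih {E} {V} g c co = eight (free? E V 7 (proj₂ eightPat) refl)
    where
    Goal : Set
    Goal = Val E V 0 2 ⊎ F14 E V
    module _ (f8 : Free E V eightPat) (cubic : ∀ {x} → V x ≡ true → 3 ≤ deg E V x) where
      five : Free E V squarePat → Free E V fivePat ⊎ ∃ (Emb E V fivePat) → Goal
      five fr4 (inj₂ (φ , e)) = CubicRules.five-goal ih g c co f8 cubic fr4 e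
      five fr4 (inj₁ fr5)     = inj₁ (Cubic.girth-val ih g c co f8 cubic fr4 fr5)
      square : Free E V squarePat ⊎ ∃ (Emb E V squarePat) → Goal
      square (inj₂ (φ , e)) = inj₁ (Cubic.square-val ih g c co f8 cubic e)
      square (inj₁ fr4)     = five fr4 (free? E V 4 (proj₂ fivePat) refl)
    low? : Free E V eightPat → Dec (∃ λ u → V u ≡ true × deg E V u ≤ 2) → Goal
    low? f8 (yes (u , v , d)) = inj₁ (val-weaken {c = 0} {d = 0} z≤n (low-thm ih g c (loose-low co v d) f8))
    low? f8 (no n) = square f8 (λ {x} v → ≰⇒> λ d → n (x , v , d)) (free? E V 3 (proj₂ squarePat) refl)
    eight : Free E V eightPat ⊎ ∃ (Emb E V eightPat) → Goal
    eight (inj₂ (φ , e)) = inj₁ (eight-thm ih g c co e)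
    eight (inj₁ f8)      = low? f8 (any? λ u → (V u ≟ᵇ true) ×-dec (deg E V u ≤? 2))

  all-IH : ∀ m → IH m
  all-IH zero    = record { low = λ g () ; girth = λ g () ; conn = λ g () }
  all-IH (suc m) = record
    { low   = λ g c → low-thm (all-IH m) g (≤-pred c)
    ; girth = λ g c → girth-thm (all-IH m) g (≤-pred c)
    ; conn  = λ g c → conn-thm (all-IH m) g (≤-pred c) }

  independence : ∀ {E V} → Good E V → Conn E V → Val E V 0 2 ⊎ F14 E V
  independence {E} {V} g co = conn-thm (all-IH (card V)) g ≤-refl co

-- The independence number of the two exceptional graphs

anyAdj : Bool → Fin 14 → List (Fin 14) → Bool
anyAdj b x ch = anyᵇ (adjF b x) ch

-- A branching search: if it succeeds, an independent set containing `ch` has at most k vertices in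
-- the remaining list. A vertex adjacent to `ch` needs no branch, and with k exhausted every
-- remaining vertex must be of this kind.
small : Bool → ℕ → List (Fin 14) → List (Fin 14) → Bool
small b k       ch []       = true
small b zero    ch (x ∷ xs) = anyAdj b x ch ∧ small b zero ch xs
small b (suc k) ch (x ∷ xs) = (anyAdj b x ch ∨ small b k (x ∷ ch) xs) ∧ small b (suc k) ch xs

small-sound : ∀ b k ch xs (S : Fin 14 → Bool) → (∀ {x y} → S x ≡ true → S y ≡ true → adjF b x y ≡ false) →
              (∀ {x} → x ∈ ch → S x ≡ true) → small b k ch xs ≡ true → length (filterᵇ S xs) ≤ k
small-sound b k ch [] S iS sub h = z≤n
small-sound b zero ch (x ∷ xs) S iS sub h with S x in sx
... | true with anyᵇ⁻ {f = adjF b x} {xs = ch} (proj₁ (∧-true {anyAdj b x ch} h))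
...   | y , m , e = ⊥-elim (t≢f e (iS sx (sub m)))
small-sound b zero ch (x ∷ xs) S iS sub h | false = small-sound b zero ch xs S iS sub (proj₂ (∧-true {anyAdj b x ch} h))
small-sound b (suc k) ch (x ∷ xs) S iS sub h with S x in sx
... | false = small-sound b (suc k) ch xs S iS sub (proj₂ (∧-true {anyAdj b x ch ∨ small b k (x ∷ ch) xs} h))
... | true with ∨-case {anyAdj b x ch} (proj₁ (∧-true {anyAdj b x ch ∨ small b k (x ∷ ch) xs} h))
...   | inj₂ r = s≤s (small-sound b k (x ∷ ch) xs S iS (λ { (here refl) → sx ; (there m) → sub m }) r)
...   | inj₁ r with anyᵇ⁻ {f = adjF b x} {xs = ch} r
...     | y , m , e = ⊥-elim (t≢f e (iS sx (sub m)))

five-max : ∀ b → small b 5 [] (allFin 14) ≡ true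
five-max true  = refl
five-max false = refl

tabulate-count : ∀ {n} (S : Fin n → Bool) → ∣ tabulate S ∣ ≡ sumL (Data.List.tabulate (ind ∘ S))
tabulate-count {zero}  S = refl
tabulate-count {suc n} S with S zero
... | true  = cong suc (tabulate-count (S ∘ suc))
... | false = tabulate-count (S ∘ suc)

module Fourteen = Ambient 14

at-most-five : ∀ b (S : Fin 14 → Bool) → (∀ {x y} → S x ≡ true → S y ≡ true → adjF b x y ≡ false) → Fourteen.card S ≤ 5
at-most-five b S iS = ≤-trans (≤-reflexive (trans (sym (Fourteen.els-length S)) (lengths (allFin 14))))
  (small-sound b 5 [] (allFin 14) S iS (λ ()) (five-max b))
  where
  lengths : ∀ xs → length (filter (λ x → S x ≟ᵇ true) xs) ≡ length (filterᵇ S xs)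
  lengths [] = refl
  lengths (x ∷ xs) with S x
  ... | true  = cong suc (lengths xs)
  ... | false = lengths xs

-- Translation to the given graph and the final counts

module _ (G : Graph) where

  private
    N : ℕ
    N = n G
    module A = Ambient N

  whole : Fin N → Bool
  whole _ = true

  card-whole : A.card whole ≡ N
  card-whole = trans (A.card-cong {U = whole} {A.⟪ allFin N ⟫} (λ x → sym (A.⟪⟫⁺ (∈-allFin x))))
    (trans (A.card-list (allFin⁺ N)) (length-tabulate id))

  degree : ∀ u → A.deg (adj G) whole u ≡ degree-of G u
  degree u = trans (A.deg-card (adj G) whole u)
    (trans (A.card-cong {U = λ y → true ∧ adj G u y} {adj G u} (λ _ → refl)) (A.card-sum (adj G u)))

  subset-card : ∀ (S : Fin N → Bool) → ∣ tabulate S ∣ ≡ A.card S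
  subset-card S = trans (tabulate-count S) (sym (trans (A.card-sum S) (cong sumL (map-tabulate id (ind ∘ S)))))

  in-tabulate : ∀ {S : Fin N → Bool} {x} → x ∈ˢ tabulate S → S x ≡ true
  in-tabulate {S} {x} m = trans (sym (lookup∘tabulate S x)) ([]=⇒lookup m)

  independent-tabulate : ∀ {S : Fin N → Bool} → A.Indep (adj G) S → Independent G (tabulate S)
  independent-tabulate i u v a b = i (in-tabulate a) (in-tabulate b)

  independent-lookup : ∀ {S} → Independent G S → A.Indep (adj G) (lookup S)
  independent-lookup {S} i {x} {y} a b = i x y (lookup⇒[]= x S a) (lookup⇒[]= y S b)

  lookup-card : ∀ S → A.card (lookup S) ≡ ∣ S ∣
  lookup-card S = trans (sym (subset-card (lookup S))) (cong ∣_∣ (tabulate∘lookup S))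

  good : Simple G → TriangleFree G → Subcubic G → A.Good (adj G) whole
  good (sy , ir) tf sc = record { symm = sy ; irr = ir ; tri = λ {x} {y} {z} _ _ _ a b d → tf x y z a b d
                                ; cub = λ {x} _ → ≤-trans (≤-reflexive (degree x)) (sc x) }

  connected : Connected G → A.Conn (adj G) whole
  connected co U (z , Uz) _ cl {x} _ = go (co z x) Uz
    where
    go : ∀ {u v} → Walk G u v → U u ≡ true → U v ≡ true
    go Walk.here       h = h
    go (Walk.step e w) h = go w (cl h refl e)

  isomorphic : A.F14 (adj G) whole → Isomorphic G F14-1 ⊎ Isomorphic G F14-2
  isomorphic F = pick which F′
    where
    open A.F14 F
    to : Fin N → Fin 14
    to x = proj₁ (f-sur {x} refl)
    f-to : ∀ x → f (to x) ≡ x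
    f-to x = proj₂ (f-sur {x} refl)
    bij : Fin N ⤖ Fin 14
    bij = mk⤖ ((λ {x} {y} e → trans (sym (f-to x)) (trans (cong f e) (f-to y))) , λ a → f a , λ { refl → f-inj (f-to (f a)) })
    F′ : ∀ u v → adjF which (to u) (to v) ≡ adj G u v
    F′ u v = trans (sym (f-adj (to u) (to v))) (cong₂ (adj G) (f-to u) (f-to v))
    pick : ∀ b → (∀ u v → adjF b (to u) (to v) ≡ adj G u v) → Isomorphic G F14-1 ⊎ Isomorphic G F14-2
    pick true  h = inj₁ (bij , h)
    pick false h = inj₂ (bij , h)

  bound : Simple G → Connected G → TriangleFree G → Subcubic G → ¬ (Isomorphic G F14-1 ⊎ Isomorphic G F14-2) →
          ∀ a → IsIndependenceNumber G a → 11 * N ≤ 30 * a + 2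
  bound si co tf sc ni a (_ , max) = from (A.independence gd (connected co))
    where
    gd = good si tf sc
    from : A.Val (adj G) whole 0 2 ⊎ A.F14 (adj G) whole → 11 * N ≤ 30 * a + 2
    from (inj₂ F) = ⊥-elim (ni (isomorphic F))
    -- The value gives 14 N ≤ 30 card S + e + 2 with e the degree sum; the claim follows from card S
    -- ≤ a and e ≤ 3 N.
    from (inj₁ v) = lin 0 (+-mono-≤ (subst (λ z → 14 * z + 0 ≤ 30 * A.card S + (A.eb (adj G) whole whole + 2)) card-whole bd)
        (+-mono-≤ (*-mono-≤ (≤-refl {30}) (≤-trans (≤-reflexive (sym (subset-card S))) (max (tabulate S) (independent-tabulate ind′))))
          (≤-trans (A.eb-upper {adj G} {whole} {whole} 3 (A.Good.cub gd)) (≤-reflexive (cong (_* 3) card-whole)))))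
        (lem N (A.card S) a (A.eb (adj G) whole whole))
      where
      open A.Val v renaming (bound to bd; indep to ind′)
      lem : ∀ n s a e → 11 * n + (30 * s + (e + 2) + (30 * a + n * 3)) + 0 ≡ 30 * a + 2 + (14 * n + 0 + (30 * s + e))
      lem = solve-∀

  -- Independent sets are carried along the bijection in both directions, which gives N = 14 and a =
  -- 5; and 30 · 5 + 4 = 11 · 14.
  exact : ∀ b (f : Fin N ⤖ Fin 14) → (∀ u v → adjF b (Bijection.to f u) (Bijection.to f v) ≡ adj G u v) →
          ∀ a → IsIndependenceNumber G a → 30 * a + 4 ≡ 11 * N
  exact b f f-adj a ((S , iS , refl) , max) = trans (cong (λ z → 30 * z + 4) (≤-antisym upper lower)) (cong (11 *_) (sym N≡14))
    where
    open Bijection f using (to; injective; strictlySurjective)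
    from : Fin 14 → Fin N
    from y = proj₁ (strictlySurjective y)
    to-from : ∀ y → to (from y) ≡ y
    to-from y = proj₂ (strictlySurjective y)
    from-to : ∀ x → from (to x) ≡ x
    from-to x = injective (to-from (to x))
    from-inj : ∀ {x y} → from x ≡ from y → x ≡ y
    from-inj {x} {y} e = trans (sym (to-from x)) (trans (cong to e) (to-from y))
    P : Fin 14 → Bool
    P y = lookup S (from y)
    iP : ∀ {x y} → P x ≡ true → P y ≡ true → adjF b x y ≡ false
    iP {x} {y} p q = trans (cong₂ (adjF b) (sym (to-from x)) (sym (to-from y))) (trans (f-adj (from x) (from y)) (independent-lookup {S} iS p q))
    image : ∀ {Q : Fin N → Bool} {R : Fin 14 → Bool} → (∀ {x} → Q x ≡ true → R (to x) ≡ true) → A.card Q ≤ Fourteen.card R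
    image {Q} {R} h = ≤-trans (≤-reflexive (trans (sym (A.els-length Q)) (sym (length-map to (A.els Q)))))
      (Fourteen.card-⟨⟩≤ {map to (A.els Q)} {R} (map⁺ injective (A.els-unique Q)) λ {y} m → hit (∈-map⁻ to (Fourteen.⟪⟫⁻ {map to (A.els Q)} {y} m)))
      where
      hit : ∀ {y} → (∃ λ x → x ∈ A.els Q × y ≡ to x) → R y ≡ true
      hit (x , m , refl) = h (A.els⁻ {Q} m)
    preimage : ∀ {ys : List (Fin 14)} {Q : Fin N → Bool} → Unique ys → (∀ {y} → y ∈ ys → Q (from y) ≡ true) → length ys ≤ A.card Q
    preimage {ys} {Q} u h = ≤-trans (≤-reflexive (sym (length-map from ys)))
      (A.card-⟨⟩≤ {map from ys} {Q} (map⁺ from-inj u) λ {x} m → hit (∈-map⁻ from (A.⟪⟫⁻ {map from ys} {x} m)))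
      where
      hit : ∀ {x} → (∃ λ y → y ∈ ys × x ≡ from y) → Q x ≡ true
      hit (y , m , refl) = h m
    upper : ∣ S ∣ ≤ 5
    upper = ≤-trans (≤-reflexive (sym (lookup-card S))) (≤-trans (image {lookup S} {P} λ {x} h → trans (cong (lookup S) (from-to x)) h) (at-most-five b P iP))
    Q : Fin N → Bool
    Q x = Fourteen.⟪ fiveSet b ⟫ (to x)
    iQ : A.Indep (adj G) Q
    iQ {x} {y} p q = trans (sym (f-adj x y)) (fiveSet-nonadj b (Fourteen.⟪⟫⁻ {fiveSet b} p) (Fourteen.⟪⟫⁻ {fiveSet b} q))
    lower : 5 ≤ ∣ S ∣
    lower = ≤-trans (≤-reflexive (sym (fiveSet-length b))) (≤-trans (preimage {fiveSet b} {Q} (fiveSet-unique b) λ {y} m → Fourteen.⟪⟫⁺ (subst (_∈ fiveSet b) (sym (to-from y)) m))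
      (≤-trans (≤-reflexive (sym (subset-card Q))) (max (tabulate Q) (independent-tabulate iQ))))
    N≡14 : N ≡ 14
    N≡14 = ≤-antisym
      (≤-trans (≤-reflexive (sym card-whole)) (≤-trans (image {whole} {λ _ → true} λ _ → refl) (≤-reflexive (trans (Fourteen.card-cong {U = λ _ → true} {Fourteen.⟪ allFin 14 ⟫} (λ x → sym (Fourteen.⟪⟫⁺ (∈-allFin x)))) (Fourteen.card-list (allFin⁺ 14))))))
      (≤-trans (preimage {allFin 14} {whole} (allFin⁺ 14) λ _ → refl) (≤-reflexive card-whole))

theorem1p11 : (G : Graph) → Simple G → Connected G → TriangleFree G → Subcubic G →
    (¬ (Isomorphic G F14-1 ⊎ Isomorphic G F14-2) →
    ∀ a → IsIndependenceNumber G a → 11 * n G ≤ 30 * a + 2)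
    × ((Isomorphic G F14-1 ⊎ Isomorphic G F14-2) →
    ∀ a → IsIndependenceNumber G a → 30 * a + 4 ≡ 11 * n G)
theorem1p11 G si co tf sc = bound G si co tf sc ,
  λ { (inj₁ (f , f-adj)) → exact G true f f-adj ; (inj₂ (f , f-adj)) → exact G false f f-adj }
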